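{- Let $k\ge2$ be an integer, let $a\in\mathbb{F}_q^*$, and let $\mathcal{F}_k$ be the set of monic polynomials in $\mathbb{F}_q[x]$ which are $k$-th power free. Then, for any $0<B<1$, $$\frac1{q^n}\sum_{\substack{f\in\mathcal{M}_n\\ f,\,f+a\in\mathcal{F}_k}}1=\prod_P\Big(1-\frac{2}{q^{k\deg P}}\Big)+O\Big(\frac1{n^B}\Big),$$ where the product runs over all monic irreducible polynomials $P$.
   Context: $\mathbb{F}_q$ is a fixed finite field of odd cardinality $q$; $\mathcal{M}_n$ is the set of monic polynomials of degree $n$ in $\mathbb{F}_q[x]$. A polynomial is $k$-th power free if it is not divisible by $P^k$ for any monic irreducible $P$. The asymptotic is as $n\to\infty$ with $q,k,a,B$ fixed; the implied constant may depend on them. -}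

module Defs where

open import Algebra.Apartness.Bundles using (HeytingField; HeytingCommutativeRing)
open import Algebra.Bundles using (CommutativeRing)
open import Algebra.Bundles.Raw using (RawSemiring)
import Algebra.Definitions.RawSemiring as RawSemiringDefinitions
import Algebra.Properties.CommutativeSemiring.Exp as Exp
open import Data.Empty using (⊥; ⊥-elim)
open import Data.Fin.Base using (Fin)
import Data.Fin.Properties as FinP
import Data.Integer.Base as ℤ
import Data.Integer.Properties as ℤP
open import Data.List.Base using (List; []; _∷_; map; foldr)
import Data.List.Relation.Binary.Subset.Setoid as Subset
import Data.List.Relation.Unary.Unique.Setoid as UniqueSetoid
open import Data.Nat.Base as ℕ using (ℕ; zero; suc)
import Data.Nat.Properties as ℕP
open import Data.Product.Base using (∃; ∃-syntax; Σ-syntax; _×_; _,_; proj₁; proj₂)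
open import Data.Rational.Base
  using (ℚ; mkℚ; toℚᵘ; 0ℚ; 1ℚ; Positive; _+_; _*_; -_; _-_; 1/_; _/_; _≤_; _<_;
         ↥_; ↧ₙ_; _⊔_; positive; nonNegative)
open import Data.Rational.Properties hiding (heytingCommutativeRing; heytingField)
open import Data.Rational.Solver using (module +-*-Solver)
import Data.Rational.Unnormalised.Base as ℚᵘ
import Data.Rational.Unnormalised.Properties as ℚᵘP
open import Data.Sum.Base using (_⊎_; inj₁; inj₂)
open import Function.Bundles using (Inverse)
open import Level using (0ℓ) renaming (_⊔_ to _⊔ˡ_; suc to lsuc)
open import Relation.Binary.Bundles using (Setoid)
import Relation.Binary.Construct.On as On
open import Relation.Binary.PropositionalEquality as ≡
  using (_≡_; refl; sym; trans; cong; cong₂; subst; subst₂)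
open import Relation.Nullary using (¬_; yes; no)

open Exp (CommutativeRing.commutativeSemiring +-*-commutativeRing) public
  using () renaming (_^_ to _^ℚ_)
private
  module E = Exp (CommutativeRing.commutativeSemiring +-*-commutativeRing)

------------------------------------------------------------------------

record ℝ : Set₁ where
  field
    -- Lower q  means  q < x ;  Upper q  means  x < q
    Lower Upper : ℚ → Set
    lower-inhabited : ∃ Lower
    upper-inhabited : ∃ Upper
    lower-closed : ∀ {p q} → p < q → Lower q → Lower p
    lower-open   : ∀ {p} → Lower p → ∃[ q ] p < q × Lower q
    upper-closed : ∀ {p q} → p < q → Upper p → Upper q
    upper-open   : ∀ {q} → Upper q → ∃[ p ] p < q × Upper p
    disjoint     : ∀ {q} → Lower q → Upper q → ⊥
    located      : ∀ {p q} → p < q → Lower p ⊎ Upper q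

open ℝ

infix 4 _≤ᴿ_ _<ᴿ_

_≤ᴿ_ : ℝ → ℝ → Set
x ≤ᴿ y = ∀ q → Lower x q → Lower y q

_<ᴿ_ : ℝ → ℝ → Set
x <ᴿ y = ∃[ q ] Upper x q × Lower y q

fromℚ : ℚ → ℝ
fromℚ r = record
  { Lower = _< r
  ; Upper = r <_
  ; lower-inhabited = r - 1ℚ , subst (r - 1ℚ <_) (+-identityʳ r) (+-monoʳ-< r (negative⁻¹ (- 1ℚ)))
  ; upper-inhabited = r + 1ℚ , subst (_< r + 1ℚ) (+-identityʳ r) (+-monoʳ-< r (positive⁻¹ 1ℚ))
  ; lower-closed = <-trans
  ; lower-open = λ p<r → let (m , p<m , m<r) = <-dense p<r in m , p<m , m<r
  ; upper-closed = λ p<q r<p → <-trans r<p p<q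
  ; upper-open = λ r<q → let (m , r<m , m<q) = <-dense r<q in m , m<q , r<m
  ; disjoint = <-asym
  ; located = loc
  }
  where
  loc : ∀ {p q} → p < q → p < r ⊎ r < q
  loc {p} {q} p<q with p <? r
  ... | yes p<r = inj₁ p<r
  ... | no  p≮r = inj₂ (≤-<-trans (≮⇒≥ p≮r) p<q)

private
  lower≤ : ∀ x {p q} → p ≤ q → Lower x q → Lower x p
  lower≤ x p≤q l = let (_ , q<s , l′) = lower-open x l in lower-closed x (≤-<-trans p≤q q<s) l′

  upper≤ : ∀ x {p q} → p ≤ q → Upper x p → Upper x q
  upper≤ x p≤q u = let (_ , s<p , u′) = upper-open x u in upper-closed x (<-≤-trans s<p p≤q) u′

  lower<upper : ∀ x {p q} → Lower x p → Upper x q → p < q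
  lower<upper x {p} {q} l u with p <? q
  ... | yes p<q = p<q
  ... | no  p≮q = ⊥-elim (disjoint x l (upper≤ x (≮⇒≥ p≮q) u))

  open +-*-Solver using (solve; con; _:+_; _:*_; _:-_; _:=_)

  r+[s-r] : ∀ r s → r + (s - r) ≡ s
  r+[s-r] = solve 2 (λ r s → r :+ (s :- r) := s) refl

  r-[r-s] : ∀ r s → r - (r - s) ≡ s
  r-[r-s] = solve 2 (λ r s → r :- (r :- s) := s) refl

  shift : ∀ r {s t} → r + s < t → s < t - r
  shift r {s} {t} h = subst (_< t - r) (solve 2 (λ r s → r :+ s :- r := s) refl r s)
                            (+-monoˡ-< (- r) h)

  r--mono : ∀ r {s t} → s < t → r - t < r - s
  r--mono r s<t = +-monoʳ-< r (neg-antimono-< s<t)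

  r--mono-≤ : ∀ r {s t} → s ≤ t → r - t ≤ r - s
  r--mono-≤ r s≤t = +-monoʳ-≤ r (neg-antimono-≤ s≤t)

∣_-_∣ : ℚ → ℝ → ℝ
∣ r - x ∣ = record
  { Lower = L
  ; Upper = U
  ; lower-inhabited = - 1ℚ , inj₁ (negative⁻¹ (- 1ℚ))
  ; upper-inhabited = inhU
  ; lower-closed = closedL
  ; lower-open = openL
  ; upper-closed = λ p<q (l , u) →
      lower-closed x (r--mono r p<q) l , upper-closed x (+-monoʳ-< r p<q) u
  ; upper-open = openU
  ; disjoint = disj
  ; located = loc
  }
  where
  L U : ℚ → Set
  L q = q < 0ℚ ⊎ (Lower x (r + q) ⊎ Upper x (r - q))
  U q = Lower x (r - q) × Upper x (r + q)

  memU : ∀ {s t} → Lower x s → Upper x t → U ((r - s) ⊔ (t - r))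
  memU {s} {t} l u =
      lower≤ x (subst (r - ((r - s) ⊔ (t - r)) ≤_) (r-[r-s] r s) (r--mono-≤ r (p≤p⊔q (r - s) (t - r)))) l
    , upper≤ x (subst (_≤ r + ((r - s) ⊔ (t - r))) (r+[s-r] r t) (+-monoʳ-≤ r (p≤q⊔p (r - s) (t - r)))) u

  inhU : ∃ U
  inhU = let (l , hl) = lower-inhabited x ; (u , hu) = upper-inhabited x in _ , memU hl hu

  closedL : ∀ {p q} → p < q → L q → L p
  closedL p<q (inj₁ q<0)        = inj₁ (<-trans p<q q<0)
  closedL p<q (inj₂ (inj₁ l)) = inj₂ (inj₁ (lower-closed x (+-monoʳ-< r p<q) l))
  closedL p<q (inj₂ (inj₂ u)) = inj₂ (inj₂ (upper-closed x (r--mono r p<q) u))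

  openL : ∀ {p} → L p → ∃[ q ] p < q × L q
  openL (inj₁ p<0) = let (m , p<m , m<0) = <-dense p<0 in m , p<m , inj₁ m<0
  openL (inj₂ (inj₁ l)) with lower-open x l
  ... | s , lt , l′ = s - r , shift r lt , inj₂ (inj₁ (subst (Lower x) (sym (r+[s-r] r s)) l′))
  openL {p} (inj₂ (inj₂ u)) with upper-open x u
  ... | s , lt , u′ = r - s , subst (_< r - s) (r-[r-s] r p) (r--mono r lt)
                            , inj₂ (inj₂ (subst (Upper x) (sym (r-[r-s] r s)) u′))

  openU : ∀ {q} → U q → ∃[ p ] p < q × U p
  openU {q} (l , u) with lower-open x l | upper-open x u
  ... | s , r-q<s , l′ | t , t<r+q , u′ with ⊔-sel (r - s) (t - r)
  ...   | inj₁ eq = _ , subst (_< q) (sym eq) (subst (r - s <_) (r-[r-s] r q) (r--mono r r-q<s))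
                  , memU l′ u′
  ...   | inj₂ eq = _ , subst (_< q) (sym eq)
                          (subst (t - r <_) (solve 2 (λ r q → r :+ q :- r := q) refl r q)
                                 (+-monoˡ-< (- r) t<r+q))
                  , memU l′ u′

  disj : ∀ {q} → L q → U q → ⊥
  disj {q} (inj₁ q<0) (l , u) = <-asym (lower<upper x l u) (+-monoʳ-< r q<-q)
    where
    q<-q : q < - q
    q<-q = <-trans q<0 (neg-antimono-< q<0)
  disj (inj₂ (inj₁ l)) (_ , u) = disjoint x l u
  disj (inj₂ (inj₂ u)) (l , _) = disjoint x l u

  loc : ∀ {p q} → p < q → L p ⊎ U q
  loc p<q with located x (+-monoʳ-< r p<q) | located x (r--mono r p<q)
  ... | inj₁ l | _      = inj₁ (inj₂ (inj₁ l))
  ... | inj₂ _ | inj₂ u = inj₁ (inj₂ (inj₂ u))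
  ... | inj₂ u | inj₁ l = inj₂ (l , u)

infixl 7 _·_

_·_ : (c : ℚ) .{{_ : Positive c}} → ℝ → ℝ
_·_ c {{c>0}} x = record
  { Lower = λ q → Lower x (d * q)
  ; Upper = λ q → Upper x (d * q)
  ; lower-inhabited = let (l , h) = lower-inhabited x in c * l , subst (Lower x) (sym (d*c* l)) h
  ; upper-inhabited = let (u , h) = upper-inhabited x in c * u , subst (Upper x) (sym (d*c* u)) h
  ; lower-closed = λ p<q → lower-closed x (mono p<q)
  ; lower-open = λ {p} h → let (s , lt , h′) = lower-open x h in
      c * s , subst (_< c * s) (c*d* p) (*-monoʳ-<-pos c lt) , subst (Lower x) (sym (d*c* s)) h′
  ; upper-closed = λ p<q → upper-closed x (mono p<q)
  ; upper-open = λ {p} h → let (s , lt , h′) = upper-open x h in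
      c * s , subst (c * s <_) (c*d* p) (*-monoʳ-<-pos c lt) , subst (Upper x) (sym (d*c* s)) h′
  ; disjoint = disjoint x
  ; located = λ p<q → located x (mono p<q)
  }
  where
  instance
    _ = pos⇒nonZero c
  d = 1/ c
  instance
    d>0 : Positive d
    d>0 = 1/pos⇒pos c
  mono : ∀ {p q} → p < q → d * p < d * q
  mono = *-monoʳ-<-pos d
  d*c* : ∀ s → d * (c * s) ≡ s
  d*c* s = trans (sym (*-assoc d c s)) (trans (cong (_* s) (*-inverseˡ c)) (*-identityˡ s))
  c*d* : ∀ s → c * (d * s) ≡ s
  c*d* s = trans (sym (*-assoc c d s)) (trans (cong (_* s) (*-inverseʳ c)) (*-identityˡ s))

private
  ι : ℕ → ℚ
  ι n = ℤ.+ n / 1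

  frac≃ : ∀ p r → toℚᵘ (ℤ.+ p / suc r) ℚᵘ.≃ ℚᵘ.mkℚᵘ (ℤ.+ p) r
  frac≃ p r = toℚᵘ-fromℚᵘ (ℚᵘ.mkℚᵘ (ℤ.+ p) r)

  frac-< : ∀ {p r p′ r′} → p ℕ.* suc r′ ℕ.< p′ ℕ.* suc r → ℤ.+ p / suc r < ℤ.+ p′ / suc r′
  frac-< {p} {r} {p′} {r′} h = toℚᵘ-cancel-<
    (ℚᵘP.<-respˡ-≃ (ℚᵘP.≃-sym (frac≃ p r))
      (ℚᵘP.<-respʳ-≃ (ℚᵘP.≃-sym (frac≃ p′ r′))
        (ℚᵘ.*<* (subst₂ ℤ._<_ (ℤP.pos-* p (suc r′)) (ℤP.pos-* p′ (suc r)) (ℤ.+<+ h)))))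

  frac-<⁻¹ : ∀ {p r p′ r′} → ℤ.+ p / suc r < ℤ.+ p′ / suc r′ → p ℕ.* suc r′ ℕ.< p′ ℕ.* suc r
  frac-<⁻¹ {p} {r} {p′} {r′} h
    with ℚᵘP.<-respˡ-≃ (frac≃ p r) (ℚᵘP.<-respʳ-≃ (frac≃ p′ r′) (toℚᵘ-mono-< h))
  ... | ℚᵘ.*<* k = ℤP.drop‿+<+
    (subst₂ ℤ._<_ (sym (ℤP.pos-* p (suc r′))) (sym (ℤP.pos-* p′ (suc r))) k)

  i≤∣i∣ : ∀ i → i ℤ.≤ ℤ.+ ℤ.∣ i ∣
  i≤∣i∣ (ℤ.+ n)    = ℤP.≤-refl
  i≤∣i∣ ℤ.-[1+ n ] = ℤ.-≤+

  ≤frac : ∀ u r → u ≤ ℤ.+ (ℤ.∣ ↥ u ∣ ℕ.* suc r) / suc r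
  ≤frac u@(mkℚ i d _) r = toℚᵘ-cancel-≤
    (ℚᵘP.≤-respʳ-≃ (ℚᵘP.≃-sym (frac≃ (ℤ.∣ i ∣ ℕ.* suc r) r))
      (ℚᵘ.*≤* (ℤP.≤-trans (ℤP.*-monoʳ-≤-nonNeg (ℤ.+ suc r) (i≤∣i∣ i)) le)))
    where
    le : ℤ.+ ℤ.∣ i ∣ ℤ.* ℤ.+ suc r ℤ.≤ ℤ.+ (ℤ.∣ i ∣ ℕ.* suc r) ℤ.* ℤ.+ suc d
    le = subst₂ ℤ._≤_ (ℤP.pos-* ℤ.∣ i ∣ (suc r)) (ℤP.pos-* (ℤ.∣ i ∣ ℕ.* suc r) (suc d))
           (ℤ.+≤+ (ℕP.m≤m*n (ℤ.∣ i ∣ ℕ.* suc r) (suc d)))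

  ι-suc : ∀ n → ι (suc n) ≡ 1ℚ + ι n
  ι-suc n = toℚᵘ-injective (ℚᵘP.≃-trans (frac≃ (suc n) 0)
    (ℚᵘP.≃-trans (ℚᵘ.*≡* eq)
      (ℚᵘP.≃-trans (ℚᵘP.+-congʳ ℚᵘ.1ℚᵘ (ℚᵘP.≃-sym (frac≃ n 0)))
        (ℚᵘP.≃-sym (toℚᵘ-homo-+ 1ℚ (ι n))))))
    where
    eq : ℤ.+ suc n ℤ.* ℤ.+ 1 ≡ (ℤ.+ 1 ℤ.* ℤ.+ 1 ℤ.+ ℤ.+ n ℤ.* ℤ.+ 1) ℤ.* ℤ.+ 1
    eq = cong (ℤ._* ℤ.+ 1) (cong (λ z → ℤ.+ 1 ℤ.+ z) (sym (ℤP.*-identityʳ (ℤ.+ n))))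

  0≤1 : 0ℚ ≤ 1ℚ
  0≤1 = nonNegative⁻¹ 1ℚ

  ι≥0 : ∀ n → 0ℚ ≤ ι n
  ι≥0 zero    = ≤-refl
  ι≥0 (suc n) = subst (0ℚ ≤_) (sym (ι-suc n)) (+-mono-≤ 0≤1 (ι≥0 n))

  ι≥1 : ∀ n .{{_ : ℕ.NonZero n}} → 1ℚ ≤ ι n
  ι≥1 (suc n) = subst (1ℚ ≤_) (sym (ι-suc n)) (subst (_≤ 1ℚ + ι n) (+-identityʳ 1ℚ) (+-monoʳ-≤ 1ℚ (ι≥0 n)))

  *-mono-≤ : ∀ {a b c d} → 0ℚ ≤ a → 0ℚ ≤ d → a ≤ b → c ≤ d → a * c ≤ b * d
  *-mono-≤ {a} {b} {c} {d} 0≤a 0≤d a≤b c≤d = ≤-trans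
    (*-monoˡ-≤-nonNeg a {{nonNegative 0≤a}} c≤d) (*-monoʳ-≤-nonNeg d {{nonNegative 0≤d}} a≤b)

  *≥0 : ∀ {a b} → 0ℚ ≤ a → 0ℚ ≤ b → 0ℚ ≤ a * b
  *≥0 {a} {b} 0≤a 0≤b = subst (_≤ a * b) (*-zeroʳ a) (*-monoˡ-≤-nonNeg a {{nonNegative 0≤a}} 0≤b)

  ^≥0 : ∀ {x} n → 0ℚ ≤ x → 0ℚ ≤ x ^ℚ n
  ^≥0 zero    0≤x = 0≤1
  ^≥0 (suc n) 0≤x = *≥0 0≤x (^≥0 n 0≤x)

  ^-mono : ∀ {x y} n → 0ℚ ≤ x → x ≤ y → x ^ℚ n ≤ y ^ℚ n
  ^-mono zero    0≤x x≤y = ≤-refl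
  ^-mono (suc n) 0≤x x≤y = *-mono-≤ 0≤x (^≥0 n (≤-trans 0≤x x≤y)) x≤y (^-mono n 0≤x x≤y)

  1^ : ∀ n → 1ℚ ^ℚ n ≡ 1ℚ
  1^ zero    = refl
  1^ (suc n) = trans (*-identityˡ (1ℚ ^ℚ n)) (1^ n)

  ^≥1 : ∀ {x} n → 1ℚ ≤ x → 1ℚ ≤ x ^ℚ n
  ^≥1 {x} n 1≤x = subst (_≤ x ^ℚ n) (1^ n) (^-mono n 0≤1 1≤x)

  ^≤1 : ∀ {x} n → 0ℚ ≤ x → x ≤ 1ℚ → x ^ℚ n ≤ 1ℚ
  ^≤1 {x} n 0≤x x≤1 = subst (x ^ℚ n ≤_) (1^ n) (^-mono n 0≤x x≤1)

  ^-monoʳ : ∀ {x m n} → 1ℚ ≤ x → m ℕ.≤ n → x ^ℚ m ≤ x ^ℚ n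
  ^-monoʳ {n = n} 1≤x ℕ.z≤n = ^≥1 n 1≤x
  ^-monoʳ {n = suc n} 1≤x (ℕ.s≤s m≤n) =
    let 0≤x = ≤-trans 0≤1 1≤x in *-mono-≤ 0≤x (^≥0 n 0≤x) ≤-refl (^-monoʳ 1≤x m≤n)

  ^-mono-< : ∀ {x y} n → 0ℚ ≤ x → x < y → x ^ℚ suc n < y ^ℚ suc n
  ^-mono-< {x} {y} n 0≤x x<y = ≤-<-trans
    (*-monoˡ-≤-nonNeg x {{nonNegative 0≤x}} (^-mono n 0≤x (<⇒≤ x<y)))
    (*-monoˡ-<-pos (y ^ℚ n) {{positive (^>0 n)}} x<y)
    where
    0<y = ≤-<-trans 0≤x x<y
    ^>0 : ∀ n → 0ℚ < y ^ℚ n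
    ^>0 zero    = positive⁻¹ 1ℚ
    ^>0 (suc n) = subst (_< y * y ^ℚ n) (*-zeroʳ y) (*-monoʳ-<-pos y {{positive 0<y}} (^>0 n))

  bernoulli : ∀ e n → 0ℚ ≤ e → ι n * e ≤ (1ℚ + e) ^ℚ n
  bernoulli e zero    0≤e = subst (_≤ 1ℚ) (sym (*-zeroˡ e)) 0≤1
  bernoulli e (suc n) 0≤e = begin
    ι (suc n) * e                             ≡⟨ cong (_* e) (ι-suc n) ⟩
    (1ℚ + ι n) * e                            ≡⟨ solve 2 (λ n e → (con 1ℚ :+ n) :* e := n :* e :+ e :* con 1ℚ) refl (ι n) e ⟩
    ι n * e + e * 1ℚ                          ≤⟨ +-mono-≤ (bernoulli e n 0≤e) (*-monoˡ-≤-nonNeg e {{nonNegative 0≤e}} (^≥1 n 1≤1+e)) ⟩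
    (1ℚ + e) ^ℚ n + e * (1ℚ + e) ^ℚ n         ≡⟨ solve 2 (λ x e → x :+ e :* x := (con 1ℚ :+ e) :* x) refl ((1ℚ + e) ^ℚ n) e ⟩
    (1ℚ + e) * (1ℚ + e) ^ℚ n                  ∎
    where
    open ≤-Reasoning
    1≤1+e : 1ℚ ≤ 1ℚ + e
    1≤1+e = subst (_≤ 1ℚ + e) (+-identityʳ 1ℚ) (+-monoʳ-≤ 1ℚ 0≤e)

  ^-unbounded : ∀ e X → 0ℚ < e → ∃[ k ] X ≤ (1ℚ + e) ^ℚ suc k
  ^-unbounded e X 0<e = k , ≤-trans X≤ (≤-trans (bernoulli e k (<⇒≤ 0<e)) (^-monoʳ 1≤1+e (ℕP.n≤1+n k)))
    where
    instance
      e>0 = positive 0<e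
      e≢0 = pos⇒nonZero e
    k = ℤ.∣ ↥ (X * 1/ e) ∣ ℕ.* 1
    X≤ : X ≤ ι k * e
    X≤ = subst (_≤ ι k * e)
      (trans (*-assoc X (1/ e) e) (trans (cong (X *_) (*-inverseˡ e)) (*-identityʳ X)))
      (*-monoʳ-≤-nonNeg e {{nonNegative (<⇒≤ 0<e)}} (≤frac (X * 1/ e) 0))
    1≤1+e : 1ℚ ≤ 1ℚ + e
    1≤1+e = subst (_≤ 1ℚ + e) (+-identityʳ 1ℚ) (+-monoʳ-≤ 1ℚ (<⇒≤ 0<e))

  ^-gap : ∀ {x y} X → 0ℚ < x → x < y → ∃[ r ] x ^ℚ suc r * X ≤ y ^ℚ suc r
  ^-gap {x} {y} X 0<x x<y = r , (begin
    x ^ℚ suc r * X                  ≤⟨ *-monoˡ-≤-nonNeg (x ^ℚ suc r) {{nonNegative (^≥0 (suc r) (<⇒≤ 0<x))}} (proj₂ k) ⟩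
    x ^ℚ suc r * (1ℚ + e) ^ℚ suc r  ≡⟨ E.^-distrib-* x (1ℚ + e) (suc r) ⟨
    (x * (1ℚ + e)) ^ℚ suc r         ≡⟨ cong (_^ℚ suc r) x[1+e]≡y ⟩
    y ^ℚ suc r                      ∎)
    where
    open ≤-Reasoning
    instance
      x>0 = positive 0<x
      x≢0 = pos⇒nonZero x
      1/x>0 = 1/pos⇒pos x
    e = (y - x) * 1/ x
    0<y-x : 0ℚ < y - x
    0<y-x = subst (_< y - x) (+-inverseʳ x) (+-monoˡ-< (- x) x<y)
    0<e : 0ℚ < e
    0<e = subst (_< e) (*-zeroˡ (1/ x)) (*-monoˡ-<-pos (1/ x) 0<y-x)
    k = ^-unbounded e X 0<e
    r = proj₁ k
    x[1+e]≡y : x * (1ℚ + e) ≡ y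
    x[1+e]≡y = trans
      (solve 3 (λ x y i → x :* (con 1ℚ :+ (y :- x) :* i) := x :+ (y :- x) :* (x :* i)) refl x y (1/ x))
      (trans (cong (λ z → x + (y - x) * z) (*-inverseʳ x))
             (solve 2 (λ x y → x :+ (y :- x) :* con 1ℚ := y) refl x y))

-- The real power n ^ (- B) for n ≥ 1 and B > 0, from rational exponents p / d:
-- for s ≥ 0 the inequality  s ^ d * n ^ p ≤ 1  says  s ≤ n ^ (- p / d).  Thus
--   q < n ^ (- B)  iff  q < s ≤ n ^ (- p / d)  for some rationals s ≥ 0 and p / d > B,
--   n ^ (- B) < q  iff  n ^ (- p / d) ≤ s < q  for some rationals s ≥ 0 and p / d < B.
module _ (n : ℕ) .{{n≢0 : ℕ.NonZero n}} (B : ℝ) (B>0 : fromℚ 0ℚ <ᴿ B) where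

  private
    N : ℚ
    N = ℤ.+ n / 1

    1≤N : 1ℚ ≤ N
    1≤N = ι≥1 n

    0≤N : 0ℚ ≤ N
    0≤N = ≤-trans 0≤1 1≤N

    L U : ℚ → Set
    L q = ∃[ s ] ∃[ p ] ∃[ r ]
      q < s × 0ℚ ≤ s × Upper B (ℤ.+ p / suc r) × s ^ℚ suc r * N ^ℚ p ≤ 1ℚ
    U q = ∃[ s ] ∃[ p ] ∃[ r ]
      s < q × 0ℚ ≤ s × Lower B (ℤ.+ p / suc r) × 1ℚ ≤ s ^ℚ suc r * N ^ℚ p

    lower0 : Lower B 0ℚ
    lower0 = lower-closed B (proj₁ (proj₂ B>0)) (proj₂ (proj₂ B>0))

    negative∈L : ∀ {q} → q < 0ℚ → L q
    negative∈L q<0 with upper-inhabited B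
    ... | u , hu = 0ℚ , ℤ.∣ ↥ u ∣ ℕ.* 1 , 0 , q<0 , ≤-refl , upper≤ B (≤frac u 0) hu
      , subst (_≤ 1ℚ) (sym (*-zeroˡ (N ^ℚ (ℤ.∣ ↥ u ∣ ℕ.* 1)))) 0≤1

    disj : ∀ {q} → L q → U q → ⊥
    disj (s , p , r , q<s , 0≤s , u , s≤) (s′ , p′ , r′ , s′<q , 0≤s′ , l , s′≥) =
      <-irrefl refl (begin-strict
        1ℚ                                                        ≤⟨ ^≥1 (suc r) s′≥ ⟩
        (s′ ^ℚ suc r′ * N ^ℚ p′) ^ℚ suc r                         ≡⟨ expand s′ r′ p′ (suc r) ⟩
        s′ ^ℚ (suc r′ ℕ.* suc r) * N ^ℚ (p′ ℕ.* suc r)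
          <⟨ *-monoˡ-<-pos (N ^ℚ (p′ ℕ.* suc r)) {{positive (<-≤-trans (positive⁻¹ 1ℚ) (^≥1 (p′ ℕ.* suc r) 1≤N))}}
               (^-mono-< (r ℕ.+ r′ ℕ.* suc r) 0≤s′ (<-trans s′<q q<s)) ⟩
        s ^ℚ (suc r′ ℕ.* suc r) * N ^ℚ (p′ ℕ.* suc r)
          ≤⟨ *-monoˡ-≤-nonNeg (s ^ℚ (suc r′ ℕ.* suc r)) {{nonNegative (^≥0 (suc r′ ℕ.* suc r) 0≤s)}}
               (^-monoʳ 1≤N (ℕP.<⇒≤ (frac-<⁻¹ {p′} {r′} {p} {r} (lower<upper B l u)))) ⟩
        s ^ℚ (suc r′ ℕ.* suc r) * N ^ℚ (p ℕ.* suc r′)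
          ≡⟨ cong (λ z → s ^ℚ z * N ^ℚ (p ℕ.* suc r′)) (ℕP.*-comm (suc r′) (suc r)) ⟩
        s ^ℚ (suc r ℕ.* suc r′) * N ^ℚ (p ℕ.* suc r′)             ≡⟨ expand s r p (suc r′) ⟨
        (s ^ℚ suc r * N ^ℚ p) ^ℚ suc r′                           ≤⟨ ^≤1 (suc r′) (*≥0 (^≥0 (suc r) 0≤s) (^≥0 p 0≤N)) s≤ ⟩
        1ℚ                                                        ∎)
      where
      open ≤-Reasoning
      expand : ∀ s r p m → (s ^ℚ suc r * N ^ℚ p) ^ℚ m ≡ s ^ℚ (suc r ℕ.* m) * N ^ℚ (p ℕ.* m)
      expand s r p m = trans (E.^-distrib-* (s ^ℚ suc r) (N ^ℚ p) m)
        (cong₂ _*_ (E.^-assocʳ s (suc r) m) (E.^-assocʳ N p m))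

    bracket : ∀ r m j → Lower B (ℤ.+ j / suc r) → Upper B (ℤ.+ (m ℕ.+ j) / suc r) →
              ∃[ i ] Lower B (ℤ.+ i / suc r) × Upper B (ℤ.+ (2 ℕ.+ i) / suc r)
    bracket r zero    j l u = ⊥-elim (disjoint B l u)
    bracket r (suc m) j l u
      with located B (frac-< {suc j} {r} {2 ℕ.+ j} {r} (ℕP.*-monoˡ-< (suc r) (ℕP.n<1+n (suc j))))
    ... | inj₁ l′ = bracket r m (suc j) l′ (subst (λ i → Upper B (ℤ.+ i / suc r)) (sym (ℕP.+-suc m j)) u)
    ... | inj₂ u′ = j , l , u′

    start : ∀ r → ∃[ i ] Lower B (ℤ.+ i / suc r) × Upper B (ℤ.+ (2 ℕ.+ i) / suc r)
    start r = bracket r m 0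
      (subst (Lower B) (sym (0/n≡0 (suc r))) lower0)
      (subst (λ i → Upper B (ℤ.+ i / suc r)) (sym (ℕP.+-identityʳ m))
        (upper≤ B (≤frac u r) (proj₂ (upper-inhabited B))))
      where
      u = proj₁ (upper-inhabited B)
      m = ℤ.∣ ↥ u ∣ ℕ.* suc r

    step : ∀ x y d j → 0ℚ ≤ x → x ^ℚ d * N ^ℚ 2 ≤ y ^ℚ d → 1ℚ ≤ x ^ℚ d * N ^ℚ (2 ℕ.+ j) →
           1ℚ ≤ y ^ℚ d * N ^ℚ j
    step x y d j 0≤x gap h = begin
      1ℚ                           ≤⟨ h ⟩
      x ^ℚ d * N ^ℚ (2 ℕ.+ j)      ≡⟨ cong (x ^ℚ d *_) (E.^-homo-* N 2 j) ⟩
      x ^ℚ d * (N ^ℚ 2 * N ^ℚ j)   ≡⟨ *-assoc (x ^ℚ d) (N ^ℚ 2) (N ^ℚ j) ⟨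
      x ^ℚ d * N ^ℚ 2 * N ^ℚ j     ≤⟨ *-monoʳ-≤-nonNeg (N ^ℚ j) {{nonNegative (^≥0 j 0≤N)}} gap ⟩
      y ^ℚ d * N ^ℚ j              ∎
      where open ≤-Reasoning

    separate : ∀ {a b x y} r i → 0ℚ ≤ x → a < x → x < y → y < b →
               x ^ℚ suc r * N ^ℚ 2 ≤ y ^ℚ suc r →
               Lower B (ℤ.+ i / suc r) → Upper B (ℤ.+ (2 ℕ.+ i) / suc r) → L a ⊎ U b
    separate {x = x} {y} r i 0≤x a<x x<y y<b gap l u
      with ≤-total (x ^ℚ suc r * N ^ℚ (2 ℕ.+ i)) 1ℚ
    ... | inj₁ h = inj₁ (x , 2 ℕ.+ i , r , a<x , 0≤x , u , h)
    ... | inj₂ h = inj₂ (y , i , r , y<b , ≤-trans 0≤x (<⇒≤ x<y) , l , step x y (suc r) i 0≤x gap h)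

    loc⁺ : ∀ {a b} → 0ℚ ≤ a → a < b → L a ⊎ U b
    loc⁺ 0≤a a<b =
      let (y , a<y , y<b)  = <-dense a<b
          (x , a<x , x<y)  = <-dense a<y
          0<x              = ≤-<-trans 0≤a a<x
          (r , gap)        = ^-gap (N ^ℚ 2) 0<x x<y
          (i , l , u)      = start r
      in separate r i (<⇒≤ 0<x) a<x x<y y<b gap l u

    loc : ∀ {a b} → a < b → L a ⊎ U b
    loc {a} a<b with a <? 0ℚ
    ... | yes a<0 = inj₁ (negative∈L a<0)
    ... | no  a≮0 = loc⁺ (≮⇒≥ a≮0) a<b

  negPower : ℝ
  negPower = record
    { Lower = L
    ; Upper = U
    ; lower-inhabited = - 1ℚ , negative∈L (negative⁻¹ (- 1ℚ))
    ; upper-inhabited = 1ℚ + 1ℚ , 1ℚ , 0 , 0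
        , subst (_< 1ℚ + 1ℚ) (+-identityʳ 1ℚ) (+-monoʳ-< 1ℚ (positive⁻¹ 1ℚ))
        , 0≤1 , lower0 , ≤-refl
    ; lower-closed = λ p<q (s , p , r , q<s , h) → s , p , r , <-trans p<q q<s , h
    ; lower-open = λ (s , p , r , q<s , h) →
        let (m , q<m , m<s) = <-dense q<s in m , q<m , s , p , r , m<s , h
    ; upper-closed = λ p<q (s , p , r , s<p , h) → s , p , r , <-trans s<p p<q , h
    ; upper-open = λ (s , p , r , s<q , h) →
        let (m , s<m , m<q) = <-dense s<q in m , m<q , s , p , r , s<m , h
    ; disjoint = disj
    ; located = loc
    }

infix 10 _^-[_,_]
_^-[_,_] : (n : ℕ) .{{_ : ℕ.NonZero n}} (B : ℝ) → fromℚ 0ℚ <ᴿ B → ℝ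
n ^-[ B , B>0 ] = negPower n B B>0

-- Unordered product: the net of products over finite sets of indices, directed
-- by inclusion, converges to x.  Finite sets are duplicate-free lists.
HasProduct : ∀ {c ℓ} (S : Setoid c ℓ) → (Setoid.Carrier S → ℚ) → ℝ → Set (c ⊔ˡ ℓ)
HasProduct S f x =
  ∀ ε .{{_ : Positive ε}} →
  ∃[ is ] Unique is × (∀ js → Unique js → is ⊆ js →
    ∣ foldr _*_ 1ℚ (map f js) - x ∣ <ᴿ fromℚ ε)
  where
  open UniqueSetoid S using (Unique)
  open Subset S using (_⊆_)

HasCardinality : ∀ {c ℓ} → Setoid c ℓ → ℕ → Set (c ⊔ˡ ℓ)
HasCardinality S n = Inverse S (≡.setoid (Fin n))

------------------------------------------------------------------------

-- Equality on a finite carrier is decidable, so the apartness _#_ of a finite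
-- Heyting field is the negation of _≈_.
record FiniteField c ℓ₁ ℓ₂ : Set (lsuc (c ⊔ˡ ℓ₁ ⊔ˡ ℓ₂)) where
  field
    heytingField : HeytingField c ℓ₁ ℓ₂

  open HeytingField heytingField public
  open HeytingCommutativeRing heytingCommutativeRing public using (commutativeRing)

  field
    order       : ℕ
    cardinality : HasCardinality (CommutativeRing.setoid commutativeRing) order

  instance
    order-nonZero : ℕ.NonZero order
    order-nonZero = FinP.nonZeroIndex (Inverse.to cardinality 0#)

------------------------------------------------------------------------

module Polynomials {c ℓ} (R : CommutativeRing c ℓ) where

  open CommutativeRing R
    using (Carrier; 0#; 1#; _≈_)
    renaming (_+_ to _+ʳ_; _*_ to _*ʳ_; refl to ≈-refl; sym to ≈-sym; trans to ≈-trans)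

  infix  4 _≈ₚ_
  infixl 6 _+ₚ_
  infixl 7 _*ₚ_

  -- Coefficients from degree 0 upwards; trailing zeros are allowed and are
  -- identified away by _≈ₚ_.
  Poly : Set c
  Poly = List Carrier

  coeff : Poly → ℕ → Carrier
  coeff []      _       = 0#
  coeff (a ∷ f) zero    = a
  coeff (a ∷ f) (suc i) = coeff f i

  _≈ₚ_ : Poly → Poly → Set ℓ
  f ≈ₚ g = ∀ i → coeff f i ≈ coeff g i

  constant : Carrier → Poly
  constant a = a ∷ []

  _+ₚ_ : Poly → Poly → Poly
  []      +ₚ g       = g
  (a ∷ f) +ₚ []      = a ∷ f
  (a ∷ f) +ₚ (b ∷ g) = (a +ʳ b) ∷ (f +ₚ g)

  _*ₚ_ : Poly → Poly → Poly
  []      *ₚ g = []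
  (a ∷ f) *ₚ g = map (a *ʳ_) g +ₚ (0# ∷ (f *ₚ g))

  polySetoid : Setoid c ℓ
  polySetoid = record
    { Carrier = Poly
    ; _≈_ = _≈ₚ_
    ; isEquivalence = record
      { refl  = λ _ → ≈-refl
      ; sym   = λ f≈g i → ≈-sym (f≈g i)
      ; trans = λ f≈g g≈h i → ≈-trans (f≈g i) (g≈h i)
      }
    }

  polyRawSemiring : RawSemiring c ℓ
  polyRawSemiring = record
    { Carrier = Poly
    ; _≈_ = _≈ₚ_
    ; _+_ = _+ₚ_
    ; _*_ = _*ₚ_
    ; 0#  = []
    ; 1#  = constant 1#
    }

  open RawSemiringDefinitions polyRawSemiring public
    using (_∣_; _∤_; Irreducible) renaming (_^_ to _^ₚ_)

  MonicOfDegree : ℕ → Poly → Set ℓ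
  MonicOfDegree d f = coeff f d ≈ 1# × (∀ i → d ℕ.< i → coeff f i ≈ 0#)

  MonicIrreducible : Set (c ⊔ˡ ℓ)
  MonicIrreducible = ∃[ P ] ∃[ d ] MonicOfDegree d P × Irreducible P

  poly : MonicIrreducible → Poly
  poly = proj₁

  deg : MonicIrreducible → ℕ
  deg (_ , d , _) = d

  monicIrreducibles : Setoid (c ⊔ˡ ℓ) ℓ
  monicIrreducibles = On.setoid polySetoid poly

  PowerFree : ℕ → Poly → Set (c ⊔ˡ ℓ)
  PowerFree k f = (P : MonicIrreducible) → poly P ^ₚ k ∤ f

  MonicPowerFree : ℕ → Poly → Set (c ⊔ˡ ℓ)
  MonicPowerFree k f = (∃[ d ] MonicOfDegree d f) × PowerFree k f

  powerFreePairs : ℕ → Carrier → ℕ → Setoid (c ⊔ˡ ℓ) ℓ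
  powerFreePairs k a n = On.setoid polySetoid (proj₁ {B = member})
    where
    member : Poly → Set (c ⊔ˡ ℓ)
    member f = MonicOfDegree n f × MonicPowerFree k f × MonicPowerFree k (f +ₚ constant a)

------------------------------------------------------------------------

module OverFiniteField {c ℓ₁ ℓ₂} (F : FiniteField c ℓ₁ ℓ₂) where

  open FiniteField F public
    using (Carrier; 0#; _#_; commutativeRing; order; order-nonZero)
  open Polynomials commutativeRing public

  infixl 7 _/order^_
  _/order^_ : ℕ → ℕ → ℚ
  m /order^ n = _/_ (ℤ.+ m) (order ℕ.^ n) {{ℕP.m^n≢0 order n}}

  eulerFactor : ℕ → MonicIrreducible → ℚ
  eulerFactor k P = 1ℚ - 2 /order^ (k ℕ.* deg P)

{-# OPTIONS --safe #-}
module Submission where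

-- Sieve by the irreducibles P of degree at most y.  The conditions P^k ∤ f and
-- P^k ∤ f + a exclude two distinct residue classes modulo P^k, so by Chinese
-- remaindering the density of the surviving f of degree n is exactly
-- ∏ (1 - 2 / q^(k deg P)) over deg P ≤ y, provided that the degrees k deg P sum
-- to at most n; this holds for k y q^(y+1) ≤ n.  The irreducibles of degree d
-- exclude at most a proportion q^d · 2 / q^(k d) ≤ 2 / q^d, so those of degree
-- above y change both the density and the product by at most 2 / q^y.  Taking y
-- maximal gives q^y at least of order n / log n, and 1 / q^y is O(n^(-B)) for
-- every B < 1.  Partial products form a decreasing sequence with the same error
-- bound, from which the infinite product is built as a Dedekind cut.

open import Defs
open import Data.Nat.Base using (ℕ; NonZero; _≤_)
open import Data.Nat.Divisibility using () renaming (_∤_ to _∤ℕ_)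
open import Data.Product.Base using (Σ-syntax; ∃-syntax; _×_)
open import Data.Rational.Base using (ℚ; Positive; 0ℚ; 1ℚ)

open import Algebra.Bundles using (CommutativeRing; Semiring)
import Algebra.Definitions.RawSemiring as RawSR
open import Algebra.Definitions.RawMagma using (module _∣ʳ_)
import Algebra.Properties.CommutativeSemiring.Exp as Exp
import Algebra.Properties.Group as GroupProperties
import Algebra.Properties.Ring as RingProperties
import Algebra.Properties.Semiring.Divisibility as Divisibility
import Algebra.Solver.Ring.NaturalCoefficients.Default as NatSolver
open import Data.Fin.Base using (Fin; zero; suc)
import Data.Fin.Properties as Fin
import Data.Integer.Base as ℤ
import Data.Integer.Properties as ℤ
open import Data.List.Base
  using (List; []; _∷_; [_]; _++_; cartesianProductWith; filter; foldr; length; lookup; map; tabulate)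
import Data.List.Membership.Setoid as Membership
import Data.List.Membership.Setoid.Properties as Mem
import Data.List.Properties as List
import Data.List.Relation.Binary.Permutation.Setoid as Permutation
import Data.List.Relation.Binary.Permutation.Setoid.Properties as Perm
import Data.List.Relation.Binary.Subset.Setoid as Subset
open import Data.List.Relation.Unary.All as All using (All; []; _∷_)
import Data.List.Relation.Unary.All.Properties as Allₚ
open import Data.List.Relation.Unary.AllPairs as AllPairs using (AllPairs; []; _∷_)
import Data.List.Relation.Unary.AllPairs.Properties as AllPairsₚ
open import Data.List.Relation.Unary.Any as Any using (Any; here; there)
import Data.List.Relation.Unary.Unique.Setoid as UniqueSetoid
import Data.List.Relation.Unary.Unique.Setoid.Properties as Uniq
open import Data.Nat.Base as ℕ using (zero; suc; _<_; z≤n; s≤s)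
import Data.Nat.DivMod as ℕ
import Data.Nat.Properties as ℕ
import Data.Nat.Solver as ℕSolver
open import Data.Product.Base as Product using (Σ; _,_; proj₁; proj₂)
import Data.Rational.Solver as ℚSolver
import Data.Rational.Unnormalised.Base as ℚᵘ
import Data.Rational.Unnormalised.Properties as ℚᵘ
open import Data.Sum.Base as Sum using (_⊎_; inj₁; inj₂)
open import Data.Unit.Polymorphic.Base using (⊤; tt)
open import Function.Base using (_∘_; id)
open import Function.Bundles using (Inverse)
open import Level using (Level; _⊔_)
open import Relation.Binary.Bundles using (Setoid)
import Relation.Binary.Construct.On as On
open import Relation.Binary.Definitions using (Decidable; _Respects_)
open import Relation.Binary.PropositionalEquality as ≡ using (_≡_; refl; cong)
import Relation.Binary.Reasoning.Setoid as SetoidReasoning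
open import Relation.Nullary using (¬_; Dec; yes; no; contradiction)
open import Relation.Nullary.Decidable using (map′; _×-dec_; _⊎-dec_; ¬?)
import Relation.Unary as U

-- Duplicate-free lists over a setoid

-- The exact count removes the moduli one at a time. Within the class of `-u` modulo `m`, writing
-- `f = h m + w` turns two excluded classes modulo a coprime `n` into two excluded classes for `h`,
-- which has lower degree. The pair formed by the classes of `0` and `-a` is not preserved by this,
-- so the induction must run over arbitrary pairs of disjoint classes, and it is applied both to the
-- original classes and to the moved ones. Products are never estimated analytically. Consecutive
-- partial products are densities in a common degree, so the union bound that compares densities
-- also compares products, and one telescoping argument serves the count and the infinite product.

private variable
  ℓa ℓb ℓc ℓp ℓq ℓr ℓ ℓ₁ ℓ₂ : Level

module _ {A : Set ℓa} where

  count : {P : U.Pred A ℓp} → U.Decidable P → List A → ℕ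
  count P? xs = length (filter P? xs)

  count-mono : {P : U.Pred A ℓp} {Q : U.Pred A ℓq} (P? : U.Decidable P) (Q? : U.Decidable Q) →
               (∀ {x} → P x → Q x) → ∀ xs → count P? xs ≤ count Q? xs
  count-mono P? Q? f [] = ℕ.≤-refl
  count-mono P? Q? f (x ∷ xs) with count-mono P? Q? f xs | P? x | Q? x
  ... | ih | yes px | yes qx = s≤s ih
  ... | ih | yes px | no ¬qx = contradiction (f px) ¬qx
  ... | ih | no ¬px | yes qx = ℕ.m≤n⇒m≤1+n ih
  ... | ih | no ¬px | no ¬qx = ih

  count-split : {P : U.Pred A ℓp} {Q : U.Pred A ℓq} {R : U.Pred A ℓr}
                (P? : U.Decidable P) (Q? : U.Decidable Q) (R? : U.Decidable R) →
                (∀ {x} → P x → Q x ⊎ R x) → (∀ {x} → Q x → P x) → (∀ {x} → R x → P x) →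
                (∀ {x} → Q x → ¬ R x) → ∀ xs → count P? xs ≡ count Q? xs ℕ.+ count R? xs
  count-split P? Q? R? cover Q⇒P R⇒P disj [] = refl
  count-split P? Q? R? cover Q⇒P R⇒P disj (x ∷ xs)
    with count-split P? Q? R? cover Q⇒P R⇒P disj xs | P? x | Q? x | R? x
  ... | ih | _      | yes qx | yes rx = contradiction rx (disj qx)
  ... | ih | yes px | yes qx | no ¬rx = cong suc ih
  ... | ih | yes px | no ¬qx | yes rx =
    ≡.trans (cong suc ih) (≡.sym (ℕ.+-suc (count Q? xs) (count R? xs)))
  ... | ih | no ¬px | yes qx | _      = contradiction (Q⇒P qx) ¬px
  ... | ih | no ¬px | _      | yes rx = contradiction (R⇒P rx) ¬px
  ... | ih | no ¬px | no ¬qx | no ¬rx = ih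
  ... | ih | yes px | no ¬qx | no ¬rx with cover px
  ...   | inj₁ qx = contradiction qx ¬qx
  ...   | inj₂ rx = contradiction rx ¬rx

length-cartesianProductWith : {A : Set ℓa} {B : Set ℓb} {C : Set ℓc} (f : A → B → C) (xs : List A) (ys : List B) →
                              length (cartesianProductWith f xs ys) ≡ length xs ℕ.* length ys
length-cartesianProductWith f [] ys = refl
length-cartesianProductWith f (x ∷ xs) ys = ≡.trans (List.length-++ (map (f x) ys))
  (≡.cong₂ ℕ._+_ (List.length-map (f x) ys) (length-cartesianProductWith f xs ys))

module _ (S : Setoid ℓa ℓ) where
  open Setoid S renaming (Carrier to A; refl to ≈-refl; sym to ≈-sym; trans to ≈-trans)
  open Membership S using (_∈_)
  open Subset S using (_⊆_)
  open UniqueSetoid S using (Unique)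
  open Permutation S using (_↭_; ↭-refl; ↭-trans; ↭-prep; ↭-reflexive-≋)

  ≉-of-unique : ∀ {x y : A} {xs} → All (λ z → ¬ x ≈ z) xs → y ∈ xs → ¬ y ≈ x
  ≉-of-unique (x≉z ∷ _) (here y≈z) y≈x = x≉z (≈-trans (≈-sym y≈x) y≈z)
  ≉-of-unique (_ ∷ x∉) (there y∈) = ≉-of-unique x∉ y∈

  -- Each entry of `xs` is pulled to the front of `ys`; as `xs` has no duplicates, its later entries
  -- are still found in what remains. The leftover `zs` gives comparison of lengths, and later the
  -- extra factors of a larger product.
  unique-⊆⇒↭-++ : ∀ {xs ys} → Unique xs → xs ⊆ ys → ∃[ zs ] ys ↭ xs ++ zs
  unique-⊆⇒↭-++ {[]} {ys} _ _ = ys , ↭-refl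
  unique-⊆⇒↭-++ {x ∷ xs} {ys} (x∉ ∷ xs!) sub with Mem.∈-∃++ S (sub (here ≈-refl))
  ... | us , vs , w , x≈w , ys≋ = _ , ↭-trans ys↭ (↭-prep x (proj₂ rec))
    where
    ys↭ : ys ↭ x ∷ us ++ vs
    ys↭ = ↭-trans (↭-reflexive-≋ ys≋) (Perm.shift S (≈-sym x≈w) us vs)
    sub′ : xs ⊆ us ++ vs
    sub′ z∈ with Perm.∈-resp-↭ S ys↭ (sub (there z∈))
    ... | here z≈x = contradiction z≈x (≉-of-unique x∉ z∈)
    ... | there z∈′ = z∈′
    rec = unique-⊆⇒↭-++ xs! sub′

  unique-⊆⇒length≤ : ∀ {xs ys} → Unique xs → xs ⊆ ys → length xs ≤ length ys
  unique-⊆⇒length≤ {xs} {ys} xs! sub = begin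
    length xs                ≤⟨ ℕ.m≤m+n (length xs) (length zs) ⟩
    length xs ℕ.+ length zs  ≡⟨ List.length-++ xs ⟨
    length (xs ++ zs)        ≡⟨ Perm.xs↭ys⇒|xs|≡|ys| S ys↭ ⟨
    length ys                ∎
    where
    open ℕ.≤-Reasoning
    zs = proj₁ (unique-⊆⇒↭-++ xs! sub)
    ys↭ = proj₂ (unique-⊆⇒↭-++ xs! sub)

  lookup-unique : ∀ {xs} → Unique xs → ∀ i j → lookup xs i ≈ lookup xs j → i ≡ j
  lookup-unique (_ ∷ _) zero zero _ = refl
  lookup-unique {x ∷ xs} (x∉ ∷ _) zero (suc j) eq =
    contradiction (≈-sym eq) (≉-of-unique x∉ (Mem.∈-lookup S xs j))
  lookup-unique {x ∷ xs} (x∉ ∷ _) (suc i) zero eq =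
    contradiction eq (≉-of-unique x∉ (Mem.∈-lookup S xs i))
  lookup-unique (_ ∷ xs!) (suc i) (suc j) eq = cong suc (lookup-unique xs! i j eq)

  -- The position of an element is read off its membership proof; `lookup-unique` makes it
  -- independent of that proof and of the representative.
  cardinality-list : {P : U.Pred A ℓp} {xs : List A} → Unique xs →
                     (∀ {x} → x ∈ xs → P x) → (∀ {x} → P x → x ∈ xs) →
                     HasCardinality (On.setoid S (proj₁ {B = P})) (length xs)
  cardinality-list {P = P} {xs} xs! sound complete = record
    { to = to
    ; from = λ i → lookup xs i , sound (Mem.∈-lookup S xs i)
    ; to-cong = λ {x} {y} x≈y → lookup-unique xs! (to x) (to y)
        (≈-trans (≈-sym (lookup-to x)) (≈-trans x≈y (lookup-to y)))
    ; from-cong = λ { refl → ≈-refl }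
    ; inverse =
        (λ {i} {y} y≈ → lookup-unique xs! (to y) i (≈-trans (≈-sym (lookup-to y)) y≈))
      , (λ { {x} refl → ≈-sym (lookup-to x) })
    }
    where
    to : Σ A P → Fin (length xs)
    to (x , px) = Any.index (complete px)
    lookup-index : ∀ {x zs} (x∈ : x ∈ zs) → x ≈ lookup zs (Any.index x∈)
    lookup-index (here eq) = eq
    lookup-index (there x∈) = lookup-index x∈
    lookup-to : ∀ x → proj₁ x ≈ lookup xs (to x)
    lookup-to (x , px) = lookup-index (complete px)

module _ (S : Setoid ℓa ℓ₁) (T : Setoid ℓb ℓ₂) where
  private
    module S = Setoid S
    module T = Setoid T
    module ∈S = Membership S
    module ∈T = Membership T

  -- The image under `φ` of the filtered `xs` and the filtered `ys` are duplicate-free and contained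
  -- in each other, so neither is longer.
  count-bijection :
    {P : U.Pred S.Carrier ℓp} {Q : U.Pred T.Carrier ℓq} (P? : U.Decidable P) (Q? : U.Decidable Q) →
    P Respects S._≈_ → Q Respects T._≈_ →
    {xs : List S.Carrier} {ys : List T.Carrier} →
    UniqueSetoid.Unique S xs → UniqueSetoid.Unique T ys →
    (φ : S.Carrier → T.Carrier) → (∀ {x x′} → x S.≈ x′ → φ x T.≈ φ x′) →
    (∀ {x x′} → φ x T.≈ φ x′ → x S.≈ x′) →
    (∀ {x} → x ∈S.∈ xs → P x → φ x ∈T.∈ ys × Q (φ x)) →
    (∀ {y} → y ∈T.∈ ys → Q y → ∃[ x ] x ∈S.∈ xs × y T.≈ φ x × P x) →
    count P? xs ≡ count Q? ys
  count-bijection P? Q? P-resp Q-resp {xs} {ys} xs! ys! φ φ-cong φ-inj into onto =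
    ≡.trans (≡.sym (List.length-map φ (filter P? xs))) (ℕ.≤-antisym
      (unique-⊆⇒length≤ T (Uniq.map⁺ S T φ-inj (Uniq.filter⁺ S P? xs!))
        (λ y∈ → let x , x∈ , y≈ , px = Mem.∈-map∘filter⁻ S T P? P-resp y∈
                    φx∈ , qx = into x∈ px
                in Mem.∈-resp-≈ T (T.sym y≈) (Mem.∈-filter⁺ T Q? Q-resp φx∈ qx)))
      (unique-⊆⇒length≤ T (Uniq.filter⁺ T Q? ys!)
        (λ y∈ → let y∈ys , qy = Mem.∈-filter⁻ T Q? Q-resp y∈
                in Mem.∈-map∘filter⁺ S T P? P-resp φ-cong (onto y∈ys qy))))

-- The polynomial ring

module PolynomialRing {c ℓ} (R : CommutativeRing c ℓ) where
  open CommutativeRing R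
    using (Carrier; 0#; 1#; _≈_; +-cong; *-cong; *-congˡ; *-congʳ; +-congˡ; +-congʳ; -_; -‿cong; +-identityˡ; +-identityʳ; setoid)
    renaming (_+_ to _+ʳ_; _*_ to _*ʳ_; refl to ≈-refl; sym to ≈-sym; trans to ≈-trans)
  private
    module R = CommutativeRing R
    module RP = RingProperties R.ring
  open Polynomials R

  infixr 8 _∙ₚ_
  _∙ₚ_ : Carrier → Poly → Poly
  a ∙ₚ f = map (a *ʳ_) f

  -ₚ_ : Poly → Poly
  -ₚ f = map -_ f

  coeff-+ : ∀ f g i → coeff (f +ₚ g) i ≈ coeff f i +ʳ coeff g i
  coeff-+ [] g i = ≈-sym (+-identityˡ _)
  coeff-+ (a ∷ f) [] i = ≈-sym (+-identityʳ _)
  coeff-+ (a ∷ f) (b ∷ g) zero = ≈-refl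
  coeff-+ (a ∷ f) (b ∷ g) (suc i) = coeff-+ f g i

  coeff-∙ : ∀ a f i → coeff (a ∙ₚ f) i ≈ a *ʳ coeff f i
  coeff-∙ a [] i = ≈-sym (R.zeroʳ a)
  coeff-∙ a (b ∷ f) zero = ≈-refl
  coeff-∙ a (b ∷ f) (suc i) = coeff-∙ a f i

  coeff-neg : ∀ f i → coeff (-ₚ f) i ≈ - coeff f i
  coeff-neg [] i = ≈-sym RP.-0#≈0#
  coeff-neg (b ∷ f) zero = ≈-refl
  coeff-neg (b ∷ f) (suc i) = coeff-neg f i

  -- _≈ₚ_ unfolds to a function type, from which the two polynomials cannot be
  -- inferred; the record keeps them visible to unification.
  infix 4 _≋_
  record _≋_ (f g : Poly) : Set ℓ where
    constructor mk≋
    field at : f ≈ₚ g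
  open _≋_ public

  ≋-refl : ∀ {f} → f ≋ f
  at ≋-refl i = ≈-refl

  ≋-sym : ∀ {f g} → f ≋ g → g ≋ f
  at (≋-sym f≈g) i = ≈-sym (at f≈g i)

  ≋-trans : ∀ {f g h} → f ≋ g → g ≋ h → f ≋ h
  at (≋-trans f≈g g≈h) i = ≈-trans (at f≈g i) (at g≈h i)

  ≋-setoid : Setoid c ℓ
  ≋-setoid = record
    { Carrier = Poly
    ; _≈_ = _≋_
    ; isEquivalence = record { refl = ≋-refl ; sym = ≋-sym ; trans = ≋-trans }
    }

  tail : ∀ {a b f g} → a ∷ f ≋ b ∷ g → f ≋ g
  at (tail p) i = at p (suc i)

  tail[] : ∀ {a f} → a ∷ f ≋ [] → f ≋ []
  at (tail[] p) i = at p (suc i)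

  ∷-cong : ∀ {a b f g} → a ≈ b → f ≋ g → a ∷ f ≋ b ∷ g
  at (∷-cong a≈b f≈g) zero = a≈b
  at (∷-cong a≈b f≈g) (suc i) = at f≈g i

  0∷[]≈[] : 0# ∷ [] ≋ []
  at 0∷[]≈[] zero = ≈-refl
  at 0∷[]≈[] (suc i) = ≈-refl

  +ₚ-cong : ∀ {f f′ g g′} → f ≋ f′ → g ≋ g′ → f +ₚ g ≋ f′ +ₚ g′
  at (+ₚ-cong {f} {f′} {g} {g′} p q) i =
    ≈-trans (coeff-+ f g i) (≈-trans (+-cong (at p i) (at q i)) (≈-sym (coeff-+ f′ g′ i)))

  +ₚ-assoc : ∀ f g h → (f +ₚ g) +ₚ h ≋ f +ₚ (g +ₚ h)
  at (+ₚ-assoc f g h) i = begin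
    coeff ((f +ₚ g) +ₚ h) i                 ≈⟨ coeff-+ (f +ₚ g) h i ⟩
    coeff (f +ₚ g) i +ʳ coeff h i           ≈⟨ +-congʳ (coeff-+ f g i) ⟩
    coeff f i +ʳ coeff g i +ʳ coeff h i     ≈⟨ R.+-assoc _ _ _ ⟩
    coeff f i +ʳ (coeff g i +ʳ coeff h i)   ≈⟨ +-congˡ (coeff-+ g h i) ⟨
    coeff f i +ʳ coeff (g +ₚ h) i           ≈⟨ coeff-+ f (g +ₚ h) i ⟨
    coeff (f +ₚ (g +ₚ h)) i                 ∎
    where open SetoidReasoning setoid

  +ₚ-comm : ∀ f g → f +ₚ g ≋ g +ₚ f
  at (+ₚ-comm f g) i = ≈-trans (coeff-+ f g i) (≈-trans (R.+-comm _ _) (≈-sym (coeff-+ g f i)))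

  +ₚ-identityʳ : ∀ f → f +ₚ [] ≋ f
  at (+ₚ-identityʳ []) i = ≈-refl
  at (+ₚ-identityʳ (a ∷ f)) i = ≈-refl

  +ₚ-inverseʳ : ∀ f → f +ₚ (-ₚ f) ≋ []
  at (+ₚ-inverseʳ f) i = ≈-trans (coeff-+ f (-ₚ f) i) (≈-trans (+-congˡ (coeff-neg f i)) (R.-‿inverseʳ _))

  -ₚ-cong : ∀ {f g} → f ≋ g → -ₚ f ≋ -ₚ g
  at (-ₚ-cong {f} {g} p) i = ≈-trans (coeff-neg f i) (≈-trans (-‿cong (at p i)) (≈-sym (coeff-neg g i)))

  ∙ₚ-cong : ∀ {a b f g} → a ≈ b → f ≋ g → a ∙ₚ f ≋ b ∙ₚ g
  at (∙ₚ-cong {a} {b} {f} {g} a≈b p) i =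
    ≈-trans (coeff-∙ a f i) (≈-trans (*-cong a≈b (at p i)) (≈-sym (coeff-∙ b g i)))

  ∙ₚ-zeroˡ : ∀ {a} f → a ≈ 0# → a ∙ₚ f ≋ []
  at (∙ₚ-zeroˡ {a} f a≈0) i = ≈-trans (coeff-∙ a f i) (≈-trans (*-congʳ a≈0) (R.zeroˡ _))

  ∙ₚ-identity : ∀ f → 1# ∙ₚ f ≋ f
  at (∙ₚ-identity f) i = ≈-trans (coeff-∙ 1# f i) (R.*-identityˡ _)

  ∙ₚ-distribˡ : ∀ a f g → a ∙ₚ (f +ₚ g) ≋ a ∙ₚ f +ₚ a ∙ₚ g
  at (∙ₚ-distribˡ a f g) i = begin
    coeff (a ∙ₚ (f +ₚ g)) i               ≈⟨ coeff-∙ a (f +ₚ g) i ⟩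
    a *ʳ coeff (f +ₚ g) i                 ≈⟨ *-congˡ (coeff-+ f g i) ⟩
    a *ʳ (coeff f i +ʳ coeff g i)         ≈⟨ R.distribˡ _ _ _ ⟩
    a *ʳ coeff f i +ʳ a *ʳ coeff g i      ≈⟨ +-cong (coeff-∙ a f i) (coeff-∙ a g i) ⟨
    coeff (a ∙ₚ f) i +ʳ coeff (a ∙ₚ g) i  ≈⟨ coeff-+ (a ∙ₚ f) (a ∙ₚ g) i ⟨
    coeff (a ∙ₚ f +ₚ a ∙ₚ g) i            ∎
    where open SetoidReasoning setoid

  ∙ₚ-distribʳ : ∀ a b f → (a +ʳ b) ∙ₚ f ≋ a ∙ₚ f +ₚ b ∙ₚ f
  at (∙ₚ-distribʳ a b f) i = begin
    coeff ((a +ʳ b) ∙ₚ f) i               ≈⟨ coeff-∙ (a +ʳ b) f i ⟩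
    (a +ʳ b) *ʳ coeff f i                 ≈⟨ R.distribʳ _ _ _ ⟩
    a *ʳ coeff f i +ʳ b *ʳ coeff f i      ≈⟨ +-cong (coeff-∙ a f i) (coeff-∙ b f i) ⟨
    coeff (a ∙ₚ f) i +ʳ coeff (b ∙ₚ f) i  ≈⟨ coeff-+ (a ∙ₚ f) (b ∙ₚ f) i ⟨
    coeff (a ∙ₚ f +ₚ b ∙ₚ f) i            ∎
    where open SetoidReasoning setoid

  ∙ₚ-assoc : ∀ a b f → (a *ʳ b) ∙ₚ f ≋ a ∙ₚ b ∙ₚ f
  at (∙ₚ-assoc a b f) i = begin
    coeff ((a *ʳ b) ∙ₚ f) i   ≈⟨ coeff-∙ (a *ʳ b) f i ⟩
    a *ʳ b *ʳ coeff f i       ≈⟨ R.*-assoc _ _ _ ⟩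
    a *ʳ (b *ʳ coeff f i)     ≈⟨ *-congˡ (coeff-∙ b f i) ⟨
    a *ʳ coeff (b ∙ₚ f) i     ≈⟨ coeff-∙ a (b ∙ₚ f) i ⟨
    coeff (a ∙ₚ b ∙ₚ f) i     ∎
    where open SetoidReasoning setoid

  shift-+ : ∀ f g → 0# ∷ (f +ₚ g) ≋ (0# ∷ f) +ₚ (0# ∷ g)
  at (shift-+ f g) zero = ≈-sym (+-identityˡ 0#)
  at (shift-+ f g) (suc i) = ≈-refl

  ∷≈constant+shift : ∀ a f → a ∷ f ≋ constant a +ₚ (0# ∷ f)
  at (∷≈constant+shift a f) zero = ≈-sym (+-identityʳ a)
  at (∷≈constant+shift a f) (suc i) = ≈-refl

  ∙ₚ-shift : ∀ a f → a ∙ₚ (0# ∷ f) ≋ 0# ∷ a ∙ₚ f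
  at (∙ₚ-shift a f) zero = R.zeroʳ a
  at (∙ₚ-shift a f) (suc i) = ≈-refl

  private
    open module ≋ = SetoidReasoning ≋-setoid

    interchange : ∀ e f g h → (e +ₚ f) +ₚ (g +ₚ h) ≋ (e +ₚ g) +ₚ (f +ₚ h)
    interchange e f g h = begin
      (e +ₚ f) +ₚ (g +ₚ h) ≈⟨ +ₚ-assoc e f (g +ₚ h) ⟩
      e +ₚ (f +ₚ (g +ₚ h)) ≈⟨ +ₚ-cong {e} ≋-refl (≋-sym (+ₚ-assoc f g h)) ⟩
      e +ₚ ((f +ₚ g) +ₚ h) ≈⟨ +ₚ-cong {e} ≋-refl (+ₚ-cong {g = h} (+ₚ-comm f g) ≋-refl) ⟩
      e +ₚ ((g +ₚ f) +ₚ h) ≈⟨ +ₚ-cong {e} ≋-refl (+ₚ-assoc g f h) ⟩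
      e +ₚ (g +ₚ (f +ₚ h)) ≈⟨ +ₚ-assoc e g (f +ₚ h) ⟨
      (e +ₚ g) +ₚ (f +ₚ h) ∎

  -- Equal polynomials may be lists of different lengths, so congruence in the left factor cannot
  -- rely on a simultaneous recursion alone. This settles the case where one list ends first.
  zero*ₚ : ∀ f g → f ≋ [] → f *ₚ g ≋ []
  zero*ₚ [] g f≈0 = ≋-refl
  zero*ₚ (a ∷ f) g f≈0 = begin
    a ∙ₚ g +ₚ (0# ∷ f *ₚ g)  ≈⟨ +ₚ-cong (∙ₚ-zeroˡ g (at f≈0 zero)) (∷-cong ≈-refl (zero*ₚ f g (tail[] f≈0))) ⟩
    0# ∷ []                  ≈⟨ 0∷[]≈[] ⟩
    []                       ∎

  *ₚ-congʳ : ∀ {f f′} g → f ≋ f′ → f *ₚ g ≋ f′ *ₚ g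
  *ₚ-congʳ {[]} {f′} g p = ≋-sym (zero*ₚ f′ g (≋-sym p))
  *ₚ-congʳ {a ∷ f} {[]} g p = zero*ₚ (a ∷ f) g p
  *ₚ-congʳ {a ∷ f} {b ∷ f′} g p =
    +ₚ-cong (∙ₚ-cong (at p zero) ≋-refl) (∷-cong ≈-refl (*ₚ-congʳ g (tail p)))

  *ₚ-congˡ : ∀ f {g g′} → g ≋ g′ → f *ₚ g ≋ f *ₚ g′
  *ₚ-congˡ [] p = ≋-refl
  *ₚ-congˡ (a ∷ f) {g} {g′} p = +ₚ-cong (∙ₚ-cong {a} ≈-refl p) (∷-cong ≈-refl (*ₚ-congˡ f {g} {g′} p))

  *ₚ-distribʳ : ∀ h f g → (f +ₚ g) *ₚ h ≋ f *ₚ h +ₚ g *ₚ h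
  *ₚ-distribʳ h [] g = ≋-refl
  *ₚ-distribʳ h (a ∷ f) [] = ≋-sym (+ₚ-identityʳ ((a ∷ f) *ₚ h))
  *ₚ-distribʳ h (a ∷ f) (b ∷ g) = begin
    (a +ʳ b) ∙ₚ h +ₚ (0# ∷ (f +ₚ g) *ₚ h)
      ≈⟨ +ₚ-cong (∙ₚ-distribʳ a b h) (∷-cong ≈-refl (*ₚ-distribʳ h f g)) ⟩
    (a ∙ₚ h +ₚ b ∙ₚ h) +ₚ (0# ∷ (f *ₚ h +ₚ g *ₚ h))
      ≈⟨ +ₚ-cong ≋-refl (shift-+ (f *ₚ h) (g *ₚ h)) ⟩
    (a ∙ₚ h +ₚ b ∙ₚ h) +ₚ ((0# ∷ f *ₚ h) +ₚ (0# ∷ g *ₚ h))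
      ≈⟨ interchange (a ∙ₚ h) (b ∙ₚ h) (0# ∷ f *ₚ h) (0# ∷ g *ₚ h) ⟩
    (a ∷ f) *ₚ h +ₚ (b ∷ g) *ₚ h ∎

  *ₚ-zeroʳ : ∀ f → f *ₚ [] ≋ []
  *ₚ-zeroʳ [] = ≋-refl
  *ₚ-zeroʳ (a ∷ f) = begin
    0# ∷ f *ₚ []  ≈⟨ ∷-cong ≈-refl (*ₚ-zeroʳ f) ⟩
    0# ∷ []       ≈⟨ 0∷[]≈[] ⟩
    []            ∎

  *ₚ-shift : ∀ f g → f *ₚ (0# ∷ g) ≋ 0# ∷ f *ₚ g
  *ₚ-shift [] g = ≋-sym 0∷[]≈[]
  *ₚ-shift (a ∷ f) g = begin
    a ∙ₚ (0# ∷ g) +ₚ (0# ∷ f *ₚ (0# ∷ g))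
      ≈⟨ +ₚ-cong (∙ₚ-shift a g) (∷-cong ≈-refl (*ₚ-shift f g)) ⟩
    (0# ∷ a ∙ₚ g) +ₚ (0# ∷ (0# ∷ f *ₚ g))
      ≈⟨ shift-+ (a ∙ₚ g) (0# ∷ f *ₚ g) ⟨
    0# ∷ (a ∙ₚ g +ₚ (0# ∷ f *ₚ g)) ∎

  *ₚ-constant : ∀ f a → f *ₚ constant a ≋ a ∙ₚ f
  *ₚ-constant [] a = ≋-refl
  at (*ₚ-constant (b ∷ f) a) zero = ≈-trans (+-identityʳ (b *ʳ a)) (R.*-comm b a)
  at (*ₚ-constant (b ∷ f) a) (suc i) = at (*ₚ-constant f a) i

  constant*ₚ : ∀ a f → constant a *ₚ f ≋ a ∙ₚ f
  constant*ₚ a f = begin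
    a ∙ₚ f +ₚ (0# ∷ [])  ≈⟨ +ₚ-cong ≋-refl 0∷[]≈[] ⟩
    a ∙ₚ f +ₚ []         ≈⟨ +ₚ-identityʳ (a ∙ₚ f) ⟩
    a ∙ₚ f               ∎

  *ₚ-distribˡ : ∀ f g h → f *ₚ (g +ₚ h) ≋ f *ₚ g +ₚ f *ₚ h
  *ₚ-distribˡ [] g h = ≋-refl
  *ₚ-distribˡ (a ∷ f) g h = begin
    a ∙ₚ (g +ₚ h) +ₚ (0# ∷ f *ₚ (g +ₚ h))
      ≈⟨ +ₚ-cong (∙ₚ-distribˡ a g h) (∷-cong ≈-refl (*ₚ-distribˡ f g h)) ⟩
    (a ∙ₚ g +ₚ a ∙ₚ h) +ₚ (0# ∷ (f *ₚ g +ₚ f *ₚ h))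
      ≈⟨ +ₚ-cong ≋-refl (shift-+ (f *ₚ g) (f *ₚ h)) ⟩
    (a ∙ₚ g +ₚ a ∙ₚ h) +ₚ ((0# ∷ f *ₚ g) +ₚ (0# ∷ f *ₚ h))
      ≈⟨ interchange (a ∙ₚ g) (a ∙ₚ h) (0# ∷ f *ₚ g) (0# ∷ f *ₚ h) ⟩
    (a ∷ f) *ₚ g +ₚ (a ∷ f) *ₚ h ∎

  *ₚ-comm : ∀ f g → f *ₚ g ≋ g *ₚ f
  *ₚ-comm [] g = ≋-sym (*ₚ-zeroʳ g)
  *ₚ-comm (a ∷ f) g = begin
    a ∙ₚ g +ₚ (0# ∷ f *ₚ g)
      ≈⟨ +ₚ-cong (≋-sym (*ₚ-constant g a)) (∷-cong ≈-refl (*ₚ-comm f g)) ⟩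
    g *ₚ constant a +ₚ (0# ∷ g *ₚ f)
      ≈⟨ +ₚ-cong ≋-refl (≋-sym (*ₚ-shift g f)) ⟩
    g *ₚ constant a +ₚ g *ₚ (0# ∷ f)
      ≈⟨ *ₚ-distribˡ g (constant a) (0# ∷ f) ⟨
    g *ₚ (constant a +ₚ (0# ∷ f))
      ≈⟨ *ₚ-congˡ g (≋-sym (∷≈constant+shift a f)) ⟩
    g *ₚ (a ∷ f) ∎

  ∙ₚ-*ₚ : ∀ a f g → (a ∙ₚ f) *ₚ g ≋ a ∙ₚ (f *ₚ g)
  ∙ₚ-*ₚ a [] g = ≋-refl
  ∙ₚ-*ₚ a (b ∷ f) g = begin
    (a *ʳ b) ∙ₚ g +ₚ (0# ∷ (a ∙ₚ f) *ₚ g)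
      ≈⟨ +ₚ-cong (∙ₚ-assoc a b g) (∷-cong ≈-refl (∙ₚ-*ₚ a f g)) ⟩
    a ∙ₚ b ∙ₚ g +ₚ (0# ∷ a ∙ₚ (f *ₚ g))
      ≈⟨ +ₚ-cong ≋-refl (≋-sym (∙ₚ-shift a (f *ₚ g))) ⟩
    a ∙ₚ b ∙ₚ g +ₚ a ∙ₚ (0# ∷ f *ₚ g)
      ≈⟨ ∙ₚ-distribˡ a (b ∙ₚ g) (0# ∷ f *ₚ g) ⟨
    a ∙ₚ (b ∙ₚ g +ₚ (0# ∷ f *ₚ g)) ∎

  shift-*ₚ : ∀ f g → (0# ∷ f) *ₚ g ≋ 0# ∷ f *ₚ g
  shift-*ₚ f g = +ₚ-cong (∙ₚ-zeroˡ g ≈-refl) ≋-refl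

  *ₚ-assoc : ∀ f g h → (f *ₚ g) *ₚ h ≋ f *ₚ (g *ₚ h)
  *ₚ-assoc [] g h = ≋-refl
  *ₚ-assoc (a ∷ f) g h = begin
    (a ∙ₚ g +ₚ (0# ∷ f *ₚ g)) *ₚ h
      ≈⟨ *ₚ-distribʳ h (a ∙ₚ g) (0# ∷ f *ₚ g) ⟩
    (a ∙ₚ g) *ₚ h +ₚ (0# ∷ f *ₚ g) *ₚ h
      ≈⟨ +ₚ-cong (∙ₚ-*ₚ a g h) (shift-*ₚ (f *ₚ g) h) ⟩
    a ∙ₚ (g *ₚ h) +ₚ (0# ∷ (f *ₚ g) *ₚ h)
      ≈⟨ +ₚ-cong ≋-refl (∷-cong ≈-refl (*ₚ-assoc f g h)) ⟩
    a ∙ₚ (g *ₚ h) +ₚ (0# ∷ f *ₚ (g *ₚ h)) ∎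

  *ₚ-identityˡ : ∀ f → constant 1# *ₚ f ≋ f
  *ₚ-identityˡ f = ≋-trans (constant*ₚ 1# f) (∙ₚ-identity f)

  polyRing : CommutativeRing c ℓ
  polyRing = record
    { Carrier = Poly
    ; _≈_ = _≋_
    ; _+_ = _+ₚ_
    ; _*_ = _*ₚ_
    ; -_ = -ₚ_
    ; 0# = []
    ; 1# = constant 1#
    ; isCommutativeRing = record
      { isRing = record
        { +-isAbelianGroup = record
          { isGroup = record
            { isMonoid = record
              { isSemigroup = record
                { isMagma = record
                  { isEquivalence = Setoid.isEquivalence ≋-setoid
                  ; ∙-cong = +ₚ-cong
                  }
                ; assoc = +ₚ-assoc
                }
              ; identity = (λ f → ≋-refl) , +ₚ-identityʳ
              }
            ; inverse = (λ f → ≋-trans (+ₚ-comm (-ₚ f) f) (+ₚ-inverseʳ f)) , +ₚ-inverseʳ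
            ; ⁻¹-cong = -ₚ-cong
            }
          ; comm = +ₚ-comm
          }
        ; *-cong = λ {_} {f′} {g} p q → ≋-trans (*ₚ-congʳ g p) (*ₚ-congˡ f′ q)
        ; *-assoc = *ₚ-assoc
        ; *-identity = *ₚ-identityˡ , λ f → ≋-trans (*ₚ-comm f (constant 1#)) (*ₚ-identityˡ f)
        ; distrib = *ₚ-distribˡ , *ₚ-distribʳ
        }
      ; *-comm = *ₚ-comm
      }
    }

-- Divisibility and degree

module RingDivisibility {c ℓ} (R : CommutativeRing c ℓ) where
  open CommutativeRing R renaming (refl to ≈-refl; sym to ≈-sym; trans to ≈-trans)
  open RawSR (Semiring.rawSemiring semiring) public using (_^_)
  open Divisibility semiring public using (_∣_; _∤_; _,_; ∣-respˡ; ∣-respʳ; ∣-trans; ∣ʳ-refl; _∣0; 1∣_; x∣ʳy⇒x∣ʳzy)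
  open NatSolver commutativeSemiring using (solve; con; _:+_; _:*_; _:=_)
  open RingProperties ring using (-‿distribˡ-*)
  open SetoidReasoning setoid

  ∣-+ : ∀ {x y z} → x ∣ y → x ∣ z → x ∣ y + z
  ∣-+ (p , px≈y) (q , qx≈z) = p + q , ≈-trans (distribʳ _ p q) (+-cong px≈y qx≈z)

  ∣-neg : ∀ {x y} → x ∣ y → x ∣ - y
  ∣-neg (p , px≈y) = - p , ≈-trans (≈-sym (-‿distribˡ-* p _)) (-‿cong px≈y)

  ∣-+⇒∣ʳ : ∀ {x y z} → x ∣ y + z → x ∣ y → x ∣ z
  ∣-+⇒∣ʳ {x} {y} {z} x∣y+z x∣y = ∣-respʳ (begin
    - y + (y + z)  ≈⟨ +-assoc (- y) y z ⟨
    - y + y + z    ≈⟨ +-congʳ (-‿inverseˡ y) ⟩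
    0# + z         ≈⟨ +-identityˡ z ⟩
    z              ∎) (∣-+ (∣-neg x∣y) x∣y+z)

  Bézout : Carrier → Carrier → Set (c ⊔ ℓ)
  Bézout x y = ∃[ s ] ∃[ t ] s * x + t * y ≈ 1#

  bézout-sym : ∀ {x y} → Bézout x y → Bézout y x
  bézout-sym (s , t , eq) = t , s , ≈-trans (+-comm _ _) eq

  -- The product of the two relations: every term of the expansion except `t t′ y z` contains `x`.
  bézout-* : ∀ {x y z} → Bézout x y → Bézout x z → Bézout x (y * z)
  bézout-* {x} {y} {z} (s , t , eq) (s′ , t′ , eq′) = s * (s′ * x + t′ * z) + t * y * s′ , t * t′ , (begin
    (s * (s′ * x + t′ * z) + t * y * s′) * x + t * t′ * (y * z)
      ≈⟨ solve 7 (λ x y z s t s′ t′ →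
           (s :* (s′ :* x :+ t′ :* z) :+ t :* y :* s′) :* x :+ t :* t′ :* (y :* z)
           := (s :* x :+ t :* y) :* (s′ :* x :+ t′ :* z)) ≈-refl x y z s t s′ t′ ⟩
    (s * x + t * y) * (s′ * x + t′ * z) ≈⟨ *-cong eq eq′ ⟩
    1# * 1#                             ≈⟨ *-identityˡ 1# ⟩
    1#                                  ∎)

  bézout-1 : ∀ x → Bézout x 1#
  bézout-1 x = 0# , 1# , ≈-trans (+-cong (zeroˡ x) (*-identityˡ 1#)) (+-identityˡ 1#)

  bézout-^ʳ : ∀ {x y} n → Bézout x y → Bézout x (y ^ n)
  bézout-^ʳ {x} zero    b = bézout-1 x
  bézout-^ʳ     (suc n) b = bézout-* b (bézout-^ʳ n b)

  bézout-^ : ∀ {x y} m n → Bézout x y → Bézout (x ^ m) (y ^ n)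
  bézout-^ m n b = bézout-^ʳ n (bézout-sym (bézout-^ʳ m (bézout-sym b)))

  -- With s inverse to m modulo n, the congruence h m ≡ -z (mod n) reads h ≡ -s z.
  module _ {m n} (b : Bézout m n) (h z : Carrier) where
    private
      s = proj₁ b
      t = proj₁ (proj₂ b)
      eq = proj₂ (proj₂ b)

    ∣-unscale : n ∣ h * m + z → n ∣ h + s * z
    ∣-unscale n∣ = ∣-respʳ (begin
      s * (h * m + z) + t * h * n
        ≈⟨ solve 6 (λ s t m n h z → s :* (h :* m :+ z) :+ t :* h :* n
             := (s :* m :+ t :* n) :* h :+ s :* z) ≈-refl s t m n h z ⟩
      (s * m + t * n) * h + s * z ≈⟨ +-congʳ (*-congʳ eq) ⟩
      1# * h + s * z              ≈⟨ +-congʳ (*-identityˡ h) ⟩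
      h + s * z                   ∎) (∣-+ (x∣ʳy⇒x∣ʳzy s n∣) (t * h , ≈-refl))

    ∣-scale : n ∣ h + s * z → n ∣ h * m + z
    ∣-scale n∣ = ∣-respʳ (begin
      m * (h + s * z) + t * z * n
        ≈⟨ solve 6 (λ s t m n h z → m :* (h :+ s :* z) :+ t :* z :* n
             := h :* m :+ (s :* m :+ t :* n) :* z) ≈-refl s t m n h z ⟩
      h * m + (s * m + t * n) * z ≈⟨ +-congˡ (*-congʳ eq) ⟩
      h * m + 1# * z              ≈⟨ +-congˡ (*-identityˡ z) ⟩
      h * m + z                   ∎) (∣-+ (x∣ʳy⇒x∣ʳzy m n∣) (t * z , ≈-refl))

  bézout-unit : ∀ {x y} s t → s * x + t * y ∣ 1# → Bézout x y
  bézout-unit {x} {y} s t (u , eq) = u * s , u * t , ≈-trans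
    (solve 5 (λ u s t x y → u :* s :* x :+ u :* t :* y := u :* (s :* x :+ t :* y)) ≈-refl u s t x y) eq

  -- Back substitution in the extended Euclidean algorithm: `u g` is the normalised divisor,
  -- `f + q (u g)` the remainder, and the right side is the relation returned by the recursive call.
  euclid-step : ∀ s t u q f g →
    t * f + (s * u + t * q * u) * g ≈ s * (u * g) + t * (f + q * (u * g))
  euclid-step = solve 6 (λ s t u q f g →
    t :* f :+ (s :* u :+ t :* q :* u) :* g := s :* (u :* g) :+ t :* (f :+ q :* (u :* g))) ≈-refl

  unit-cofactor : ∀ {x y z} → x ∣ 1# → x * y ≈ z → z ∣ y
  unit-cofactor {x} {y} {z} (u , ux≈1) xy≈z = u , (begin
    u * z        ≈⟨ *-congˡ xy≈z ⟨
    u * (x * y)  ≈⟨ *-assoc u x y ⟨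
    u * x * y    ≈⟨ *-congʳ ux≈1 ⟩
    1# * y       ≈⟨ *-identityˡ y ⟩
    y            ∎)

module PolynomialDegree {c ℓ} (R : CommutativeRing c ℓ) where
  private module R = CommutativeRing R
  open CommutativeRing R using (Carrier; 0#; 1#; _≈_)
  open Polynomials R
  open PolynomialRing R
  open RingDivisibility polyRing using (_^_)

  DegreeBelow : ℕ → Poly → Set ℓ
  DegreeBelow n f = ∀ i → n ≤ i → coeff f i ≈ 0#

  below-resp : ∀ {n f g} → f ≋ g → DegreeBelow n f → DegreeBelow n g
  below-resp f≋g bf i n≤i = R.trans (R.sym (at f≋g i)) (bf i n≤i)

  below-+ : ∀ {n} f g → DegreeBelow n f → DegreeBelow n g → DegreeBelow n (f +ₚ g)
  below-+ f g bf bg i n≤i = R.trans (coeff-+ f g i)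
    (R.trans (R.+-cong (bf i n≤i) (bg i n≤i)) (R.+-identityˡ 0#))

  below-∙ : ∀ {n} a f → DegreeBelow n f → DegreeBelow n (a ∙ₚ f)
  below-∙ a f bf i n≤i = R.trans (coeff-∙ a f i) (R.trans (R.*-congˡ (bf i n≤i)) (R.zeroʳ a))

  below-neg : ∀ {n} f → DegreeBelow n f → DegreeBelow n (-ₚ f)
  below-neg f bf i n≤i = R.trans (coeff-neg f i)
    (R.trans (R.-‿cong (bf i n≤i)) (RingProperties.-0#≈0# R.ring))

  below-tail : ∀ {n a f} → DegreeBelow (suc n) (a ∷ f) → DegreeBelow n f
  below-tail b i n≤i = b (suc i) (s≤s n≤i)

  below-0 : ∀ f → DegreeBelow 0 f → f ≋ []
  at (below-0 f b) i = b i z≤n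

  monic-resp : ∀ {n f g} → f ≋ g → MonicOfDegree n f → MonicOfDegree n g
  monic-resp {n} {f} {g} f≋g (lead , b) = R.trans (R.sym (at f≋g n)) lead , below-resp {suc n} {f} {g} f≋g b

  monic-+ : ∀ {n} f g → MonicOfDegree n f → DegreeBelow n g → MonicOfDegree n (f +ₚ g)
  monic-+ {n} f g (lead , bf) bg =
      R.trans (coeff-+ f g n) (R.trans (R.+-cong lead (bg n ℕ.≤-refl)) (R.+-identityʳ 1#))
    , below-+ f g bf (λ i n<i → bg i (ℕ.<⇒≤ n<i))

  -- Assuming only upper bounds on the degrees makes this valid over any commutative ring. Monicity,
  -- or a field of coefficients, then shows that the coefficient does not vanish.
  *-lead : ∀ d e f g → DegreeBelow (suc d) f → DegreeBelow (suc e) g →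
           coeff (f *ₚ g) (d ℕ.+ e) ≈ coeff f d R.* coeff g e × DegreeBelow (suc (d ℕ.+ e)) (f *ₚ g)
  *-lead d e [] g bf bg = R.sym (R.zeroˡ _) , λ _ _ → R.refl
  *-lead zero e (a ∷ f) g bf bg =
      R.trans (at eq e) (coeff-∙ a g e)
    , below-resp {suc e} {a ∙ₚ g} {(a ∷ f) *ₚ g} (≋-sym eq) (below-∙ a g bg)
    where
    eq : (a ∷ f) *ₚ g ≋ a ∙ₚ g
    eq = ≋-trans (*ₚ-congʳ g (∷-cong R.refl (below-0 f (below-tail {0} {a} {f} bf)))) (constant*ₚ a g)
  *-lead (suc d) e (a ∷ f) g bf bg with *-lead d e f g (below-tail {suc d} {a} {f} bf) bg
  ... | lead , below =
      R.trans (coeff-+ (a ∙ₚ g) (0# ∷ f *ₚ g) (suc (d ℕ.+ e)))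
        (R.trans (R.+-cong (ag (suc (d ℕ.+ e)) (s≤s (ℕ.m≤n+m e d))) lead) (R.+-identityˡ _))
    , below-+ (a ∙ₚ g) (0# ∷ f *ₚ g)
        (λ i le → ag i (ℕ.≤-trans (s≤s (ℕ.m≤n+m e (suc d))) le))
        (λ { (suc i) (s≤s le) → below i le })
    where
    ag = below-∙ a g bg

  monic-* : ∀ {d e} f g → MonicOfDegree d f → MonicOfDegree e g → MonicOfDegree (d ℕ.+ e) (f *ₚ g)
  monic-* {d} {e} f g (leadf , bf) (leadg , bg) with *-lead d e f g bf bg
  ... | lead , below = R.trans lead (R.trans (R.*-cong leadf leadg) (R.*-identityˡ 1#)) , below

  monic-1 : MonicOfDegree 0 (constant 1#)
  monic-1 = R.refl , λ { (suc i) _ → R.refl }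

  monic-^ : ∀ {d} f k → MonicOfDegree d f → MonicOfDegree (k ℕ.* d) (f ^ k)
  monic-^ f zero    mf = monic-1
  monic-^ f (suc k) mf = monic-* f (f ^ k) mf (monic-^ f k mf)

  -- Reduction modulo m, as f + q m = r so that no subtraction is needed.
  reduce : ∀ {e} m → MonicOfDegree e m → ∀ f → ∃[ q ] ∃[ r ] DegreeBelow e r × f +ₚ q *ₚ m ≋ r
  reduce m mm [] = [] , [] , (λ _ _ → R.refl) , ≋-refl
  reduce {e} m (lead , bm) (a ∷ f) with reduce m (lead , bm) f
  ... | q , r , br , f+qm≋r = R.- l ∷ q , (a ∷ r) +ₚ (R.- l) ∙ₚ m , below , eq
    where
    l = coeff (a ∷ r) e
    above : ∀ i → suc e ≤ i → coeff (a ∷ r) i ≈ 0#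
    above (suc i) (s≤s e≤i) = br i e≤i
    below : DegreeBelow e ((a ∷ r) +ₚ (R.- l) ∙ₚ m)
    below i e≤i with ℕ.m≤n⇒m<n∨m≡n e≤i
    ... | inj₁ e<i = below-+ (a ∷ r) ((R.- l) ∙ₚ m) above (below-∙ (R.- l) m bm) i e<i
    ... | inj₂ refl = R.trans (coeff-+ (a ∷ r) ((R.- l) ∙ₚ m) e)
      (R.trans (R.+-congˡ (R.trans (coeff-∙ (R.- l) m e) (R.trans (R.*-congˡ lead) (R.*-identityʳ _))))
               (R.-‿inverseʳ l))
    open SetoidReasoning ≋-setoid
    module P = CommutativeRing polyRing
    step : (a ∷ f) +ₚ (0# ∷ q *ₚ m) ≋ a ∷ r
    step = ∷-cong (R.+-identityʳ a) f+qm≋r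
    eq : (a ∷ f) +ₚ (R.- l ∷ q) *ₚ m ≋ (a ∷ r) +ₚ (R.- l) ∙ₚ m
    eq = begin
      (a ∷ f) +ₚ ((R.- l) ∙ₚ m +ₚ (0# ∷ q *ₚ m))  ≈⟨ P.+-congˡ {a ∷ f} (P.+-comm ((R.- l) ∙ₚ m) (0# ∷ q *ₚ m)) ⟩
      (a ∷ f) +ₚ ((0# ∷ q *ₚ m) +ₚ (R.- l) ∙ₚ m)  ≈⟨ P.+-assoc (a ∷ f) (0# ∷ q *ₚ m) ((R.- l) ∙ₚ m) ⟨
      ((a ∷ f) +ₚ (0# ∷ q *ₚ m)) +ₚ (R.- l) ∙ₚ m  ≈⟨ P.+-congʳ {(R.- l) ∙ₚ m} step ⟩
      (a ∷ r) +ₚ (R.- l) ∙ₚ m                     ∎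

-- Polynomials over a finite field

module FiniteFieldPolynomials {c ℓ₁ ℓ₂} (F : FiniteField c ℓ₁ ℓ₂)
  (1≉0 : ¬ FiniteField._≈_ F (FiniteField.1# F) (FiniteField.0# F)) where

  open OverFiniteField F public hiding (0#)
  open CommutativeRing commutativeRing public using (_≈_; 0#; 1#)
  private
    module F = FiniteField F
    module R = CommutativeRing commutativeRing
  open PolynomialRing commutativeRing public
  open PolynomialDegree commutativeRing public
  open RingDivisibility polyRing public hiding (_∣_; _∤_; _^_)
  open RingDivisibility polyRing public using () renaming (_∣_ to _∣ᵖ_)
  private
    module P = CommutativeRing polyRing
    module I = Inverse F.cardinality

  infix 4 _≟_
  _≟_ : Decidable _≈_
  x ≟ y = map′ to-injective I.to-cong (I.to x Fin.≟ I.to y)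
    where
    to-injective : I.to x ≡ I.to y → x ≈ y
    to-injective eq = R.trans (R.sym (I.strictlyInverseʳ x))
      (R.trans (R.reflexive (≡.cong I.from eq)) (I.strictlyInverseʳ y))

  -- The inverse is found by search; tightness turns a failed search into x ≈ 0.
  inverse : ∀ x → ¬ x ≈ 0# → ∃[ y ] y R.* x ≈ 1#
  inverse x x≉0 with Fin.any? (λ i → I.from i R.* x ≟ 1#)
  ... | yes (i , eq) = I.from i , eq
  ... | no none = contradiction (proj₁ (F.tight x 0#) not-apart) x≉0
    where
    not-apart : ¬ x F.# 0#
    not-apart x#0 with F.#⇒invertible x#0
    ... | z , eq , _ = none (I.to z , (begin
      I.from (I.to z) R.* x  ≈⟨ R.*-congʳ (I.strictlyInverseʳ z) ⟩
      z R.* x                ≈⟨ R.*-congˡ (R.+-identityʳ x) ⟨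
      z R.* (x R.+ 0#)       ≈⟨ R.*-congˡ (R.+-congˡ (RingProperties.-0#≈0# R.ring)) ⟨
      z R.* (x R.- 0#)       ≈⟨ eq ⟩
      1#                     ∎))
      where open SetoidReasoning R.setoid

  *-nonzero : ∀ {x y} → ¬ x ≈ 0# → ¬ y ≈ 0# → ¬ x R.* y ≈ 0#
  *-nonzero {x} {y} x≉0 y≉0 xy≈0 with inverse x x≉0
  ... | z , zx≈1 = y≉0 (begin
    y                ≈⟨ R.*-identityˡ y ⟨
    1# R.* y         ≈⟨ R.*-congʳ zx≈1 ⟨
    z R.* x R.* y    ≈⟨ R.*-assoc z x y ⟩
    z R.* (x R.* y)  ≈⟨ R.*-congˡ xy≈0 ⟩
    z R.* 0#         ≈⟨ R.zeroʳ z ⟩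
    0#               ∎)
    where open SetoidReasoning R.setoid

  1<order : 1 < order
  1<order = two-elements (I.to 0#) (I.to 1#) to≢
    where
    two-elements : ∀ {n} (i j : Fin n) → ¬ i ≡ j → 1 < n
    two-elements {suc zero} zero zero i≢j = contradiction refl i≢j
    two-elements {suc (suc n)} _ _ _ = s≤s (s≤s z≤n)
    to≢ : ¬ I.to 0# ≡ I.to 1#
    to≢ eq = 1≉0 (R.trans (R.sym (I.strictlyInverseʳ 1#))
      (R.trans (R.reflexive (≡.cong I.from (≡.sym eq))) (I.strictlyInverseʳ 0#)))

  Leading : ℕ → Poly → Set ℓ₁
  Leading d f = ¬ coeff f d ≈ 0# × DegreeBelow (suc d) f

  zero-or-leading : ∀ f → f ≋ [] ⊎ ∃[ d ] Leading d f
  zero-or-leading [] = inj₁ ≋-refl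
  zero-or-leading (a ∷ f) with zero-or-leading f
  ... | inj₂ (d , lead , b) = inj₂ (suc d , lead , λ { (suc i) (s≤s le) → b i le })
  ... | inj₁ f≋[] with a ≟ 0#
  ...   | yes a≈0 = inj₁ (≋-trans (∷-cong a≈0 f≋[]) 0∷[]≈[])
  ...   | no a≉0 = inj₂ (0 , a≉0 , λ { (suc i) _ → at f≋[] i })

  leading-resp : ∀ {d f g} → f ≋ g → Leading d f → Leading d g
  leading-resp {d} {f} {g} f≋g (lead , b) =
    (λ eq → lead (R.trans (at f≋g d) eq)) , below-resp {suc d} {f} {g} f≋g b

  leading-≤ : ∀ {d e} f → ¬ coeff f d ≈ 0# → DegreeBelow e f → d < e
  leading-≤ f nz b = ℕ.≰⇒> (λ le → nz (b _ le))

  leading-unique : ∀ {d e} f → Leading d f → Leading e f → d ≡ e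
  leading-unique f (nz , b) (nz′ , b′) =
    ℕ.≤-antisym (ℕ.s≤s⁻¹ (leading-≤ f nz b′)) (ℕ.s≤s⁻¹ (leading-≤ f nz′ b))

  monic⇒leading : ∀ {d} f → MonicOfDegree d f → Leading d f
  monic⇒leading f (lead , b) = (λ eq → 1≉0 (R.trans (R.sym lead) eq)) , b

  leading≢[] : ∀ {d} f → Leading d f → ¬ f ≋ []
  leading≢[] {d} f (nz , _) f≋[] = nz (at f≋[] d)

  leading-* : ∀ {d e} f g → Leading d f → Leading e g → Leading (d ℕ.+ e) (f *ₚ g)
  leading-* {d} {e} f g (nzf , bf) (nzg , bg) with *-lead d e f g bf bg
  ... | lead , b = (λ eq → *-nonzero nzf nzg (R.trans (R.sym lead) eq)) , b

  monic-degree-unique : ∀ {d e} f → MonicOfDegree d f → MonicOfDegree e f → d ≡ e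
  monic-degree-unique f mf mf′ = leading-unique f (monic⇒leading f mf) (monic⇒leading f mf′)

  *-monic-zero : ∀ {e} h m → MonicOfDegree e m → h *ₚ m ≋ [] → h ≋ []
  *-monic-zero h m mm hm≋[] with zero-or-leading h
  ... | inj₁ h≋[] = h≋[]
  ... | inj₂ (d , lh) = contradiction hm≋[] (leading≢[] (h *ₚ m) (leading-* h m lh (monic⇒leading m mm)))

  *-monic-cancel : ∀ {e} h h′ m → MonicOfDegree e m → h *ₚ m ≋ h′ *ₚ m → h ≋ h′
  *-monic-cancel h h′ m mm eq = begin
    h                       ≈⟨ P.+-identityʳ h ⟨
    h +ₚ []                 ≈⟨ P.+-congˡ {h} (P.-‿inverseˡ h′) ⟨
    h +ₚ (-ₚ h′ +ₚ h′)      ≈⟨ P.+-assoc h (-ₚ h′) h′ ⟨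
    (h +ₚ -ₚ h′) +ₚ h′      ≈⟨ P.+-congʳ {h′} (*-monic-zero (h +ₚ -ₚ h′) m mm diff≋[]) ⟩
    h′                      ∎
    where
    open SetoidReasoning ≋-setoid
    diff≋[] : (h +ₚ -ₚ h′) *ₚ m ≋ []
    diff≋[] = begin
      (h +ₚ -ₚ h′) *ₚ m          ≈⟨ P.distribʳ m h (-ₚ h′) ⟩
      h *ₚ m +ₚ (-ₚ h′) *ₚ m     ≈⟨ P.+-congˡ {h *ₚ m} (RingProperties.-‿distribˡ-* P.ring h′ m) ⟨
      h *ₚ m +ₚ -ₚ (h′ *ₚ m)     ≈⟨ P.+-congʳ { -ₚ (h′ *ₚ m)} eq ⟩
      h′ *ₚ m +ₚ -ₚ (h′ *ₚ m)    ≈⟨ P.-‿inverseʳ (h′ *ₚ m) ⟩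
      []                         ∎

  quotient-monic : ∀ {e n} h m f → MonicOfDegree e m → MonicOfDegree n f → h *ₚ m ≋ f →
                   ∃[ d ] n ≡ d ℕ.+ e × MonicOfDegree d h
  quotient-monic {e} {n} h m f mm mf hm≋f with zero-or-leading h
  ... | inj₁ h≋[] = contradiction (≋-trans (≋-sym hm≋f) (*ₚ-congʳ m h≋[])) (leading≢[] f (monic⇒leading f mf))
  ... | inj₂ (d , lh) = d , n≡ , lead , proj₂ lh
    where
    n≡ : n ≡ d ℕ.+ e
    n≡ = leading-unique f (monic⇒leading f mf)
      (leading-resp {_} {h *ₚ m} {f} hm≋f (leading-* h m lh (monic⇒leading m mm)))
    open SetoidReasoning R.setoid
    lead : coeff h d ≈ 1#
    lead = begin
      coeff h d               ≈⟨ R.*-identityʳ _ ⟨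
      coeff h d R.* 1#        ≈⟨ R.*-congˡ (proj₁ mm) ⟨
      coeff h d R.* coeff m e ≈⟨ proj₁ (*-lead d e h m (proj₂ lh) (proj₂ mm)) ⟨
      coeff (h *ₚ m) (d ℕ.+ e) ≈⟨ at hm≋f (d ℕ.+ e) ⟩
      coeff f (d ℕ.+ e)       ≡⟨ ≡.cong (coeff f) n≡ ⟨
      coeff f n               ≈⟨ proj₁ mf ⟩
      1#                      ∎

  positive-degree∤1 : ∀ {d} f → MonicOfDegree (suc d) f → ¬ f ∣ᵖ constant 1#
  positive-degree∤1 f mf (h , eq) with quotient-monic h f (constant 1#) mf monic-1 eq
  ... | j , 0≡ , _ = ℕ.1+n≢0 (≡.trans (≡.sym (ℕ.+-suc j _)) (≡.sym 0≡))

  monic∣below⇒[] : ∀ {e} m r → MonicOfDegree e m → DegreeBelow e r → m ∣ᵖ r → r ≋ []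
  monic∣below⇒[] {e} m r mm br (h , hm≋r) with zero-or-leading h
  ... | inj₁ h≋[] = ≋-trans (≋-sym hm≋r) (*ₚ-congʳ m h≋[])
  ... | inj₂ (d , lh) = contradiction
    (leading-≤ r (proj₁ (leading-resp {_} {h *ₚ m} {r} hm≋r (leading-* h m lh (monic⇒leading m mm)))) br)
    (ℕ.≤⇒≯ (ℕ.m≤n+m e d))

  -- Reduction requires a monic modulus; scaling by the inverse of the leading coefficient supplies
  -- one with the same multiples and the same divisors.
  normalise : ∀ {d} f → Leading d f →
              ∃[ m ] MonicOfDegree d m × m ∣ᵖ f × f ∣ᵖ m
  normalise {d} f (nz , b) with inverse (coeff f d) nz
  ... | u , uf≈1 = u ∙ₚ f , (R.trans (coeff-∙ u f d) uf≈1 , below-∙ u f b)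
                 , (constant l , (begin
                     constant l *ₚ (u ∙ₚ f)  ≈⟨ constant*ₚ l (u ∙ₚ f) ⟩
                     l ∙ₚ u ∙ₚ f             ≈⟨ ∙ₚ-assoc l u f ⟨
                     (l R.* u) ∙ₚ f          ≈⟨ ∙ₚ-cong (R.trans (R.*-comm l u) uf≈1) (≋-refl {f}) ⟩
                     1# ∙ₚ f                 ≈⟨ ∙ₚ-identity f ⟩
                     f                       ∎))
                 , (constant u , constant*ₚ u f)
    where
    open SetoidReasoning ≋-setoid
    l = coeff f d

  leading-0∣1 : ∀ f → Leading 0 f → f ∣ᵖ constant 1#
  leading-0∣1 f lf with normalise f lf
  ... | m , (lead , b) , _ , f∣m = ∣-respʳ m≋1 f∣m
    where
    m≋1 : m ≋ constant 1#
    at m≋1 zero = lead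
    at m≋1 (suc i) = b (suc i) (s≤s z≤n)

  _≟[] : ∀ f → Dec (f ≋ [])
  f ≟[] with zero-or-leading f
  ... | inj₁ f≋[] = yes f≋[]
  ... | inj₂ (_ , lf) = no (leading≢[] f lf)

  infix 4 _∣ᵖ?_
  -- For nonzero `g` the test is whether the remainder modulo its monic associate vanishes; zero
  -- divides only zero.
  _∣ᵖ?_ : Decidable _∣ᵖ_
  g ∣ᵖ? f with zero-or-leading g
  ... | inj₁ g≋[] = map′
    (λ f≋[] → [] , ≋-sym f≋[])
    (λ (h , hg≋f) → ≋-trans (≋-sym hg≋f) (≋-trans (*ₚ-congˡ h g≋[]) (*ₚ-zeroʳ h)))
    (f ≟[])
  ... | inj₂ (e , lg) with normalise g lg
  ...   | m , mm , m∣g , g∣m with reduce m mm f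
  ...     | q , r , br , f+qm≋r = map′
    (λ r≋[] → ∣-trans g∣m (∣-+⇒∣ʳ {m} {q *ₚ m} {f}
      (∣-respʳ (≋-trans (≋-sym r≋[]) (≋-trans (≋-sym f+qm≋r) (+ₚ-comm f (q *ₚ m)))) (m ∣0))
      (q , ≋-refl)))
    (λ g∣f → monic∣below⇒[] m r mm br
      (∣-respʳ f+qm≋r (∣-+ {m} {f} (∣-trans m∣g g∣f) (q , ≋-refl))))
    (r ≟[])

  -- The Euclidean algorithm with `n` as fuel: the remainder has smaller degree than `g`, so the
  -- bound drops by at least one in each call.
  common-divisor : ∀ n f g → DegreeBelow n g →
    ∃[ d ] ∃[ s ] ∃[ t ] s *ₚ f +ₚ t *ₚ g ≋ d × d ∣ᵖ f × d ∣ᵖ g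
  common-divisor n f g bg with zero-or-leading g
  ... | inj₁ g≋[] = f , constant 1# , []
    , ≋-trans (+ₚ-identityʳ (constant 1# *ₚ f)) (*ₚ-identityˡ f) , ∣ʳ-refl , ∣-respʳ (≋-sym g≋[]) (f ∣0)
  common-divisor zero f g bg | inj₂ (e , nz , _) = contradiction (bg e z≤n) nz
  common-divisor (suc n) f g bg | inj₂ (e , lg) with normalise g lg
  ... | m , mm , m∣g , (u , ug≋m) with reduce m mm f
  ...   | q , r , br , f+qm≋r with common-divisor n m r
                (λ i n≤i → br i (ℕ.≤-trans (ℕ.s≤s⁻¹ (leading-≤ g (proj₁ lg) bg)) n≤i))
  ...     | d , s , t , eq , d∣m , d∣r = d , t , s *ₚ u +ₚ t *ₚ q *ₚ u , combination
            , ∣-+⇒∣ʳ {d} {q *ₚ m} {f}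
                (∣-respʳ (≋-trans (≋-sym f+qm≋r) (+ₚ-comm f (q *ₚ m))) d∣r)
                (x∣ʳy⇒x∣ʳzy q d∣m)
            , ∣-trans d∣m m∣g
    where
    open SetoidReasoning ≋-setoid
    combination : t *ₚ f +ₚ (s *ₚ u +ₚ t *ₚ q *ₚ u) *ₚ g ≋ d
    combination = begin
      t *ₚ f +ₚ (s *ₚ u +ₚ t *ₚ q *ₚ u) *ₚ g
        ≈⟨ euclid-step s t u q f g ⟩
      s *ₚ (u *ₚ g) +ₚ t *ₚ (f +ₚ q *ₚ (u *ₚ g))
        ≈⟨ P.+-cong {s *ₚ (u *ₚ g)} (*ₚ-congˡ s ug≋m)
             (*ₚ-congˡ t (P.+-congˡ {f} (*ₚ-congˡ q ug≋m))) ⟩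
      s *ₚ m +ₚ t *ₚ (f +ₚ q *ₚ m)
        ≈⟨ P.+-congˡ {s *ₚ m} (*ₚ-congˡ t f+qm≋r) ⟩
      s *ₚ m +ₚ t *ₚ r
        ≈⟨ eq ⟩
      d ∎

  -- Irreducible polynomials

  ∣⇒∣ᵖ : ∀ {f g} → f ∣ g → f ∣ᵖ g
  ∣⇒∣ᵖ f∣g = record { quotient = _∣ʳ_.quotient f∣g ; equality = mk≋ (_∣ʳ_.equality f∣g) }

  ∣ᵖ⇒∣ : ∀ {f g} → f ∣ᵖ g → f ∣ g
  ∣ᵖ⇒∣ f∣g = record { quotient = _∣ʳ_.quotient f∣g ; equality = at (_∣ʳ_.equality f∣g) }

  irreducible-split : ∀ {p} x y → Irreducible p → x *ₚ y ≋ p → x ∣ᵖ constant 1# ⊎ y ∣ᵖ constant 1#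
  irreducible-split x y irr eq =
    Sum.map ∣⇒∣ᵖ ∣⇒∣ᵖ (RawSR.Irreducible.split-∣1 irr {x} {y} (at (≋-sym eq)))

  -- Let `c` be the Euclidean common divisor and `x c = p`. If `x` is a unit, then `p` divides `c`
  -- and hence `g`, which is excluded; so `c` is a unit and its linear combination can be scaled to
  -- 1.
  irreducible⇒bézout : ∀ {d} p g → MonicOfDegree d p → Irreducible p → ¬ p ∣ᵖ g → Bézout p g
  irreducible⇒bézout {d} p g mp irr p∤g with common-divisor (suc d) g p (proj₂ mp)
  ... | c , s , t , sg+tp≋c , c∣g , (x , xc≋p) with irreducible-split x c irr xc≋p
  ...   | inj₁ x∣1 = contradiction (∣-trans (unit-cofactor x∣1 xc≋p) c∣g) p∤g
  ...   | inj₂ c∣1 = bézout-sym (bézout-unit s t (∣-respˡ (≋-sym sg+tp≋c) c∣1))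

  -- The cofactor `h` is monic. Degree 0 makes it 1; positive degree would make `q` a product of two
  -- nonunits.
  irreducible∣irreducible⇒≋ : ∀ {d e} p q → MonicOfDegree d p → Irreducible p →
                              MonicOfDegree e q → Irreducible q → p ∣ᵖ q → p ≋ q
  irreducible∣irreducible⇒≋ p q mp irrp mq irrq (h , hp≋q)
    with quotient-monic h p q mp mq hp≋q | irreducible-split h p irrq hp≋q
  ... | zero , _ , mh | _ = ≋-trans (≋-sym (≋-trans (*ₚ-congʳ p h≋1) (*ₚ-identityˡ p))) hp≋q
    where
    h≋1 : h ≋ constant 1#
    at h≋1 zero = proj₁ mh
    at h≋1 (suc i) = proj₂ mh (suc i) (s≤s z≤n)
  ... | suc j , _ , mh | inj₁ h∣1 = contradiction h∣1 (positive-degree∤1 h mh)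
  ... | suc j , _ , mh | inj₂ p∣1 = contradiction (∣ᵖ⇒∣ p∣1) (RawSR.Irreducible.p∤1 irrp)

  distinct⇒bézout : ∀ {d e} p q → MonicOfDegree d p → Irreducible p →
                    MonicOfDegree e q → Irreducible q → ¬ p ≋ q → Bézout p q
  distinct⇒bézout p q mp irrp mq irrq p≢q = irreducible⇒bézout p q mp irrp
    (λ p∣q → p≢q (irreducible∣irreducible⇒≋ p q mp irrp mq irrq p∣q))

  irreducible⇒positive-degree : ∀ {d} p → MonicOfDegree d p → Irreducible p → 1 ≤ d
  irreducible⇒positive-degree {zero} p mp irr =
    contradiction (∣ᵖ⇒∣ (leading-0∣1 p (monic⇒leading p mp))) (RawSR.Irreducible.p∤1 irr)
  irreducible⇒positive-degree {suc d} p mp irr = s≤s z≤n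

  -- Lists of monic polynomials and a decision procedure for irreducibility

  elements : List Carrier
  elements = tabulate I.from

  from-injective : ∀ {i j} → I.from i ≈ I.from j → i ≡ j
  from-injective {i} {j} eq = ≡.trans (≡.sym (I.strictlyInverseˡ i))
    (≡.trans (I.to-cong eq) (I.strictlyInverseˡ j))

  monics : ℕ → List Poly
  monics zero = [ constant 1# ]
  monics (suc n) = cartesianProductWith _∷_ elements (monics n)

  length-monics : ∀ n → length (monics n) ≡ order ℕ.^ n
  length-monics zero = refl
  length-monics (suc n) = ≡.trans (length-cartesianProductWith _∷_ elements (monics n))
    (≡.cong₂ ℕ._*_ (List.length-tabulate I.from) (length-monics n))

  open UniqueSetoid ≋-setoid public using (Unique)
  open Membership ≋-setoid public using (_∈_)

  monics-unique : ∀ n → Unique (monics n)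
  monics-unique zero = [] ∷ []
  monics-unique (suc n) = Uniq.cartesianProductWith⁺ R.setoid ≋-setoid ≋-setoid _∷_
    (λ eq → at eq 0 , tail eq)
    (Uniq.tabulate⁺ R.setoid from-injective) (monics-unique n)

  monics-complete : ∀ n f → MonicOfDegree n f → f ∈ monics n
  monics-complete n [] (lead , _) = contradiction (R.sym lead) 1≉0
  monics-complete zero (a ∷ f) (lead , b) = here (∷-cong lead (below-0 f (below-tail {0} {a} {f} b)))
  monics-complete (suc n) (a ∷ f) (lead , b) =
    Mem.∈-cartesianProductWith⁺ R.setoid ≋-setoid ≋-setoid ∷-cong
      (Mem.∈-resp-≈ R.setoid (I.strictlyInverseʳ a) (Mem.∈-tabulate⁺ R.setoid (I.to a)))
      (monics-complete n f (lead , below-tail {suc n} {a} {f} b))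

  monics-sound : ∀ n {f} → f ∈ monics n → MonicOfDegree n f
  monics-sound zero (here f≋1) = monic-resp {0} (≋-sym f≋1) monic-1
  monics-sound (suc n) {f} f∈ with Mem.∈-cartesianProductWith⁻ R.setoid ≋-setoid ≋-setoid _∷_ elements (monics n) f∈
  ... | a , g , _ , g∈ , f≋ with monics-sound n g∈
  ...   | lead , b = monic-resp {suc n} (≋-sym f≋) (lead , λ { (suc i) (s≤s le) → b i le })

  -- A search over finitely many monic polynomials, hence decidable; for monic `p` of positive
  -- degree `d` its failure is equivalent to irreducibility.
  ProperDivisor : ℕ → Poly → Set _
  ProperDivisor d p = ∃[ e ] e < d × 1 ≤ e × Any (_∣ᵖ p) (monics e)

  properDivisor? : ∀ d p → Dec (ProperDivisor d p)
  properDivisor? d p = ℕ.anyUpTo? (λ e → (1 ℕ.≤? e) ×-dec Any.any? (_∣ᵖ? p) (monics e)) d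

  properDivisor⇒reducible : ∀ {d} p → MonicOfDegree d p → ProperDivisor d p → ¬ Irreducible p
  properDivisor⇒reducible {d} p mp (suc e , e<d , _ , any) irr with Membership.find ≋-setoid any
  ... | m , m∈ , (h , hm≋p) with monics-sound (suc e) m∈
  ...   | mm with quotient-monic h m p mm mp hm≋p | irreducible-split h m irr hm≋p
  ...     | _ | inj₂ m∣1 = positive-degree∤1 m mm m∣1
  ...     | suc j , _ , mh | inj₁ h∣1 = positive-degree∤1 h mh h∣1
  ...     | zero , d≡ , _ | inj₁ _ = ℕ.<-irrefl (≡.sym d≡) e<d

  noProperDivisor⇒irreducible : ∀ {d} p → MonicOfDegree (suc d) p → ¬ ProperDivisor (suc d) p → Irreducible p
  noProperDivisor⇒irreducible {d} p mp none = record
    { p∤1 = λ p∣1 → positive-degree∤1 p mp (∣⇒∣ᵖ p∣1)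
    ; split-∣1 = λ {x} {y} p≈xy → Sum.map ∣ᵖ⇒∣ ∣ᵖ⇒∣ (split x y (mk≋ p≈xy) (zero-or-leading x) (zero-or-leading y))
    }
    where
    split : ∀ x y → p ≋ x *ₚ y → x ≋ [] ⊎ ∃[ i ] Leading i x → y ≋ [] ⊎ ∃[ j ] Leading j y →
            x ∣ᵖ constant 1# ⊎ y ∣ᵖ constant 1#
    split x y eq (inj₁ x≋[]) _ =
      contradiction (≋-trans eq (*ₚ-congʳ y x≋[])) (leading≢[] p (monic⇒leading p mp))
    split x y eq _ (inj₁ y≋[]) =
      contradiction (≋-trans eq (≋-trans (*ₚ-congˡ x y≋[]) (*ₚ-zeroʳ x))) (leading≢[] p (monic⇒leading p mp))
    split x y eq (inj₂ (zero , lx)) _ = inj₁ (leading-0∣1 x lx)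
    split x y eq _ (inj₂ (zero , ly)) = inj₂ (leading-0∣1 y ly)
    -- Both factors have positive degree, so the monic associate of `y` is a divisor whose degree
    -- lies strictly between 0 and `suc d`.
    split x y eq (inj₂ (suc i , lx)) (inj₂ (suc j , ly)) with normalise y ly
    ... | m , mm , m∣y , _ = contradiction
      (suc j , ≡.subst (suc j <_) (≡.sym d≡) (s≤s (ℕ.m≤n+m (suc j) i)) , s≤s z≤n
        , Any.map (λ m≋ → ∣-respˡ m≋ (∣-respʳ (≋-sym eq) (x∣ʳy⇒x∣ʳzy x m∣y))) (monics-complete (suc j) m mm))
      none
      where
      d≡ : suc d ≡ suc i ℕ.+ suc j
      d≡ = leading-unique p (monic⇒leading p mp) (leading-resp {_} {x *ₚ y} (≋-sym eq) (leading-* x y lx ly))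

  irreducible? : ∀ d p → MonicOfDegree d p → Dec (Irreducible p)
  irreducible? zero p mp = no (λ irr → ℕ.n≮n 0 (irreducible⇒positive-degree p mp irr))
  irreducible? (suc d) p mp with properDivisor? (suc d) p
  ... | yes div = no (properDivisor⇒reducible p mp div)
  ... | no none = yes (noProperDivisor⇒irreducible p mp none)

-- Enumeration of the monic irreducibles by degree

module IrreducibleLists {c ℓ₁ ℓ₂} (F : FiniteField c ℓ₁ ℓ₂)
  (1≉0 : ¬ FiniteField._≈_ F (FiniteField.1# F) (FiniteField.0# F)) where

  open FiniteFieldPolynomials F 1≉0

  open Membership monicIrreducibles public using () renaming (_∈_ to _∈ᴵ_)
  open UniqueSetoid monicIrreducibles public using () renaming (Unique to Uniqueᴵ)
  private module 𝕀 = Setoid monicIrreducibles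

  irreducible-resp : ∀ {p q} → p ≋ q → Irreducible p → Irreducible q
  irreducible-resp p≋q irr = record
    { p∤1 = λ q∣1 → RawSR.Irreducible.p∤1 irr (∣ᵖ⇒∣ (∣-respˡ (≋-sym p≋q) (∣⇒∣ᵖ q∣1)))
    ; split-∣1 = λ {x} {y} q≈xy → RawSR.Irreducible.split-∣1 irr {x} {y} (at (≋-trans p≋q (mk≋ {g = x *ₚ y} q≈xy)))
    }

  deg-cong : ∀ P Q → P 𝕀.≈ Q → deg P ≡ deg Q
  deg-cong P Q P≈Q = monic-degree-unique (poly Q)
    (monic-resp {deg P} (mk≋ {poly P} {poly Q} P≈Q) (proj₁ (proj₂ (proj₂ P)))) (proj₁ (proj₂ (proj₂ Q)))

  -- More than a `filter`: each entry must carry its degree and the proofs, and the decision of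
  -- irreducibility uses monicity.
  selectIrreducible : ∀ d fs → (∀ {f} → f ∈ fs → MonicOfDegree d f) → List MonicIrreducible
  selectIrreducible d [] monic = []
  selectIrreducible d (f ∷ fs) monic with irreducible? d f (monic (here ≋-refl))
  ... | yes irr = (f , d , monic (here ≋-refl) , irr) ∷ selectIrreducible d fs (monic ∘ there)
  ... | no _ = selectIrreducible d fs (monic ∘ there)

  select-sound : ∀ d fs (monic : ∀ {f} → f ∈ fs → MonicOfDegree d f) →
                 All (λ P → deg P ≡ d × poly P ∈ fs) (selectIrreducible d fs monic)
  select-sound d [] monic = []
  select-sound d (f ∷ fs) monic with irreducible? d f (monic (here ≋-refl))
  ... | yes irr = (refl , here ≋-refl) ∷ All.map (Product.map id there) (select-sound d fs (monic ∘ there))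
  ... | no _ = All.map (Product.map id there) (select-sound d fs (monic ∘ there))

  select-length : ∀ d fs (monic : ∀ {f} → f ∈ fs → MonicOfDegree d f) →
                  length (selectIrreducible d fs monic) ≤ length fs
  select-length d [] monic = z≤n
  select-length d (f ∷ fs) monic with irreducible? d f (monic (here ≋-refl))
  ... | yes irr = s≤s (select-length d fs (monic ∘ there))
  ... | no _ = ℕ.m≤n⇒m≤1+n (select-length d fs (monic ∘ there))

  select-unique : ∀ d fs (monic : ∀ {f} → f ∈ fs → MonicOfDegree d f) →
                  Unique fs → Uniqueᴵ (selectIrreducible d fs monic)
  select-unique d [] monic _ = []
  select-unique d (f ∷ fs) monic (f∉fs ∷ fs!) with irreducible? d f (monic (here ≋-refl))
  ... | no _ = select-unique d fs (monic ∘ there) fs!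
  ... | yes irr =
    All.map (λ {P} (_ , P∈fs) f≈P → ≉-of-unique ≋-setoid f∉fs P∈fs (≋-sym (mk≋ {f} {poly P} f≈P)))
            (select-sound d fs (monic ∘ there))
    ∷ select-unique d fs (monic ∘ there) fs!

  select-complete : ∀ d fs (monic : ∀ {f} → f ∈ fs → MonicOfDegree d f) P →
                    poly P ∈ fs → P ∈ᴵ selectIrreducible d fs monic
  select-complete d (f ∷ fs) monic P P∈ with irreducible? d f (monic (here ≋-refl)) | P∈
  ... | yes irr | here P≋f = here (at P≋f)
  ... | yes irr | there P∈′ = there (select-complete d fs (monic ∘ there) P P∈′)
  ... | no ¬irr | here P≋f = contradiction (irreducible-resp P≋f (proj₂ (proj₂ (proj₂ P)))) ¬irr
  ... | no ¬irr | there P∈′ = select-complete d fs (monic ∘ there) P P∈′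

  irreducibles : ℕ → List MonicIrreducible
  irreducibles d = selectIrreducible d (monics d) (monics-sound d)

  irreducibles-deg : ∀ d → All (λ P → deg P ≡ d) (irreducibles d)
  irreducibles-deg d = All.map proj₁ (select-sound d (monics d) (monics-sound d))

  length-irreducibles : ∀ d → length (irreducibles d) ≤ order ℕ.^ d
  length-irreducibles d = ≡.subst (length (irreducibles d) ≤_) (length-monics d)
    (select-length d (monics d) (monics-sound d))

  irreduciblesUpTo : ℕ → List MonicIrreducible
  irreduciblesUpTo zero = []
  irreduciblesUpTo (suc y) = irreducibles (suc y) ++ irreduciblesUpTo y

  upTo-deg : ∀ y → All (λ P → deg P ≤ y) (irreduciblesUpTo y)
  upTo-deg zero = []
  upTo-deg (suc y) = Allₚ.++⁺ (All.map ℕ.≤-reflexive (irreducibles-deg (suc y)))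
                              (All.map ℕ.m≤n⇒m≤1+n (upTo-deg y))

  upTo-unique : ∀ y → Uniqueᴵ (irreduciblesUpTo y)
  upTo-unique zero = []
  upTo-unique (suc y) = Uniq.++⁺ monicIrreducibles
    (select-unique (suc y) (monics (suc y)) (monics-sound (suc y)) (monics-unique (suc y)))
    (upTo-unique y)
    (λ {P} (P∈ , P∈′) → ℕ.1+n≰n (≡.subst (_≤ y) (deg-∈ {R = _≡ suc y} P P∈ (irreducibles-deg (suc y))) (deg-∈ {R = _≤ y} P P∈′ (upTo-deg y))))
    where
    deg-∈ : ∀ {p} {R : ℕ → Set p} P {Ps} → P ∈ᴵ Ps → All (R ∘ deg) Ps → R (deg P)
    deg-∈ {R = R} P (here {x = Q} P≈Q) (r ∷ _) = ≡.subst R (≡.sym (deg-cong P Q P≈Q)) r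
    deg-∈ {R = R} P (there P∈) (_ ∷ rs) = deg-∈ {R = R} P P∈ rs

  deg-positive : ∀ P → 1 ≤ deg P
  deg-positive (p , d , mp , irr) = irreducible⇒positive-degree p mp irr

  upTo-complete : ∀ y P → deg P ≤ y → P ∈ᴵ irreduciblesUpTo y
  upTo-complete zero P d≤0 = contradiction (ℕ.≤-trans (deg-positive P) d≤0) ℕ.1+n≰n
  upTo-complete (suc y) P@(p , d , mp , irr) d≤ with ℕ.m≤n⇒m<n∨m≡n d≤
  ... | inj₁ (s≤s d≤y) = Mem.∈-++⁺ʳ monicIrreducibles {v = P} (irreducibles (suc y)) (upTo-complete y P d≤y)
  ... | inj₂ refl = Mem.∈-++⁺ˡ monicIrreducibles {v = P}
    (select-complete d (monics d) (monics-sound d) P (monics-complete d p mp))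

-- Counting in residue classes

module ResidueCounting {c ℓ₁ ℓ₂} (F : FiniteField c ℓ₁ ℓ₂)
  (1≉0 : ¬ FiniteField._≈_ F (FiniteField.1# F) (FiniteField.0# F)) where

  open FiniteFieldPolynomials F 1≉0
  private module P = CommutativeRing polyRing

  record Modulus : Set (c ⊔ ℓ₁) where
    field
      modulus : Poly
      degree  : ℕ
      monic   : MonicOfDegree degree modulus
  open Modulus public

  -- u₁ and u₂ stand for the residue classes of -u₁ and -u₂.
  record Residues (m : Modulus) : Set (c ⊔ ℓ₁) where
    field
      u₁ u₂    : Poly
      disjoint : ∀ f → modulus m ∣ᵖ f +ₚ u₁ → ¬ modulus m ∣ᵖ f +ₚ u₂
  open Residues

  Avoids : ∀ {ms} → All Residues ms → Poly → Set (c ⊔ ℓ₁)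
  Avoids [] f = ⊤
  Avoids {m ∷ _} (ρ ∷ ρs) f =
    (¬ modulus m ∣ᵖ f +ₚ u₁ ρ × ¬ modulus m ∣ᵖ f +ₚ u₂ ρ) × Avoids ρs f

  avoids? : ∀ {ms} (ρs : All Residues ms) f → Dec (Avoids ρs f)
  avoids? [] f = yes tt
  avoids? {m ∷ _} (ρ ∷ ρs) f =
    (¬? (modulus m ∣ᵖ? f +ₚ u₁ ρ) ×-dec ¬? (modulus m ∣ᵖ? f +ₚ u₂ ρ)) ×-dec avoids? ρs f

  ∣-+-resp : ∀ {m f g} u → f ≋ g → m ∣ᵖ f +ₚ u → m ∣ᵖ g +ₚ u
  ∣-+-resp u f≋g = ∣-respʳ (P.+-congʳ {u} f≋g)

  avoids-resp : ∀ {ms} (ρs : All Residues ms) {f g} → f ≋ g → Avoids ρs f → Avoids ρs g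
  avoids-resp [] f≋g _ = tt
  avoids-resp (ρ ∷ ρs) f≋g ((¬1 , ¬2) , av) =
    (¬1 ∘ ∣-+-resp (u₁ ρ) (≋-sym f≋g) , ¬2 ∘ ∣-+-resp (u₂ ρ) (≋-sym f≋g)) , avoids-resp ρs f≋g av

  Congruent : Modulus → Poly → ∀ {ms} → All Residues ms → Poly → Set (c ⊔ ℓ₁)
  Congruent m u ρs f = modulus m ∣ᵖ f +ₚ u × Avoids ρs f

  congruent? : ∀ m u {ms} (ρs : All Residues ms) f → Dec (Congruent m u ρs f)
  congruent? m u ρs f = (modulus m ∣ᵖ? f +ₚ u) ×-dec avoids? ρs f

  -- The two classes modulo `m` are disjoint, so polynomials avoiding `ρs` fall into exactly three
  -- kinds. A sum keeps subtraction out of the natural numbers.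
  avoids-split : ∀ {m ms} (ρ : Residues m) (ρs : All Residues ms) fs →
    count (avoids? ρs) fs ≡
    count (avoids? (ρ ∷ ρs)) fs ℕ.+ (count (congruent? m (u₁ ρ) ρs) fs ℕ.+ count (congruent? m (u₂ ρ) ρs) fs)
  avoids-split {m} ρ ρs fs = ≡.trans
    (count-split (avoids? ρs) (avoids? (ρ ∷ ρs)) either? cover proj₂ Sum.[ proj₂ , proj₂ ]′ disj fs)
    (≡.cong (count (avoids? (ρ ∷ ρs)) fs ℕ.+_)
      (count-split either? (congruent? m (u₁ ρ) ρs) (congruent? m (u₂ ρ) ρs) id inj₁ inj₂
        (λ {f} (m∣1 , _) (m∣2 , _) → disjoint ρ f m∣1 m∣2) fs))
    where
    Either : Poly → Set _
    Either f = Congruent m (u₁ ρ) ρs f ⊎ Congruent m (u₂ ρ) ρs f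
    either? : ∀ f → Dec (Either f)
    either? f = congruent? m (u₁ ρ) ρs f ⊎-dec congruent? m (u₂ ρ) ρs f
    cover : ∀ {f} → Avoids ρs f → Avoids (ρ ∷ ρs) f ⊎ Either f
    cover {f} av with modulus m ∣ᵖ? f +ₚ u₁ ρ | modulus m ∣ᵖ? f +ₚ u₂ ρ
    ... | yes m∣1 | _       = inj₂ (inj₁ (m∣1 , av))
    ... | no _    | yes m∣2 = inj₂ (inj₂ (m∣2 , av))
    ... | no ¬1   | no ¬2   = inj₁ ((¬1 , ¬2) , av)
    disj : ∀ {f} → Avoids (ρ ∷ ρs) f → ¬ Either f
    disj ((¬1 , _) , _) (inj₁ (m∣1 , _)) = ¬1 m∣1
    disj ((_ , ¬2) , _) (inj₂ (m∣2 , _)) = ¬2 m∣2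

  Coprime : Modulus → Modulus → Set (c ⊔ ℓ₁)
  Coprime m n = Bézout (modulus m) (modulus n)

  -- The class of -u modulo m in degree r + e consists of the h m + w with h of degree r.
  module _ (m : Modulus) (u : Poly) where
    private
      M = modulus m
      e = degree m
      w⁻ : ∃[ q ] ∃[ w ] DegreeBelow e w × u +ₚ q *ₚ M ≋ w
      w⁻ = reduce M (monic m) u
      q = proj₁ w⁻
      -- `u + q M` is the remainder of `u`, so its negative represents the class of `-u` in degree
      -- below `e`.
      w = -ₚ proj₁ (proj₂ w⁻)
      w-below : DegreeBelow e w
      w-below = below-neg (proj₁ (proj₂ w⁻)) (proj₁ (proj₂ (proj₂ w⁻)))
      open SetoidReasoning ≋-setoid

      M∣w+u : M ∣ᵖ w +ₚ u
      M∣w+u = ∣-+⇒∣ʳ {M} {q *ₚ M} {w +ₚ u} (∣-respʳ (≋-sym eq) (M ∣0)) (q , ≋-refl)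
        where
        eq : q *ₚ M +ₚ (w +ₚ u) ≋ []
        eq = begin
          q *ₚ M +ₚ (w +ₚ u)   ≈⟨ P.+-comm (q *ₚ M) (w +ₚ u) ⟩
          (w +ₚ u) +ₚ q *ₚ M   ≈⟨ P.+-assoc w u (q *ₚ M) ⟩
          w +ₚ (u +ₚ q *ₚ M)   ≈⟨ P.+-congˡ {w} (proj₂ (proj₂ (proj₂ w⁻))) ⟩
          w +ₚ proj₁ (proj₂ w⁻) ≈⟨ P.-‿inverseˡ (proj₁ (proj₂ w⁻)) ⟩
          []                   ∎

      φ : Poly → Poly
      φ h = h *ₚ M +ₚ w

      -- With `s` inverse to `M` modulo `n`, the condition `n ∣ φ h + v` becomes
      -- `n ∣ h + s (w + v)`. An `h` in both new classes would put `φ h` in both old ones, so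
      -- disjointness survives.
      transport : ∀ {n} → Coprime m n × Residues n → Residues n
      transport {n} (b@(s , _) , ρ) = record
        { u₁ = s *ₚ (w +ₚ u₁ ρ)
        ; u₂ = s *ₚ (w +ₚ u₂ ρ)
        ; disjoint = λ h n∣1 n∣2 → disjoint ρ (φ h) (scale b h (u₁ ρ) n∣1) (scale b h (u₂ ρ) n∣2)
        }
        where
        scale : (b : Coprime m n) (let (s , _) = b) → ∀ h v →
                modulus n ∣ᵖ h +ₚ s *ₚ (w +ₚ v) → modulus n ∣ᵖ φ h +ₚ v
        scale b h v n∣ = ∣-respʳ (≋-sym (P.+-assoc (h *ₚ M) w v)) (∣-scale b h (w +ₚ v) n∣)

    residuesOfQuotient : ∀ {ms} → All (Coprime m) ms → All Residues ms → All Residues ms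
    residuesOfQuotient bs ρs = All.zipWith transport (bs , ρs)

    private
      avoids-φ⁺ : ∀ {ms} (bs : All (Coprime m) ms) (ρs : All Residues ms) h →
                 Avoids (residuesOfQuotient bs ρs) h → Avoids ρs (φ h)
      avoids-φ⁺ [] [] h _ = tt
      avoids-φ⁺ (b ∷ bs) (ρ ∷ ρs) h ((¬1 , ¬2) , av) =
        (¬1 ∘ unscale (u₁ ρ) , ¬2 ∘ unscale (u₂ ρ)) , avoids-φ⁺ bs ρs h av
        where
        unscale : ∀ v → _ ∣ᵖ φ h +ₚ v → _ ∣ᵖ h +ₚ proj₁ b *ₚ (w +ₚ v)
        unscale v n∣ = ∣-unscale b h (w +ₚ v) (∣-respʳ (P.+-assoc (h *ₚ M) w v) n∣)

      avoids-φ⁻ : ∀ {ms} (bs : All (Coprime m) ms) (ρs : All Residues ms) h →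
                 Avoids ρs (φ h) → Avoids (residuesOfQuotient bs ρs) h
      avoids-φ⁻ [] [] h _ = tt
      avoids-φ⁻ (b ∷ bs) (ρ ∷ ρs) h ((¬1 , ¬2) , av) =
        (¬1 ∘ scale (u₁ ρ) , ¬2 ∘ scale (u₂ ρ)) , avoids-φ⁻ bs ρs h av
        where
        scale : ∀ v → _ ∣ᵖ h +ₚ proj₁ b *ₚ (w +ₚ v) → _ ∣ᵖ φ h +ₚ v
        scale v n∣ = ∣-respʳ (≋-sym (P.+-assoc (h *ₚ M) w v)) (∣-scale b h (w +ₚ v) n∣)

      M∣φ+u : ∀ h → M ∣ᵖ φ h +ₚ u
      M∣φ+u h = ∣-respʳ (≋-sym (P.+-assoc (h *ₚ M) w u)) (∣-+ {M} {h *ₚ M} (h , ≋-refl) M∣w+u)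

      φ-cong : ∀ {h h′} → h ≋ h′ → φ h ≋ φ h′
      φ-cong h≋ = P.+-congʳ {w} (*ₚ-congʳ M h≋)

      φ-injective : ∀ {h h′} → φ h ≋ φ h′ → h ≋ h′
      φ-injective {h} {h′} eq = *-monic-cancel h h′ M (monic m)
        (GroupProperties.∙-cancelʳ P.+-group w (h *ₚ M) (h′ *ₚ M) eq)

      φ-monic : ∀ r h → MonicOfDegree r h → MonicOfDegree (r ℕ.+ e) (φ h)
      φ-monic r h mh = monic-+ (h *ₚ M) w (monic-* h M mh (monic m))
        (λ i r+e≤i → w-below i (ℕ.≤-trans (ℕ.m≤n+m e r) r+e≤i))

      -- `M` divides `f + u` and `w + u`, hence `f - w`. As `w` has degree below `e`, this
      -- difference is still monic of degree `r + e`, and `h` is its quotient.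
      φ-onto : ∀ r f → MonicOfDegree (r ℕ.+ e) f → M ∣ᵖ f +ₚ u →
               ∃[ h ] MonicOfDegree r h × f ≋ φ h
      φ-onto r f mf M∣f+u = preimage (∣-+⇒∣ʳ {M} {w +ₚ u} {f +ₚ -ₚ w} (∣-respʳ (≋-sym shuffle) M∣f+u) M∣w+u)
        where
        f≋ : (f +ₚ -ₚ w) +ₚ w ≋ f
        f≋ = begin
          (f +ₚ -ₚ w) +ₚ w  ≈⟨ P.+-assoc f (-ₚ w) w ⟩
          f +ₚ (-ₚ w +ₚ w)  ≈⟨ P.+-congˡ {f} (P.-‿inverseˡ w) ⟩
          f +ₚ []           ≈⟨ P.+-identityʳ f ⟩
          f                 ∎
        shuffle : (w +ₚ u) +ₚ (f +ₚ -ₚ w) ≋ f +ₚ u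
        shuffle = begin
          (w +ₚ u) +ₚ (f +ₚ -ₚ w)  ≈⟨ P.+-comm (w +ₚ u) (f +ₚ -ₚ w) ⟩
          (f +ₚ -ₚ w) +ₚ (w +ₚ u)  ≈⟨ P.+-assoc (f +ₚ -ₚ w) w u ⟨
          ((f +ₚ -ₚ w) +ₚ w) +ₚ u  ≈⟨ P.+-congʳ {u} f≋ ⟩
          f +ₚ u                   ∎
        preimage : M ∣ᵖ f +ₚ -ₚ w → ∃[ h ] MonicOfDegree r h × f ≋ φ h
        preimage (h , hM≋) with quotient-monic h M (f +ₚ -ₚ w) (monic m)
          (monic-+ f (-ₚ w) mf (below-neg w λ i r+e≤i → w-below i (ℕ.≤-trans (ℕ.m≤n+m e r) r+e≤i))) hM≋
        ... | d , r+e≡d+e , mh = h , ≡.subst (λ z → MonicOfDegree z h) (≡.sym (ℕ.+-cancelʳ-≡ e r d r+e≡d+e)) mh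
                               , ≋-trans (≋-sym f≋) (P.+-congʳ {w} (≋-sym hM≋))

    -- One step of Chinese remaindering: the bijection `φ` removes `m` and lowers the degree by `e`,
    -- at the price of moving the other classes.
    count-congruent : ∀ {ms} (bs : All (Coprime m) ms) (ρs : All Residues ms) r →
      count (congruent? m u ρs) (monics (r ℕ.+ e)) ≡ count (avoids? (residuesOfQuotient bs ρs)) (monics r)
    count-congruent bs ρs r = ≡.sym (count-bijection ≋-setoid ≋-setoid
      (avoids? (residuesOfQuotient bs ρs)) (congruent? m u ρs)
      (avoids-resp (residuesOfQuotient bs ρs))
      (λ f≋g (m∣ , av) → ∣-+-resp u f≋g m∣ , avoids-resp ρs f≋g av)
      (monics-unique r) (monics-unique (r ℕ.+ e)) φ φ-cong φ-injective
      (λ {h} h∈ av → monics-complete (r ℕ.+ e) (φ h) (φ-monic r h (monics-sound r h∈)) , M∣φ+u h , avoids-φ⁺ bs ρs h av)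
      (λ {f} f∈ (m∣ , av) → let h , mh , f≋φh = φ-onto r f (monics-sound (r ℕ.+ e) f∈) m∣ in
        h , monics-complete r h mh , f≋φh , avoids-φ⁻ bs ρs h (avoids-resp ρs f≋φh av)))

  count-avoids-[] : ∀ n → count (avoids? []) (monics n) ≡ order ℕ.^ n
  count-avoids-[] n = ≡.trans (≡.cong length (List.filter-all (avoids? []) (All.universal (λ _ → tt) (monics n))))
    (length-monics n)

  -- If the degree `e` of `m` is at most `n`, the other conditions are dropped and the class has
  -- exactly `q^(n - e)` members. If `e > n`, the class must be empty: `f + u` is monic of degree
  -- `n`, and a nonzero polynomial of degree below `e` is no multiple of `m`.
  count-congruent-≤ : ∀ m u {ms} (ρs : All Residues ms) n → DegreeBelow n u →
                      count (congruent? m u ρs) (monics n) ℕ.* order ℕ.^ degree m ≤ order ℕ.^ n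
  count-congruent-≤ m u ρs n bu with degree m ℕ.≤? n
  ... | yes e≤n = begin
    count (congruent? m u ρs) (monics n) ℕ.* q^e
      ≤⟨ ℕ.*-monoˡ-≤ q^e (count-mono (congruent? m u ρs) (congruent? m u []) (λ (m∣ , _) → m∣ , tt) (monics n)) ⟩
    count (congruent? m u []) (monics n) ℕ.* q^e
      ≡⟨ ≡.cong (λ z → count (congruent? m u []) (monics z) ℕ.* q^e) (ℕ.m∸n+n≡m e≤n) ⟨
    count (congruent? m u []) (monics (n ℕ.∸ e ℕ.+ e)) ℕ.* q^e
      ≡⟨ ≡.cong (ℕ._* q^e) (≡.trans (count-congruent m u [] [] (n ℕ.∸ e)) (count-avoids-[] (n ℕ.∸ e))) ⟩
    order ℕ.^ (n ℕ.∸ e) ℕ.* q^e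
      ≡⟨ ℕ.^-distribˡ-+-* order (n ℕ.∸ e) e ⟨
    order ℕ.^ (n ℕ.∸ e ℕ.+ e)
      ≡⟨ ≡.cong (order ℕ.^_) (ℕ.m∸n+n≡m e≤n) ⟩
    order ℕ.^ n ∎
    where
    open ℕ.≤-Reasoning
    e = degree m
    q^e = order ℕ.^ e
  ... | no e≰n = ≡.subst (λ z → z ℕ.* order ℕ.^ degree m ≤ order ℕ.^ n) (≡.sym none) z≤n
    where
    none : count (congruent? m u ρs) (monics n) ≡ 0
    none = ≡.cong length (List.filter-none (congruent? m u ρs) (All.tabulateₛ ≋-setoid
      (λ {f} f∈ (m∣f+u , _) → let mf+u = monic-+ f u (monics-sound n f∈) bu in
        leading≢[] (f +ₚ u) (monic⇒leading (f +ₚ u) mf+u)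
          (monic∣below⇒[] (modulus m) (f +ₚ u) (monic m)
            (λ i e≤i → proj₂ mf+u i (ℕ.<-≤-trans (ℕ.≰⇒> e≰n) e≤i)) m∣f+u))))

-- Densities

open ≡ using (sym; trans; cong₂; subst; subst₂)
open import Data.Rational.Base
  using (mkℚ; toℚᵘ; _+_; _*_; -_; _-_; 1/_; _/_; positive; nonNegative)
  renaming (_≤_ to _≤ℚ_; _<_ to _<ℚ_)
open import Data.Rational.Properties hiding (heytingCommutativeRing; heytingField)
open ℚSolver.+-*-Solver using (solve; con; _:+_; _:*_; _:-_; :-_; _:=_)

private
  frac≃ : ∀ a m → toℚᵘ (ℤ.+ a / suc m) ℚᵘ.≃ ℚᵘ.mkℚᵘ (ℤ.+ a) m
  frac≃ a m = toℚᵘ-fromℚᵘ (ℚᵘ.mkℚᵘ (ℤ.+ a) m)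

frac-≤ : ∀ a b m n .{{_ : ℕ.NonZero m}} .{{_ : ℕ.NonZero n}} →
         a ℕ.* n ≤ b ℕ.* m → ℤ.+ a / m ≤ℚ ℤ.+ b / n
frac-≤ a b (suc m) (suc n) h = toℚᵘ-cancel-≤
  (ℚᵘ.≤-respˡ-≃ (ℚᵘ.≃-sym (frac≃ a m)) (ℚᵘ.≤-respʳ-≃ (ℚᵘ.≃-sym (frac≃ b n))
    (ℚᵘ.*≤* (subst₂ ℤ._≤_ (ℤ.pos-* a (suc n)) (ℤ.pos-* b (suc m)) (ℤ.+≤+ h)))))

frac-< : ∀ a b m n .{{_ : ℕ.NonZero m}} .{{_ : ℕ.NonZero n}} →
         a ℕ.* n < b ℕ.* m → ℤ.+ a / m <ℚ ℤ.+ b / n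
frac-< a b (suc m) (suc n) h = toℚᵘ-cancel-<
  (ℚᵘ.<-respˡ-≃ (ℚᵘ.≃-sym (frac≃ a m)) (ℚᵘ.<-respʳ-≃ (ℚᵘ.≃-sym (frac≃ b n))
    (ℚᵘ.*<* (subst₂ ℤ._<_ (ℤ.pos-* a (suc n)) (ℤ.pos-* b (suc m)) (ℤ.+<+ h)))))

frac-<⁻¹ : ∀ a b m n .{{_ : ℕ.NonZero m}} .{{_ : ℕ.NonZero n}} →
           ℤ.+ a / m <ℚ ℤ.+ b / n → a ℕ.* n < b ℕ.* m
frac-<⁻¹ a b m n h = ℕ.≰⇒> (λ le → <-irrefl refl (<-≤-trans h (frac-≤ b a n m le)))

frac-≡ : ∀ a b m n .{{_ : ℕ.NonZero m}} .{{_ : ℕ.NonZero n}} →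
         a ℕ.* n ≡ b ℕ.* m → ℤ.+ a / m ≡ ℤ.+ b / n
frac-≡ a b m n h = ≤-antisym (frac-≤ a b m n (ℕ.≤-reflexive h)) (frac-≤ b a n m (ℕ.≤-reflexive (sym h)))

frac-+ : ∀ a b m .{{_ : ℕ.NonZero m}} → ℤ.+ a / m + ℤ.+ b / m ≡ ℤ.+ (a ℕ.+ b) / m
frac-+ a b (suc m) = toℚᵘ-injective (begin
  toℚᵘ (ℤ.+ a / suc m + ℤ.+ b / suc m)                ≈⟨ toℚᵘ-homo-+ (ℤ.+ a / suc m) (ℤ.+ b / suc m) ⟩
  toℚᵘ (ℤ.+ a / suc m) ℚᵘ.+ toℚᵘ (ℤ.+ b / suc m)      ≈⟨ ℚᵘ.+-cong (frac≃ a m) (frac≃ b m) ⟩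
  ℚᵘ.mkℚᵘ (ℤ.+ a) m ℚᵘ.+ ℚᵘ.mkℚᵘ (ℤ.+ b) m            ≈⟨ ℚᵘ.*≡* eq ⟩
  ℚᵘ.mkℚᵘ (ℤ.+ (a ℕ.+ b)) m                           ≈⟨ frac≃ (a ℕ.+ b) m ⟨
  toℚᵘ (ℤ.+ (a ℕ.+ b) / suc m)                        ∎)
  where
  open import Relation.Binary.Reasoning.Setoid ℚᵘ.≃-setoid
  M = ℤ.+ suc m
  eq : (ℤ.+ a ℤ.* M ℤ.+ ℤ.+ b ℤ.* M) ℤ.* M ≡ ℤ.+ (a ℕ.+ b) ℤ.* (M ℤ.* M)
  eq = trans (cong (ℤ._* M) (sym (ℤ.*-distribʳ-+ M (ℤ.+ a) (ℤ.+ b)))) (ℤ.*-assoc (ℤ.+ (a ℕ.+ b)) M M)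

frac-* : ∀ a b m n .{{_ : ℕ.NonZero m}} .{{_ : ℕ.NonZero n}} →
         ℤ.+ a / m * (ℤ.+ b / n) ≡ ((ℤ.+ (a ℕ.* b)) / (m ℕ.* n)) {{ℕ.m*n≢0 m n}}
frac-* a b (suc m) (suc n) = toℚᵘ-injective (begin
  toℚᵘ (ℤ.+ a / suc m * (ℤ.+ b / suc n))              ≈⟨ toℚᵘ-homo-* (ℤ.+ a / suc m) (ℤ.+ b / suc n) ⟩
  toℚᵘ (ℤ.+ a / suc m) ℚᵘ.* toℚᵘ (ℤ.+ b / suc n)      ≈⟨ ℚᵘ.*-cong (frac≃ a m) (frac≃ b n) ⟩
  ℚᵘ.mkℚᵘ (ℤ.+ a) m ℚᵘ.* ℚᵘ.mkℚᵘ (ℤ.+ b) n            ≈⟨ ℚᵘ.*≡* (cong (ℤ._* (ℤ.+ suc m ℤ.* ℤ.+ suc n)) (sym (ℤ.pos-* a b))) ⟩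
  ℚᵘ.mkℚᵘ (ℤ.+ (a ℕ.* b)) (n ℕ.+ m ℕ.* suc n)         ≈⟨ frac≃ (a ℕ.* b) (n ℕ.+ m ℕ.* suc n) ⟨
  toℚᵘ (ℤ.+ (a ℕ.* b) / (suc m ℕ.* suc n))            ∎)
  where open import Relation.Binary.Reasoning.Setoid ℚᵘ.≃-setoid

ι : ℕ → ℚ
ι n = ℤ.+ n / 1

ι-mono : ∀ {m n} → m ≤ n → ι m ≤ℚ ι n
ι-mono {m} {n} m≤n = frac-≤ m n 1 1 (ℕ.*-monoˡ-≤ 1 m≤n)

ι-* : ∀ m n → ι (m ℕ.* n) ≡ ι m * ι n
ι-* m n = sym (frac-* m n 1 1)

ι-^ : ∀ m n → ι (m ℕ.^ n) ≡ ι m ^ℚ n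
ι-^ m zero = refl
ι-^ m (suc n) = trans (ι-* m (m ℕ.^ n)) (cong (ι m *_) (ι-^ m n))

frac≥0 : ∀ a m .{{_ : ℕ.NonZero m}} → 0ℚ ≤ℚ ℤ.+ a / m
frac≥0 a m = frac-≤ 0 a 1 m ℕ.z≤n

-- In other words `a - e` is nondecreasing: halving turns the loss `e (suc d)` of one step into at
-- most `e d - e (suc d)`. Keeping the term `e (j + y)` on the left is what lets the induction
-- close.
sandwich-telescope : (a e : ℕ → ℚ) → (∀ d → a d ≤ℚ a (suc d) + e (suc d)) →
                     (∀ d → e (suc d) + e (suc d) ≤ℚ e d) →
                     ∀ y j → a y + e (j ℕ.+ y) ≤ℚ a (j ℕ.+ y) + e y
sandwich-telescope a e step halve y zero = ≤-refl
sandwich-telescope a e step halve y (suc j) = begin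
  a y + e′                          ≡⟨ solve 3 (λ x y z → x :+ z := x :+ y :+ (z :- y)) refl (a y) e₀ e′ ⟩
  a y + e₀ + (e′ - e₀)              ≤⟨ +-monoˡ-≤ (e′ - e₀) (sandwich-telescope a e step halve y j) ⟩
  a₀ + e y + (e′ - e₀)              ≤⟨ +-monoˡ-≤ (e′ - e₀) (+-monoˡ-≤ (e y) (step (j ℕ.+ y))) ⟩
  a′ + e′ + e y + (e′ - e₀)         ≡⟨ solve 4 (λ a e z w → a :+ e :+ z :+ (e :- w) := a :+ z :+ (e :+ e :- w)) refl a′ e′ (e y) e₀ ⟩
  a′ + e y + (e′ + e′ - e₀)         ≤⟨ +-monoʳ-≤ (a′ + e y) (+-monoˡ-≤ (- e₀) (halve (j ℕ.+ y))) ⟩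
  a′ + e y + (e₀ - e₀)              ≡⟨ solve 2 (λ a w → a :+ (w :- w) := a) refl (a′ + e y) e₀ ⟩
  a′ + e y                          ∎
  where
  open ≤-Reasoning
  e′ = e (suc j ℕ.+ y)
  e₀ = e (j ℕ.+ y)
  a′ = a (suc j ℕ.+ y)
  a₀ = a (j ℕ.+ y)

module Density {c ℓ₁ ℓ₂} (F : FiniteField c ℓ₁ ℓ₂)
  (1≉0 : ¬ FiniteField._≈_ F (FiniteField.1# F) (FiniteField.0# F)) where

  open FiniteFieldPolynomials F 1≉0
  open ResidueCounting F 1≉0

  order^≢0 : ∀ n → ℕ.NonZero (order ℕ.^ n)
  order^≢0 n = ℕ.m^n≢0 order n

  /order^-+ : ∀ x y n → x /order^ n + y /order^ n ≡ (x ℕ.+ y) /order^ n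
  /order^-+ x y n = frac-+ x y (order ℕ.^ n) {{order^≢0 n}}

  /order^-mono : ∀ {x y} n → x ≤ y → x /order^ n ≤ℚ y /order^ n
  /order^-mono {x} {y} n x≤y = frac-≤ x y (order ℕ.^ n) (order ℕ.^ n) {{order^≢0 n}} {{order^≢0 n}} (ℕ.*-monoˡ-≤ (order ℕ.^ n) x≤y)

  /order^≥0 : ∀ x n → 0ℚ ≤ℚ x /order^ n
  /order^≥0 x n = frac≥0 x (order ℕ.^ n) {{order^≢0 n}}

  double-/order^ : ∀ n → 1 /order^ n + 1 /order^ n ≡ 2 /order^ n
  double-/order^ n = /order^-+ 1 1 n

  /order^-shift : ∀ x n e → x /order^ (n ℕ.+ e) ≡ x /order^ n * (1 /order^ e)
  /order^-shift x n e = trans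
    (frac-≡ x (x ℕ.* 1) (order ℕ.^ (n ℕ.+ e)) (order ℕ.^ n ℕ.* order ℕ.^ e)
      {{order^≢0 (n ℕ.+ e)}} {{ℕ.m*n≢0 (order ℕ.^ n) (order ℕ.^ e) {{order^≢0 n}} {{order^≢0 e}}}}
      (cong₂ ℕ._*_ (sym (ℕ.*-identityʳ x)) (sym (ℕ.^-distribˡ-+-* order n e))))
    (sym (frac-* x 1 (order ℕ.^ n) (order ℕ.^ e) {{order^≢0 n}} {{order^≢0 e}}))

  factor : Modulus → ℚ
  factor m = 1ℚ - 2 /order^ degree m

  degreeSum : List Modulus → ℕ
  degreeSum = foldr (λ m → degree m ℕ.+_) 0

  -- Chinese remaindering: exact as soon as the total degree of the moduli is at most the degree.
  density-avoids : ∀ {ms} → AllPairs Coprime ms → (ρs : All Residues ms) → ∀ r →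
    count (avoids? ρs) (monics (r ℕ.+ degreeSum ms)) /order^ (r ℕ.+ degreeSum ms) ≡
    foldr _*_ 1ℚ (map factor ms)
  density-avoids [] [] r = frac-≡ C 1 Q 1 {{order^≢0 (r ℕ.+ 0)}}
    (trans (ℕ.*-identityʳ C) (trans (count-avoids-[] (r ℕ.+ 0)) (sym (ℕ.*-identityˡ Q))))
    where
    C = count (avoids? []) (monics (r ℕ.+ 0))
    Q = order ℕ.^ (r ℕ.+ 0)
  density-avoids {m ∷ ms} (coprime ∷ pairwise) (ρ ∷ ρs) r = begin
    δ C                                ≡⟨ solve 2 (λ c x → c := c :+ x :- x) refl (δ C) (δ X₁ + δ X₂) ⟩
    δ C + (δ X₁ + δ X₂) - (δ X₁ + δ X₂) ≡⟨ cong (_- (δ X₁ + δ X₂)) split ⟩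
    δ N - (δ X₁ + δ X₂)                ≡⟨ cong₂ _-_ total (cong₂ _+_ (class (u₁ ρ)) (class (u₂ ρ))) ⟩
    Π - (Π * t + Π * t)                ≡⟨ solve 2 (λ p t → p :- (p :* t :+ p :* t) := (con 1ℚ :- (t :+ t)) :* p) refl Π t ⟩
    (1ℚ - (t + t)) * Π                 ≡⟨ cong (λ z → (1ℚ - z) * Π) (double-/order^ (degree m)) ⟩
    factor m * Π                       ∎
    where
    open ≡.≡-Reasoning
    open Residues
    n = r ℕ.+ (degree m ℕ.+ degreeSum ms)
    δ : ℕ → ℚ
    δ x = x /order^ n
    C = count (avoids? (ρ ∷ ρs)) (monics n)
    N = count (avoids? ρs) (monics n)
    X₁ = count (congruent? m (u₁ ρ) ρs) (monics n)
    X₂ = count (congruent? m (u₂ ρ) ρs) (monics n)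
    Π = foldr _*_ 1ℚ (map factor ms)
    t = 1 /order^ degree m
    split : δ C + (δ X₁ + δ X₂) ≡ δ N
    split = trans (cong (δ C +_) (/order^-+ X₁ X₂ n))
      (trans (/order^-+ C (X₁ ℕ.+ X₂) n) (cong δ (sym (avoids-split ρ ρs (monics n)))))
    total : δ N ≡ Π
    total = subst (λ z → count (avoids? ρs) (monics z) /order^ z ≡ Π) (ℕ.+-assoc r (degree m) (degreeSum ms))
      (density-avoids pairwise ρs (r ℕ.+ degree m))
    -- The induction hypothesis again, now for the moved classes. In `total` the degree of `m` was
    -- left over; here `count-congruent` has consumed it and leaves the factor `t`.
    class : ∀ u → δ (count (congruent? m u ρs) (monics n)) ≡ Π * t
    class u = subst (λ z → count (congruent? m u ρs) (monics z) /order^ z ≡ Π * t)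
      (trans (ℕ.+-assoc r (degreeSum ms) (degree m)) (cong (r ℕ.+_) (ℕ.+-comm (degreeSum ms) (degree m))))
      (begin
        count (congruent? m u ρs) (monics (n₁ ℕ.+ degree m)) /order^ (n₁ ℕ.+ degree m)
          ≡⟨ cong (_/order^ (n₁ ℕ.+ degree m)) (count-congruent m u coprime ρs n₁) ⟩
        count (avoids? ρs′) (monics n₁) /order^ (n₁ ℕ.+ degree m)
          ≡⟨ /order^-shift (count (avoids? ρs′) (monics n₁)) n₁ (degree m) ⟩
        count (avoids? ρs′) (monics n₁) /order^ n₁ * t
          ≡⟨ cong (_* t) (density-avoids pairwise ρs′ r) ⟩
        Π * t ∎)
      where
      n₁ = r ℕ.+ degreeSum ms
      ρs′ = residuesOfQuotient m u coprime ρs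

  density-∷-≤ : ∀ {m ms} (ρ : Residues m) (ρs : All Residues ms) n →
    count (avoids? (ρ ∷ ρs)) (monics n) /order^ n ≤ℚ count (avoids? ρs) (monics n) /order^ n
  density-∷-≤ ρ ρs n = /order^-mono n (count-mono (avoids? (ρ ∷ ρs)) (avoids? ρs) proj₂ (monics n))

  density-∷-≥ : ∀ {m ms} (ρ : Residues m) (ρs : All Residues ms) n →
    DegreeBelow n (Residues.u₁ ρ) → DegreeBelow n (Residues.u₂ ρ) →
    count (avoids? ρs) (monics n) /order^ n ≤ℚ count (avoids? (ρ ∷ ρs)) (monics n) /order^ n + 2 /order^ degree m
  density-∷-≥ {m} ρ ρs n b₁ b₂ = begin
    δ (count (avoids? ρs) (monics n))  ≡⟨ cong δ (avoids-split ρ ρs (monics n)) ⟩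
    δ (C ℕ.+ (X (u₁ ρ) ℕ.+ X (u₂ ρ)))  ≡⟨ /order^-+ C (X (u₁ ρ) ℕ.+ X (u₂ ρ)) n ⟨
    δ C + δ (X (u₁ ρ) ℕ.+ X (u₂ ρ))    ≡⟨ cong (δ C +_) (/order^-+ (X (u₁ ρ)) (X (u₂ ρ)) n) ⟨
    δ C + (δ (X (u₁ ρ)) + δ (X (u₂ ρ))) ≤⟨ +-monoʳ-≤ (δ C) (+-mono-≤ (bound (u₁ ρ) b₁) (bound (u₂ ρ) b₂)) ⟩
    δ C + (1 /order^ degree m + 1 /order^ degree m) ≡⟨ cong (δ C +_) (double-/order^ (degree m)) ⟩
    δ C + 2 /order^ degree m ∎
    where
    open ≤-Reasoning
    open Residues
    δ : ℕ → ℚ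
    δ x = x /order^ n
    C = count (avoids? (ρ ∷ ρs)) (monics n)
    X : Poly → ℕ
    X u = count (congruent? m u ρs) (monics n)
    bound : ∀ u → DegreeBelow n u → δ (X u) ≤ℚ 1 /order^ degree m
    bound u b = frac-≤ (X u) 1 (order ℕ.^ n) (order ℕ.^ degree m) {{order^≢0 n}} {{order^≢0 (degree m)}}
      (subst (X u ℕ.* order ℕ.^ degree m ≤_) (sym (ℕ.*-identityˡ _)) (count-congruent-≤ m u ρs n b))

-- Power-freeness as a system of residue conditions

module PowerFreePairs {c ℓ₁ ℓ₂} (F : FiniteField c ℓ₁ ℓ₂)
  (1≉0 : ¬ FiniteField._≈_ F (FiniteField.1# F) (FiniteField.0# F))
  (k : ℕ) (2≤k : 2 ≤ k) (a : FiniteField.Carrier F)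
  (a≉0 : ¬ FiniteField._≈_ F a (FiniteField.0# F)) where

  open FiniteFieldPolynomials F 1≉0
  open RingDivisibility polyRing using (_^_)
  open IrreducibleLists F 1≉0
  open ResidueCounting F 1≉0
  open Density F 1≉0
  private module R = CommutativeRing commutativeRing

  powerModulus : MonicIrreducible → Modulus
  powerModulus (p , d , mp , irr) = record
    { modulus = p ^ k ; degree = k ℕ.* d ; monic = monic-^ p k mp }

  constant-below : ∀ {n} → 1 ≤ n → DegreeBelow n (constant a)
  constant-below 1≤n zero n≤0 = contradiction (ℕ.≤-trans 1≤n n≤0) λ ()
  constant-below 1≤n (suc i) _ = R.refl

  deg≤k*deg : ∀ P → deg P ≤ k ℕ.* deg P
  deg≤k*deg P = ℕ.m≤n*m (deg P) k {{ℕ.>-nonZero (ℕ.<-trans (s≤s z≤n) 2≤k)}}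

  -- The classes encode `P^k ∣ f` and `P^k ∣ f + a`. Together they would make `P^k`, of positive
  -- degree, divide the nonzero constant `a`.
  residues : ∀ P → Residues (powerModulus P)
  residues P = record
    { u₁ = []
    ; u₂ = constant a
    ; disjoint = λ f m∣f m∣f+a → a≉0 (at (monic∣below⇒[] (modulus m) (constant a) (monic m)
        (constant-below (ℕ.≤-trans (deg-positive P) (deg≤k*deg P)))
        (∣-+⇒∣ʳ {modulus m} {f} m∣f+a (∣-respʳ (+ₚ-identityʳ f) m∣f))) 0)
    }
    where m = powerModulus P

  residuesFor : ∀ Ps → All Residues (map powerModulus Ps)
  residuesFor [] = []
  residuesFor (P ∷ Ps) = residues P ∷ residuesFor Ps

  pairwise-coprime : ∀ {Ps} → Uniqueᴵ Ps → AllPairs Coprime (map powerModulus Ps)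
  pairwise-coprime Ps! = AllPairsₚ.map⁺ (AllPairs.map
    (λ { {p , d , mp , irrp} {q , e , mq , irrq} p≉q →
      bézout-^ k k (distinct⇒bézout p q mp irrp mq irrq (λ p≋q → p≉q (at p≋q))) }) Ps!)

  density : List MonicIrreducible → ℕ → ℚ
  density Ps n = count (avoids? (residuesFor Ps)) (monics n) /order^ n

  partialProduct : List MonicIrreducible → ℚ
  partialProduct Ps = foldr _*_ 1ℚ (map (eulerFactor k) Ps)

  threshold : List MonicIrreducible → ℕ
  threshold Ps = degreeSum (map powerModulus Ps)

  density≡product : ∀ {Ps} → Uniqueᴵ Ps → ∀ r → density Ps (r ℕ.+ threshold Ps) ≡ partialProduct Ps
  density≡product {Ps} Ps! r = trans (density-avoids (pairwise-coprime Ps!) (residuesFor Ps) r)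
    (cong (foldr _*_ 1ℚ) (sym (List.map-∘ Ps)))

  density-++-≤ : ∀ Ls Ps n → density (Ls ++ Ps) n ≤ℚ density Ps n
  density-++-≤ [] Ps n = ≤-refl
  density-++-≤ (P ∷ Ls) Ps n = ≤-trans (density-∷-≤ (residues P) (residuesFor (Ls ++ Ps)) n) (density-++-≤ Ls Ps n)

  density-++-≥ : ∀ {d} Ls Ps n → 1 ≤ n → All (λ P → deg P ≡ d) Ls →
                 density Ps n ≤ℚ density (Ls ++ Ps) n + (length Ls ℕ.* 2) /order^ (k ℕ.* d)
  density-++-≥ {d} [] Ps n 1≤n [] = subst (_≤ℚ density Ps n + 0 /order^ (k ℕ.* d)) (+-identityʳ (density Ps n))
    (+-monoʳ-≤ (density Ps n) (/order^≥0 0 (k ℕ.* d)))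
  density-++-≥ {d} (P ∷ Ls) Ps n 1≤n (refl ∷ degs) = begin
    density Ps n
      ≤⟨ density-++-≥ Ls Ps n 1≤n degs ⟩
    density (Ls ++ Ps) n + rest
      ≤⟨ +-monoˡ-≤ rest (density-∷-≥ (residues P) (residuesFor (Ls ++ Ps)) n (λ _ _ → R.refl) (constant-below 1≤n)) ⟩
    density (P ∷ Ls ++ Ps) n + 2 /order^ (k ℕ.* d) + rest
      ≡⟨ +-assoc (density (P ∷ Ls ++ Ps) n) (2 /order^ (k ℕ.* d)) rest ⟩
    density (P ∷ Ls ++ Ps) n + (2 /order^ (k ℕ.* d) + rest)
      ≡⟨ cong (density (P ∷ Ls ++ Ps) n +_) (/order^-+ 2 (length Ls ℕ.* 2) (k ℕ.* d)) ⟩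
    density (P ∷ Ls ++ Ps) n + (suc (length Ls) ℕ.* 2) /order^ (k ℕ.* d) ∎
    where
    open ≤-Reasoning
    rest = (length Ls ℕ.* 2) /order^ (k ℕ.* d)

  -- It has two uses: it bounds the loss caused by the irreducibles of degree `y`, and, since it at
  -- least halves with each step, also the total loss in all degrees above `y`.
  error : ℕ → ℚ
  error y = 2 /order^ y

  density-step-≤ : ∀ y n → density (irreduciblesUpTo (suc y)) n ≤ℚ density (irreduciblesUpTo y) n
  density-step-≤ y n = density-++-≤ (irreducibles (suc y)) (irreduciblesUpTo y) n

  density-step-≥ : ∀ y n → 1 ≤ n →
                   density (irreduciblesUpTo y) n ≤ℚ density (irreduciblesUpTo (suc y)) n + error (suc y)
  density-step-≥ y n 1≤n = ≤-trans
    (density-++-≥ (irreducibles d) (irreduciblesUpTo y) n 1≤n (irreducibles-deg d))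
    (+-monoʳ-≤ (density (irreduciblesUpTo d) n)
      (frac-≤ (length (irreducibles d) ℕ.* 2) 2 (order ℕ.^ (k ℕ.* d)) (order ℕ.^ d) {{order^≢0 (k ℕ.* d)}} {{order^≢0 d}} le))
    where
    d = suc y
    open ℕ.≤-Reasoning
    le : length (irreducibles d) ℕ.* 2 ℕ.* order ℕ.^ d ≤ 2 ℕ.* order ℕ.^ (k ℕ.* d)
    le = begin
      length (irreducibles d) ℕ.* 2 ℕ.* order ℕ.^ d
        ≤⟨ ℕ.*-monoˡ-≤ (order ℕ.^ d) (ℕ.*-monoˡ-≤ 2 (length-irreducibles d)) ⟩
      order ℕ.^ d ℕ.* 2 ℕ.* order ℕ.^ d
        ≡⟨ cong (ℕ._* order ℕ.^ d) (ℕ.*-comm (order ℕ.^ d) 2) ⟩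
      2 ℕ.* order ℕ.^ d ℕ.* order ℕ.^ d
        ≡⟨ ℕ.*-assoc 2 (order ℕ.^ d) (order ℕ.^ d) ⟩
      2 ℕ.* (order ℕ.^ d ℕ.* order ℕ.^ d)
        ≡⟨ cong (2 ℕ.*_) (ℕ.^-distribˡ-+-* order d d) ⟨
      2 ℕ.* order ℕ.^ (d ℕ.+ d)
        -- One factor `q^d` pays for the number of irreducibles, the other remains as the
        -- denominator of the error.
        ≤⟨ ℕ.*-monoʳ-≤ 2 (ℕ.^-monoʳ-≤ order (subst (_≤ k ℕ.* d) (cong (d ℕ.+_) (ℕ.+-identityʳ d)) (ℕ.*-monoˡ-≤ d 2≤k))) ⟩
      2 ℕ.* order ℕ.^ (k ℕ.* d) ∎

  error-halves : ∀ y → error (suc y) + error (suc y) ≤ℚ error y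
  error-halves y = subst (_≤ℚ error y) (sym (/order^-+ 2 2 (suc y)))
    (frac-≤ 4 2 (order ℕ.^ suc y) (order ℕ.^ y) {{order^≢0 (suc y)}} {{order^≢0 y}}
      (subst (4 ℕ.* order ℕ.^ y ≤_) (ℕ.*-assoc 2 order (order ℕ.^ y))
        (ℕ.*-monoˡ-≤ (order ℕ.^ y) (ℕ.*-monoʳ-≤ 2 1<order))))

  eulerProduct : ℕ → ℚ
  eulerProduct y = partialProduct (irreduciblesUpTo y)

  -- Both partial products are densities in every sufficiently large degree.
  product-step : ∀ y → eulerProduct (suc y) ≤ℚ eulerProduct y ×
                       eulerProduct y ≤ℚ eulerProduct (suc y) + error (suc y)
  product-step y = ≡.subst₂ _≤ℚ_ eq′ eq (density-step-≤ y n)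
                 , ≡.subst₂ (λ p p′ → p ≤ℚ p′ + error (suc y)) eq eq′ (density-step-≥ y n (s≤s z≤n))
    where
    E = threshold (irreduciblesUpTo y)
    E′ = threshold (irreduciblesUpTo (suc y))
    -- The sum reaches both thresholds, and the successor makes it positive, as `density-step-≥`
    -- requires.
    n = suc E ℕ.+ E′
    eq′ : density (irreduciblesUpTo (suc y)) n ≡ eulerProduct (suc y)
    eq′ = density≡product (upTo-unique (suc y)) (suc E)
    eq : density (irreduciblesUpTo y) n ≡ eulerProduct y
    eq = subst (λ z → density (irreduciblesUpTo y) z ≡ eulerProduct y) (cong suc (ℕ.+-comm E′ E))
      (density≡product (upTo-unique y) (suc E′))

-- Limits and asymptotics

+-cancelˡ-< : ∀ r {s t} → r + s <ℚ r + t → s <ℚ t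
+-cancelˡ-< r {s} {t} h = ≡.subst₂ _<ℚ_ (cancel s) (cancel t) (+-monoʳ-< (- r) h)
  where
  cancel : ∀ s → - r + (r + s) ≡ s
  cancel = solve 2 (λ r s → (:- r) :+ (r :+ s) := s) refl r

-- Limits of decreasing sequences with an explicit error

module Limit (p e : ℕ → ℚ)
  (decreasing : ∀ {y z} → y ≤ z → p z ≤ℚ p y)
  (close : ∀ {y z} → y ≤ z → p y ≤ℚ p z + e y)
  (small : ∀ δ → 0ℚ <ℚ δ → ∃[ y ] e y <ℚ δ) where

  -- Passing through the maximum of `y` and `z` treats both orders at once.
  close-any : ∀ y z → p y ≤ℚ p z + e y
  close-any y z = ≤-trans (close (ℕ.m≤m⊔n y z)) (+-monoˡ-≤ (e y) (decreasing (ℕ.m≤n⊔m y z)))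

  -- The limit lies in every interval from `p y - e y` to `p y`. A single index `y` is the witness
  -- on either side, which makes openness a matter of density of the rationals.
  L U : ℚ → Set
  L t = ∃[ y ] t + e y <ℚ p y
  U t = ∃[ y ] p y <ℚ t

  L⇒< : ∀ {t} → L t → ∀ z → t <ℚ p z
  L⇒< {t} (y , h) z = +-cancelˡ-< (e y) (begin-strict
    e y + t    ≡⟨ +-comm (e y) t ⟩
    t + e y    <⟨ h ⟩
    p y        ≤⟨ close-any y z ⟩
    p z + e y  ≡⟨ +-comm (p z) (e y) ⟩
    e y + p z  ∎)
    where open ≤-Reasoning

  limit : ℝ
  limit = record
    { Lower = L
    ; Upper = U
    ; lower-inhabited = p 0 - e 0 - 1ℚ , 0 , ≡.subst₂ _<ℚ_
        (solve 3 (λ p e o → p :- o := p :- e :- o :+ e) refl (p 0) (e 0) 1ℚ) (+-identityʳ (p 0))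
        (+-monoʳ-< (p 0) (negative⁻¹ (- 1ℚ)))
    ; upper-inhabited = p 0 + 1ℚ , 0 , subst (_<ℚ p 0 + 1ℚ) (+-identityʳ (p 0)) (+-monoʳ-< (p 0) (positive⁻¹ 1ℚ))
    ; lower-closed = λ s<t (y , h) → y , <-trans (+-monoˡ-< (e y) s<t) h
    ; lower-open = λ { {t} (y , h) → let m , t+e<m , m<p = <-dense h in
        m - e y
        , subst (_<ℚ m - e y) (solve 2 (λ t e → t :+ e :- e := t) refl t (e y)) (+-monoˡ-< (- e y) t+e<m)
        , y , subst (_<ℚ p y) (solve 2 (λ m e → m := m :- e :+ e) refl m (e y)) m<p }
    ; upper-closed = λ s<t (y , h) → y , <-trans h s<t
    ; upper-open = λ (y , h) → let m , p<m , m<t = <-dense h in m , m<t , y , p<m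
    ; disjoint = λ l (z , p<t) → <-asym (L⇒< l z) p<t
    ; located = located
    }
    where
    located : ∀ {s t} → s <ℚ t → L s ⊎ U t
    -- Once `e y < t - s`, failure of `p y < t` leaves `s + e y < t ≤ p y`.
    located {s} {t} s<t with small (t - s) (subst (_<ℚ t - s) (+-inverseʳ s) (+-monoˡ-< (- s) s<t))
    ... | y , e<t-s with p y <? t
    ...   | yes p<t = inj₂ (y , p<t)
    ...   | no p≮t = inj₁ (y , <-≤-trans (subst (s + e y <ℚ_) (solve 2 (λ s t → s :+ (t :- s) := t) refl s t)
                                            (+-monoʳ-< s e<t-s)) (≮⇒≥ p≮t))

  -- Both `r` and the limit lie between `p y - e y` and `p y`. The three cases are those of the
  -- lower cut of an absolute value: `t` negative, the limit above `r + t`, the limit below `r - t`.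
  ∣-∣-Lower : ∀ {r y t} → r ≤ℚ p y → p y ≤ℚ r + e y → 0ℚ ≤ℚ e y → ℝ.Lower ∣ r - limit ∣ t → t <ℚ e y
  ∣-∣-Lower r≤p p≤r+e 0≤e (inj₁ t<0) = <-≤-trans t<0 0≤e
  ∣-∣-Lower {r} {y} r≤p p≤r+e 0≤e (inj₂ (inj₁ l)) = +-cancelˡ-< r (<-≤-trans (L⇒< l y) p≤r+e)
  ∣-∣-Lower {r} {y} {t} r≤p p≤r+e 0≤e (inj₂ (inj₂ (z , p<r-t))) = +-cancelˡ-< (r - t) (begin-strict
    r - t + t      ≡⟨ solve 2 (λ r t → r :- t :+ t := r) refl r t ⟩
    r              ≤⟨ r≤p ⟩
    p y            ≤⟨ close-any y z ⟩
    p z + e y      <⟨ +-monoˡ-< (e y) p<r-t ⟩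
    r - t + e y    ∎)
    where open ≤-Reasoning

  -- For finite products over arbitrary index sets, known only to lie between two terms: `p z ≤ r`
  -- bounds the limit from above and `r ≤ p y` bounds it from below.
  ∣-∣-< : ∀ {r y z ε} → p z ≤ℚ r → r ≤ℚ p y → 0ℚ ≤ℚ e y → e y <ℚ ε → ∣ r - limit ∣ <ᴿ fromℚ ε
  ∣-∣-< {r} {y} {z} {ε} p≤r r≤p 0≤e e<ε with <-dense e<ε
  ... | q , e<q , q<ε = q , ((y , lower) , (z , upper)) , q<ε
    where
    open ≤-Reasoning
    lower : r - q + e y <ℚ p y
    lower = begin-strict
      r - q + e y    <⟨ +-monoʳ-< (r - q) e<q ⟩
      r - q + q      ≡⟨ solve 2 (λ r t → r :- t :+ t := r) refl r q ⟩
      r              ≤⟨ r≤p ⟩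
      p y            ∎
    upper : p z <ℚ r + q
    upper = ≤-<-trans p≤r (subst (_<ℚ r + q) (+-identityʳ r) (+-monoʳ-< r (≤-<-trans 0≤e e<q)))

-- Exponentials against powers, and rational exponents

n<2^n : ∀ n → n < 2 ℕ.^ n
n<2^n zero = s≤s z≤n
n<2^n (suc n) = begin-strict
  suc n                          ≤⟨ n<2^n n ⟩
  2 ℕ.^ n                        <⟨ ℕ.m<m+n (2 ℕ.^ n) (ℕ.<-≤-trans (ℕ.m^n>0 2 n) (ℕ.m≤m+n (2 ℕ.^ n) 0)) ⟩
  2 ℕ.^ n ℕ.+ (2 ℕ.^ n ℕ.+ 0)    ∎
  where open ℕ.≤-Reasoning

^-distrib-* : ∀ m n p → (m ℕ.* n) ℕ.^ p ≡ m ℕ.^ p ℕ.* n ℕ.^ p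
^-distrib-* m n zero = refl
^-distrib-* m n (suc p) = trans (cong (m ℕ.* n ℕ.*_) (^-distrib-* m n p))
  (ℕ.[m*n]*[o*p]≡[m*o]*[n*p] m n (m ℕ.^ p) (n ℕ.^ p))

-- With s = ⌊ y / p ⌋: suc y ≤ p (s + 1) ≤ p 2 ^ s, and 2 ^ (s p) ≤ 2 ^ y.
suc-^-≤ : ∀ p .{{_ : ℕ.NonZero p}} y → suc y ℕ.^ p ≤ p ℕ.^ p ℕ.* 2 ℕ.^ y
suc-^-≤ p y = begin
  suc y ℕ.^ p                    ≤⟨ ℕ.^-monoˡ-≤ p suc-y≤ ⟩
  (p ℕ.* 2 ℕ.^ s) ℕ.^ p          ≡⟨ ^-distrib-* p (2 ℕ.^ s) p ⟩
  p ℕ.^ p ℕ.* (2 ℕ.^ s) ℕ.^ p    ≡⟨ cong (p ℕ.^ p ℕ.*_) (ℕ.^-*-assoc 2 s p) ⟩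
  p ℕ.^ p ℕ.* 2 ℕ.^ (s ℕ.* p)    ≤⟨ ℕ.*-monoʳ-≤ (p ℕ.^ p) (ℕ.^-monoʳ-≤ 2 (ℕ.m/n*n≤m y p)) ⟩
  p ℕ.^ p ℕ.* 2 ℕ.^ y            ∎
  where
  open ℕ.≤-Reasoning
  s = y ℕ./ p
  suc-y≤ : suc y ≤ p ℕ.* 2 ℕ.^ s
  suc-y≤ = begin
    suc y                        ≡⟨ cong suc (ℕ.m≡m%n+[m/n]*n y p) ⟩
    suc (y ℕ.% p) ℕ.+ s ℕ.* p    ≤⟨ ℕ.+-monoˡ-≤ (s ℕ.* p) (ℕ.m%n<n y p) ⟩
    suc s ℕ.* p                  ≤⟨ ℕ.*-monoˡ-≤ p (n<2^n s) ⟩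
    2 ℕ.^ s ℕ.* p                ≡⟨ ℕ.*-comm (2 ℕ.^ s) p ⟩
    p ℕ.* 2 ℕ.^ s                ∎

crossing : ∀ (G : ℕ → ℕ) n → G 0 ≤ n → ∀ m → n < G m → ∃[ y ] G y ≤ n × n < G (suc y)
crossing G n G0≤n zero n<G0 = contradiction n<G0 (ℕ.≤⇒≯ G0≤n)
crossing G n G0≤n (suc m) n<G with G m ℕ.≤? n
... | yes Gm≤n = m , Gm≤n , n<G
... | no Gm≰n = crossing G n G0≤n m (ℕ.≰⇒> Gm≰n)

-- The rational separating `B` from 1 is such a fraction; `B > 0` excludes a negative numerator. The
-- gap between `p` and `suc r` later absorbs the logarithmic factor.
exponent<1 : ∀ B → fromℚ 0ℚ <ᴿ B → B <ᴿ fromℚ 1ℚ →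
             ∃[ p ] ∃[ r ] p < suc r × ℝ.Upper B (ℤ.+ p / suc r)
exponent<1 B (l , 0<l , l∈) (mkℚ (ℤ.+ p) d cop , u∈ , u<1) = p , d , p<suc-d , subst (ℝ.Upper B) u≡ u∈
  where
  u≡ : mkℚ (ℤ.+ p) d cop ≡ ℤ.+ p / suc d
  u≡ = sym (↥p/↧p≡p (mkℚ (ℤ.+ p) d cop))
  p<suc-d : p < suc d
  p<suc-d = ≡.subst₂ _<_ (ℕ.*-identityʳ p) (ℕ.*-identityˡ (suc d))
    (frac-<⁻¹ p 1 (suc d) 1 (subst (_<ℚ 1ℚ) u≡ u<1))
exponent<1 B (l , 0<l , l∈) (u@(mkℚ ℤ.-[1+ _ ] _ _) , u∈ , u<1) =
  contradiction u∈ (ℝ.disjoint B (ℝ.lower-closed B (<-trans (negative⁻¹ u) 0<l) l∈))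

≤-power : ∀ n r → n ≤ n ℕ.^ suc r
≤-power zero r = z≤n
≤-power (suc n) r = subst (_≤ suc n ℕ.^ suc r) (ℕ.^-identityʳ (suc n)) (ℕ.^-monoʳ-≤ (suc n) (s≤s (z≤n {r})))

-- Finite products of factors between 0 and 1

module _ {c ℓ} (S : Setoid c ℓ) (f : Setoid.Carrier S → ℚ)
  (f-cong : ∀ {x y} → Setoid._≈_ S x y → f x ≡ f y)
  (f≥0 : ∀ x → 0ℚ ≤ℚ f x) (f≤1 : ∀ x → f x ≤ℚ 1ℚ) where

  open UniqueSetoid S using (Unique)
  open Subset S using (_⊆_)

  private
    product : List (Setoid.Carrier S) → ℚ
    product xs = foldr _*_ 1ℚ (map f xs)

  product≥0 : ∀ xs → 0ℚ ≤ℚ product xs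
  product≥0 [] = nonNegative⁻¹ 1ℚ
  product≥0 (x ∷ xs) = subst (_≤ℚ f x * product xs) (*-zeroʳ (f x))
    (*-monoˡ-≤-nonNeg (f x) {{nonNegative (f≥0 x)}} (product≥0 xs))

  product-++-≤ : ∀ xs ys → product (xs ++ ys) ≤ℚ product xs
  product-++-≤ [] [] = ≤-refl
  product-++-≤ [] (y ∷ ys) = begin
    f y * product ys  ≤⟨ *-monoʳ-≤-nonNeg (product ys) {{nonNegative (product≥0 ys)}} (f≤1 y) ⟩
    1ℚ * product ys   ≡⟨ *-identityˡ (product ys) ⟩
    product ys        ≤⟨ product-++-≤ [] ys ⟩
    1ℚ                ∎
    where open ≤-Reasoning
  product-++-≤ (x ∷ xs) ys = *-monoˡ-≤-nonNeg (f x) {{nonNegative (f≥0 x)}} (product-++-≤ xs ys)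

  -- Up to order, `ys` is `xs` followed by further factors, each at most 1.
  product-antimono : ∀ {xs ys} → Unique xs → xs ⊆ ys → product ys ≤ℚ product xs
  product-antimono {xs} {ys} xs! xs⊆ys with unique-⊆⇒↭-++ S xs! xs⊆ys
  ... | zs , ys↭ = subst (_≤ℚ product xs)
    (sym (Perm.foldr-commMonoid (≡.setoid ℚ) *-1-isCommutativeMonoid (Perm.map⁺ S (≡.setoid ℚ) f-cong ys↭)))
    (product-++-≤ xs zs)

-- Enumeration of the power-free pairs

module PowerFreeCount {c ℓ₁ ℓ₂} (F : FiniteField c ℓ₁ ℓ₂)
  (1≉0 : ¬ FiniteField._≈_ F (FiniteField.1# F) (FiniteField.0# F))
  (k : ℕ) (2≤k : 2 ≤ k) (a : FiniteField.Carrier F)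
  (a≉0 : ¬ FiniteField._≈_ F a (FiniteField.0# F)) where

  open FiniteFieldPolynomials F 1≉0
  open RingDivisibility polyRing using (_^_)
  open IrreducibleLists F 1≉0
  open ResidueCounting F 1≉0
  open Density F 1≉0
  open PowerFreePairs F 1≉0 k 2≤k a a≉0
  private module R = CommutativeRing commutativeRing

  ^≡^ₚ : ∀ f n → f ^ n ≡ f ^ₚ n
  ^≡^ₚ f zero = refl
  ^≡^ₚ f (suc n) = cong (f *ₚ_) (^≡^ₚ f n)

  ^-cong : ∀ {f g} n → f ≋ g → f ^ n ≋ g ^ n
  ^-cong zero f≋g = ≋-refl
  ^-cong {f} {g} (suc n) f≋g = ≋-trans (*ₚ-congʳ (f ^ n) f≋g) (*ₚ-congˡ g (^-cong n f≋g))

  power∣⇒∣ᵖ : ∀ {P f} → poly P ^ₚ k ∣ f → poly P ^ k ∣ᵖ f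
  power∣⇒∣ᵖ {P} P^k∣f = ∣⇒∣ᵖ (subst (_∣ _) (sym (^≡^ₚ (poly P) k)) P^k∣f)

  power∣ᵖ⇒∣ : ∀ {P f} → poly P ^ k ∣ᵖ f → poly P ^ₚ k ∣ f
  power∣ᵖ⇒∣ {P} P^k∣f = subst (_∣ _) (^≡^ₚ (poly P) k) (∣ᵖ⇒∣ P^k∣f)

  powerFree⇒avoids : ∀ {f} → PowerFree k f → PowerFree k (f +ₚ constant a) → ∀ Ps → Avoids (residuesFor Ps) f
  powerFree⇒avoids free free′ [] = tt
  powerFree⇒avoids {f} free free′ (P ∷ Ps) =
    ((λ P^k∣f → free P (power∣ᵖ⇒∣ {P} (∣-respʳ (+ₚ-identityʳ f) P^k∣f))) , free′ P ∘ power∣ᵖ⇒∣ {P})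
    , powerFree⇒avoids free free′ Ps

  avoids⇒∤ : ∀ {f} Ps P → P ∈ᴵ Ps → Avoids (residuesFor Ps) f →
             ¬ poly P ^ k ∣ᵖ f × ¬ poly P ^ k ∣ᵖ f +ₚ constant a
  avoids⇒∤ {f} (Q ∷ Ps) P (here P≈Q) ((¬1 , ¬2) , _) =
    (λ P^k∣f → ¬1 (∣-respʳ (≋-sym (+ₚ-identityʳ f)) (∣-respˡ P^k≋Q^k P^k∣f))) , ¬2 ∘ ∣-respˡ P^k≋Q^k
    where
    P^k≋Q^k : poly P ^ k ≋ poly Q ^ k
    P^k≋Q^k = ^-cong k (mk≋ P≈Q)
  avoids⇒∤ (Q ∷ Ps) P (there P∈) (_ , av) = avoids⇒∤ Ps P P∈ av

  power∣⇒deg≤ : ∀ {n} P f → MonicOfDegree n f → poly P ^ k ∣ᵖ f → deg P ≤ n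
  power∣⇒deg≤ {n} P@(p , d , mp , _) f mf (h , eq) with quotient-monic h (p ^ k) f (monic-^ p k mp) mf eq
  ... | j , n≡ , _ = ℕ.≤-trans (deg≤k*deg P) (subst (k ℕ.* d ≤_) (sym n≡) (ℕ.m≤n+m (k ℕ.* d) j))

  monic-+a : ∀ {n} f → 1 ≤ n → MonicOfDegree n f → MonicOfDegree n (f +ₚ constant a)
  monic-+a f 1≤n mf = monic-+ f (constant a) mf (constant-below 1≤n)

  -- A power `P^k` dividing a monic polynomial of degree `n` has `deg P ≤ n`, so finitely many
  -- conditions decide power-freeness.
  avoids⇒powerFree : ∀ {n f} → 1 ≤ n → MonicOfDegree n f → Avoids (residuesFor (irreduciblesUpTo n)) f →
                     PowerFree k f × PowerFree k (f +ₚ constant a)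
  avoids⇒powerFree {n} {f} 1≤n mf av =
      (λ P P^k∣f → let P^k∣ᵖf = power∣⇒∣ᵖ {P} P^k∣f in
        proj₁ (∤ P (power∣⇒deg≤ P f mf P^k∣ᵖf)) P^k∣ᵖf)
    , (λ P P^k∣f → let P^k∣ᵖf = power∣⇒∣ᵖ {P} P^k∣f in
        proj₂ (∤ P (power∣⇒deg≤ P (f +ₚ constant a) (monic-+a f 1≤n mf) P^k∣ᵖf)) P^k∣ᵖf)
    where
    ∤ : ∀ P → deg P ≤ n → ¬ poly P ^ k ∣ᵖ f × ¬ poly P ^ k ∣ᵖ f +ₚ constant a
    ∤ P d≤n = avoids⇒∤ (irreduciblesUpTo n) P (upTo-complete n P d≤n) av

  -- In degree 0 the only candidate is f = 1, and 1 + a is not monic.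
  pairs : ℕ → List Poly
  pairs zero = []
  pairs (suc n) = filter (avoids? (residuesFor (irreduciblesUpTo (suc n)))) (monics (suc n))

  -- `MonicPowerFree` leaves the degree `d` of the sum open. For `d = 0` monicity forces `a = 0`;
  -- for positive `d` the coefficient that should be 1 is 0.
  1+a-not-monic : ∀ {d} f → MonicOfDegree 0 f → ¬ MonicOfDegree d (f +ₚ constant a)
  1+a-not-monic {zero} f (f₀≈1 , _) (lead , _) = a≉0 (begin
    a                   ≈⟨ R.+-identityˡ a ⟨
    0# R.+ a            ≈⟨ R.+-congʳ (R.-‿inverseˡ 1#) ⟨
    (R.- 1# R.+ 1#) R.+ a ≈⟨ R.+-assoc (R.- 1#) 1# a ⟩
    R.- 1# R.+ (1# R.+ a) ≈⟨ R.+-congˡ (R.+-congʳ f₀≈1) ⟨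
    R.- 1# R.+ (coeff f 0 R.+ a) ≈⟨ R.+-congˡ (coeff-+ f (constant a) 0) ⟨
    R.- 1# R.+ coeff (f +ₚ constant a) 0 ≈⟨ R.+-congˡ lead ⟩
    R.- 1# R.+ 1#       ≈⟨ R.-‿inverseˡ 1# ⟩
    0#                  ∎)
    where open import Relation.Binary.Reasoning.Setoid R.setoid
  1+a-not-monic {suc d} f (_ , b) (lead , _) = 1≉0 (begin
    1#                                   ≈⟨ lead ⟨
    coeff (f +ₚ constant a) (suc d)      ≈⟨ coeff-+ f (constant a) (suc d) ⟩
    coeff f (suc d) R.+ 0#               ≈⟨ R.+-identityʳ _ ⟩
    coeff f (suc d)                      ≈⟨ b (suc d) (s≤s z≤n) ⟩
    0#                                   ∎)
    where open import Relation.Binary.Reasoning.Setoid R.setoid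

  pairs-unique : ∀ n → Unique (pairs n)
  pairs-unique zero = []
  pairs-unique (suc n) = Uniq.filter⁺ ≋-setoid (avoids? (residuesFor (irreduciblesUpTo (suc n)))) (monics-unique (suc n))

  pairs-sound : ∀ n {f} → f ∈ pairs n → MonicOfDegree n f × MonicPowerFree k f × MonicPowerFree k (f +ₚ constant a)
  pairs-sound (suc n) {f} f∈ with Mem.∈-filter⁻ ≋-setoid (avoids? ρs) (avoids-resp ρs) {xs = monics (suc n)} f∈
    where ρs = residuesFor (irreduciblesUpTo (suc n))
  ... | f∈monics , av = mf , ((suc n , mf) , proj₁ free) , ((suc n , monic-+a f (s≤s z≤n) mf) , proj₂ free)
    where
    mf = monics-sound (suc n) f∈monics
    free = avoids⇒powerFree (s≤s z≤n) mf av

  pairs-complete : ∀ n {f} → MonicOfDegree n f × MonicPowerFree k f × MonicPowerFree k (f +ₚ constant a) → f ∈ pairs n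
  pairs-complete zero {f} (mf , _ , (d , mf+a) , _) = contradiction mf+a (1+a-not-monic f mf)
  pairs-complete (suc n) {f} (mf , (_ , free) , (_ , free′)) =
    Mem.∈-filter⁺ ≋-setoid (avoids? ρs) (avoids-resp ρs) (monics-complete (suc n) f mf)
      (powerFree⇒avoids free free′ (irreduciblesUpTo (suc n)))
    where ρs = residuesFor (irreduciblesUpTo (suc n))

  powerFreeCount : ℕ → ℕ
  powerFreeCount n = length (pairs n)

  powerFreeCount-cardinality : ∀ n → HasCardinality (powerFreePairs k a n) (powerFreeCount n)
  powerFreeCount-cardinality n = cardinality-list polySetoid
    (AllPairs.map (λ f≢g f≈g → f≢g (mk≋ f≈g)) (pairs-unique n))
    (λ {f} f∈ → pairs-sound n (Any.map (λ {g} f≈g → mk≋ {f} {g} f≈g) f∈))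
    (λ {f} m → Any.map at (pairs-complete n m))

private module ℚ^ = Exp (CommutativeRing.commutativeSemiring +-*-commutativeRing)

^ℚ≥0 : ∀ {x} n → 0ℚ ≤ℚ x → 0ℚ ≤ℚ x ^ℚ n
^ℚ≥0 zero 0≤x = nonNegative⁻¹ 1ℚ
^ℚ≥0 {x} (suc n) 0≤x = subst (_≤ℚ x * x ^ℚ n) (*-zeroʳ x) (*-monoˡ-≤-nonNeg x {{nonNegative 0≤x}} (^ℚ≥0 n 0≤x))

1^ℚ : ∀ n → 1ℚ ^ℚ n ≡ 1ℚ
1^ℚ zero = refl
1^ℚ (suc n) = trans (*-identityˡ (1ℚ ^ℚ n)) (1^ℚ n)

-- The form in which `negPower` expresses that `1 / M` is at most `n` to the exponent `- p / r`.
reciprocal-power-≤ : ∀ M n p r .{{_ : ℕ.NonZero M}} → n ℕ.^ p ≤ M ℕ.^ r → (ℤ.+ 1 / M) ^ℚ r * ι n ^ℚ p ≤ℚ 1ℚ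
reciprocal-power-≤ M n p r n^p≤M^r = begin
  s ^ℚ r * ι n ^ℚ p      ≡⟨ cong (s ^ℚ r *_) (ι-^ n p) ⟨
  s ^ℚ r * ι (n ℕ.^ p)   ≤⟨ *-monoˡ-≤-nonNeg (s ^ℚ r) {{nonNegative (^ℚ≥0 r (frac≥0 1 M))}} (ι-mono n^p≤M^r) ⟩
  s ^ℚ r * ι (M ℕ.^ r)   ≡⟨ cong (s ^ℚ r *_) (ι-^ M r) ⟩
  s ^ℚ r * ι M ^ℚ r      ≡⟨ ℚ^.^-distrib-* s (ι M) r ⟨
  (s * ι M) ^ℚ r         ≡⟨ cong (_^ℚ r) sM≡1 ⟩
  1ℚ ^ℚ r                ≡⟨ 1^ℚ r ⟩
  1ℚ                     ∎
  where
  open ≤-Reasoning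
  s = ℤ.+ 1 / M
  sM≡1 : s * ι M ≡ 1ℚ
  sM≡1 = trans (frac-* 1 M M 1) (frac-≡ (1 ℕ.* M) 1 (M ℕ.* 1) 1 {{ℕ.m*n≢0 M 1}}
    (trans (ℕ.*-identityʳ (1 ℕ.* M)) (cong (1 ℕ.*_) (sym (ℕ.*-identityʳ M)))))

ι-positive : ∀ b .{{_ : ℕ.NonZero b}} → Positive (ι b)
ι-positive b = positive (frac-< 0 b 1 1 (ℕ.*-monoˡ-< 1 (ℕ.>-nonZero⁻¹ b)))

-- Dividing by `b` gives `t / b < 1 / M`, and `1 / M` is at most `n` to the exponent `- p / suc r`;
-- as `p / suc r` exceeds `B`, this witnesses the lower cut.
scaled-negPower-lower : ∀ B (0<B : fromℚ 0ℚ <ᴿ B) n b M p r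
  .{{_ : ℕ.NonZero n}} .{{_ : ℕ.NonZero b}} .{{M≢0 : ℕ.NonZero M}} →
  ℝ.Upper B (ℤ.+ p / suc r) → n ℕ.^ p ≤ M ℕ.^ suc r →
  ∀ {t} → t <ℚ ℤ.+ b / M → ℝ.Lower (_·_ (ι b) {{ι-positive b}} (n ^-[ B , 0<B ])) t
scaled-negPower-lower B 0<B n b M p r {{M≢0 = M≢0}} B<p/r n^p≤ {t} t<b/M =
  s , p , r , 1/b*t<s , frac≥0 1 M , B<p/r , reciprocal-power-≤ M n p (suc r) n^p≤
  where
  open ≤-Reasoning
  s = ℤ.+ 1 / M
  instance
    ιb>0 = ι-positive b
    ιb≢0 = pos⇒nonZero (ι b)
  b/M≡ : ℤ.+ b / M ≡ ι b * s
  b/M≡ = trans (frac-≡ b (b ℕ.* 1) M (1 ℕ.* M) {{M≢0}} {{ℕ.m*n≢0 1 M}}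
    (cong₂ ℕ._*_ (sym (ℕ.*-identityʳ b)) (ℕ.*-identityˡ M))) (sym (frac-* b 1 1 M))
  1/b*t<s : 1/ ι b * t <ℚ s
  1/b*t<s = begin-strict
    1/ ι b * t          <⟨ *-monoʳ-<-pos (1/ ι b) {{1/pos⇒pos (ι b)}} t<b/M ⟩
    1/ ι b * (ℤ.+ b / M) ≡⟨ cong (1/ ι b *_) b/M≡ ⟩
    1/ ι b * (ι b * s)  ≡⟨ *-assoc (1/ ι b) (ι b) s ⟨
    1/ ι b * ι b * s    ≡⟨ cong (_* s) (*-inverseˡ (ι b)) ⟩
    1ℚ * s              ≡⟨ *-identityˡ s ⟩
    s                   ∎

-- Convergence of the Euler product and the error term

module Asymptotics {c ℓ₁ ℓ₂} (F : FiniteField c ℓ₁ ℓ₂)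
  (1≉0 : ¬ FiniteField._≈_ F (FiniteField.1# F) (FiniteField.0# F))
  (k : ℕ) (2≤k : 2 ≤ k) (a : FiniteField.Carrier F)
  (a≉0 : ¬ FiniteField._≈_ F a (FiniteField.0# F)) where

  open FiniteFieldPolynomials F 1≉0
  open IrreducibleLists F 1≉0
  open Density F 1≉0
  open PowerFreePairs F 1≉0 k 2≤k a a≉0
  open PowerFreeCount F 1≉0 k 2≤k a a≉0

  error≥0 : ∀ y → 0ℚ ≤ℚ error y
  error≥0 y = /order^≥0 2 y

  telescope : (p : ℕ → ℚ) → (∀ y → p y ≤ℚ p (suc y) + error (suc y)) →
              ∀ {y z} → y ≤ z → p y ≤ℚ p z + error y
  telescope p step {y} {z} y≤z = begin
    p y                        ≡⟨ +-identityʳ (p y) ⟨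
    p y + 0ℚ                   ≤⟨ +-monoʳ-≤ (p y) (error≥0 (z ℕ.∸ y ℕ.+ y)) ⟩
    p y + error (z ℕ.∸ y ℕ.+ y)   ≤⟨ sandwich-telescope p error step error-halves y (z ℕ.∸ y) ⟩
    p (z ℕ.∸ y ℕ.+ y) + error y   ≡⟨ cong (λ w → p w + error y) (ℕ.m∸n+n≡m y≤z) ⟩
    p z + error y              ∎
    where open ≤-Reasoning

  antitone : (p : ℕ → ℚ) → (∀ y → p (suc y) ≤ℚ p y) → ∀ {y z} → y ≤ z → p z ≤ℚ p y
  antitone p step {y} {z} y≤z = subst (λ w → p w ≤ℚ p y) (ℕ.m∸n+n≡m y≤z) (steps (z ℕ.∸ y))
    where
    steps : ∀ j → p (j ℕ.+ y) ≤ℚ p y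
    steps zero = ≤-refl
    steps (suc j) = ≤-trans (step (j ℕ.+ y)) (steps j)

  2^≤order^ : ∀ y → 2 ℕ.^ y ≤ order ℕ.^ y
  2^≤order^ y = ℕ.^-monoˡ-≤ y 1<order

  error-small : ∀ δ → 0ℚ <ℚ δ → ∃[ y ] error y <ℚ δ
  error-small δ@(mkℚ ℤ.+[1+ p ] d _) 0<δ = y , subst (error y <ℚ_) (↥p/↧p≡p δ)
    (frac-< 2 (suc p) (order ℕ.^ y) (suc d) {{order^≢0 y}} (begin-strict
      y                         <⟨ n<2^n y ⟩
      2 ℕ.^ y                   ≤⟨ 2^≤order^ y ⟩
      order ℕ.^ y               ≤⟨ ℕ.m≤n*m (order ℕ.^ y) (suc p) ⟩
      suc p ℕ.* order ℕ.^ y     ∎))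
    where
    open ℕ.≤-Reasoning
    -- Cross-multiplied, the goal is `2 (d + 1) < (p + 1) q^y`, so twice the denominator of `δ`
    -- suffices by `n<2^n`.
    y = 2 ℕ.* suc d
  error-small δ@(mkℚ (ℤ.+ zero) d _) 0<δ = contradiction (positive 0<δ) λ ()
  error-small δ@(mkℚ ℤ.-[1+ _ ] d _) 0<δ = contradiction (positive 0<δ) λ ()

  eulerProduct-antitone : ∀ {y z} → y ≤ z → eulerProduct z ≤ℚ eulerProduct y
  eulerProduct-antitone = antitone eulerProduct (proj₁ ∘ product-step)

  open Limit eulerProduct error eulerProduct-antitone (telescope eulerProduct (proj₂ ∘ product-step)) error-small
    public using () renaming (limit to infiniteProduct; ∣-∣-< to ∣-infiniteProduct∣-<; ∣-∣-Lower to ∣-infiniteProduct∣-Lower)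

  eulerFactor-cong : ∀ {P Q} → Setoid._≈_ monicIrreducibles P Q → eulerFactor k P ≡ eulerFactor k Q
  eulerFactor-cong {P} {Q} P≈Q = cong (λ d → 1ℚ - 2 /order^ (k ℕ.* d)) (deg-cong P Q P≈Q)

  eulerFactor≤1 : ∀ P → eulerFactor k P ≤ℚ 1ℚ
  eulerFactor≤1 P = subst (eulerFactor k P ≤ℚ_) (+-identityʳ 1ℚ)
    (+-monoʳ-≤ 1ℚ (neg-antimono-≤ (/order^≥0 2 (k ℕ.* deg P))))

  eulerFactor≥0 : ∀ P → 0ℚ ≤ℚ eulerFactor k P
  eulerFactor≥0 P = subst (_≤ℚ eulerFactor k P) (+-inverseʳ 1ℚ) (+-monoʳ-≤ 1ℚ (neg-antimono-≤
    (frac-≤ 2 1 (order ℕ.^ e) 1 {{order^≢0 e}} (begin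
      2                  ≤⟨ 1<order ⟩
      order              ≡⟨ ℕ.^-identityʳ order ⟨
      order ℕ.^ 1        ≤⟨ ℕ.^-monoʳ-≤ order (ℕ.≤-trans (deg-positive P) (deg≤k*deg P)) ⟩
      order ℕ.^ e        ≡⟨ ℕ.*-identityˡ (order ℕ.^ e) ⟨
      1 ℕ.* order ℕ.^ e  ∎))))
    where
    open ℕ.≤-Reasoning
    e = k ℕ.* deg P

  maxDegree : List MonicIrreducible → ℕ
  maxDegree = foldr (λ P n → deg P ℕ.⊔ n) 0

  deg≤maxDegree : ∀ P Ps → P ∈ᴵ Ps → deg P ≤ maxDegree Ps
  deg≤maxDegree P (Q ∷ Ps) (here P≈Q) =
    subst (_≤ deg Q ℕ.⊔ maxDegree Ps) (sym (deg-cong P Q P≈Q)) (ℕ.m≤m⊔n (deg Q) (maxDegree Ps))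
  deg≤maxDegree P (Q ∷ Ps) (there P∈) = ℕ.≤-trans (deg≤maxDegree P Ps P∈) (ℕ.m≤n⊔m (deg Q) (maxDegree Ps))

  -- A finite set containing all irreducibles up to degree `y` is itself contained in those up to
  -- its largest degree, so its product lies between two terms of the decreasing sequence.
  infiniteProduct-hasProduct : HasProduct monicIrreducibles (eulerFactor k) infiniteProduct
  infiniteProduct-hasProduct ε = irreduciblesUpTo y , upTo-unique y , λ js js! is⊆js →
    ∣-infiniteProduct∣-< {y = y} {z = maxDegree js}
      (antimono js! (λ {P} P∈ → upTo-complete (maxDegree js) P (deg≤maxDegree P js P∈)))
      (antimono (upTo-unique y) (λ {P} → is⊆js {P})) (error≥0 y) (proj₂ y-small)
    where
    y-small = error-small ε (positive⁻¹ ε)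
    y = proj₁ y-small
    antimono = product-antimono monicIrreducibles (eulerFactor k)
      (λ {P} {Q} → eulerFactor-cong {P} {Q}) eulerFactor≥0 eulerFactor≤1

  growth : ℕ → ℕ
  growth y = order ℕ.^ suc y ℕ.* (k ℕ.* y)

  -- The geometric sum costs one more factor `q`, because `2 q^(y+1) ≤ q q^(y+1)`.
  length-upTo : ∀ y → length (irreduciblesUpTo y) ≤ order ℕ.^ suc y
  length-upTo zero = z≤n
  length-upTo (suc y) = begin
    length (irreducibles (suc y) ++ irreduciblesUpTo y)
      ≡⟨ List.length-++ (irreducibles (suc y)) ⟩
    length (irreducibles (suc y)) ℕ.+ length (irreduciblesUpTo y)
      ≤⟨ ℕ.+-mono-≤ (length-irreducibles (suc y)) (length-upTo y) ⟩
    q ℕ.+ q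
      ≡⟨ cong (q ℕ.+_) (ℕ.+-identityʳ q) ⟨
    2 ℕ.* q
      ≤⟨ ℕ.*-monoˡ-≤ q 1<order ⟩
    order ℕ.* q ∎
    where
    open ℕ.≤-Reasoning
    q = order ℕ.^ suc y

  threshold-≤ : ∀ {y} Ps → All (λ P → deg P ≤ y) Ps → threshold Ps ≤ length Ps ℕ.* (k ℕ.* y)
  threshold-≤ [] [] = z≤n
  threshold-≤ (P ∷ Ps) (d≤y ∷ ds) = ℕ.+-mono-≤ (ℕ.*-monoʳ-≤ k d≤y) (threshold-≤ Ps ds)

  threshold≤growth : ∀ y → threshold (irreduciblesUpTo y) ≤ growth y
  threshold≤growth y = ℕ.≤-trans (threshold-≤ (irreduciblesUpTo y) (upTo-deg y)) (ℕ.*-monoˡ-≤ (k ℕ.* y) (length-upTo y))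

  k≢0 : ℕ.NonZero k
  k≢0 = ℕ.>-nonZero (ℕ.<-trans (s≤s z≤n) 2≤k)

  ≤growth : ∀ y → y ≤ growth y
  ≤growth y = ℕ.≤-trans (ℕ.m≤n*m y k {{k≢0}}) (ℕ.m≤n*m (k ℕ.* y) (order ℕ.^ suc y) {{order^≢0 (suc y)}})

  -- The count is the density for all irreducibles up to `n`, and the density for those up to `y` is
  -- exactly the partial product. Telescoping from `y` to `n` in the fixed degree `n` compares them.
  count-error : ∀ y n .{{_ : ℕ.NonZero n}} → growth y ≤ n →
    let r = powerFreeCount n /order^ n in r ≤ℚ eulerProduct y × eulerProduct y ≤ℚ r + error y
  count-error y n@(suc _) growth≤n =
      subst (density (irreduciblesUpTo n) n ≤ℚ_) exact (antitone (λ z → density (irreduciblesUpTo z) n) (λ z → density-step-≤ z n) y≤n)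
    , subst (_≤ℚ density (irreduciblesUpTo n) n + error y) exact
        (telescope (λ z → density (irreduciblesUpTo z) n) (λ z → density-step-≥ z n (s≤s z≤n)) y≤n)
    where
    y≤n = ℕ.≤-trans (≤growth y) growth≤n
    exact : density (irreduciblesUpTo y) n ≡ eulerProduct y
    exact = subst (λ z → density (irreduciblesUpTo y) z ≡ eulerProduct y)
      (ℕ.m∸n+n≡m (ℕ.≤-trans (threshold≤growth y) growth≤n))
      (density≡product (upTo-unique y) (n ℕ.∸ threshold (irreduciblesUpTo y)))

  -- Since `growth (suc y) = q² k · q^y · (y + 1)`, its `p`-th power contributes `(q² k)^p`; the
  -- factor `(p + 1)^(p + 1)` comes from `suc-^-≤` applied to `y + 1`.
  constantFor : ℕ → ℕ
  constantFor p = (order ℕ.* order ℕ.* k) ℕ.^ p ℕ.* suc p ℕ.^ suc p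

  constantFor≢0 : ∀ p → ℕ.NonZero (constantFor p)
  constantFor≢0 p = ℕ.m*n≢0 (c₀ ℕ.^ p) (suc p ℕ.^ suc p)
    {{ℕ.m^n≢0 c₀ p {{ℕ.m*n≢0 (order ℕ.* order) k {{ℕ.m*n≢0 order order}} {{k≢0}}}}}} {{ℕ.m^n≢0 (suc p) (suc p)}}
    where c₀ = order ℕ.* order ℕ.* k

  -- The factor `y + 1`, of logarithmic size in `n`, costs one extra power of `Q` after raising to
  -- `p`. The resulting exponent `p + 1` fits because `p < suc r`.
  power-growth : ∀ n y p r → n ≤ growth (suc y) → p < suc r →
                 n ℕ.^ p ≤ (constantFor p ℕ.* order ℕ.^ y) ℕ.^ suc r
  power-growth n y p r n≤ p<r = begin
    n ℕ.^ p
      ≤⟨ ℕ.^-monoˡ-≤ p n≤ ⟩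
    growth (suc y) ℕ.^ p
      ≡⟨ cong (ℕ._^ p) (ℕS.solve 4 (λ q Q k y → q ℕS.:* (q ℕS.:* Q) ℕS.:* (k ℕS.:* y)
           ℕS.:= q ℕS.:* q ℕS.:* k ℕS.:* (Q ℕS.:* y)) refl order Q k (suc y)) ⟩
    (c₀ ℕ.* (Q ℕ.* suc y)) ℕ.^ p
      ≡⟨ trans (^-distrib-* c₀ (Q ℕ.* suc y) p) (cong (c₀ ℕ.^ p ℕ.*_) (^-distrib-* Q (suc y) p)) ⟩
    c₀ ℕ.^ p ℕ.* (Q ℕ.^ p ℕ.* suc y ℕ.^ p)
      ≤⟨ ℕ.*-monoʳ-≤ (c₀ ℕ.^ p) (ℕ.*-monoʳ-≤ (Q ℕ.^ p) (begin
           -- Raised to `suc p` since `suc-^-≤` takes a nonzero exponent.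
           suc y ℕ.^ p              ≤⟨ ℕ.^-monoʳ-≤ (suc y) (ℕ.n≤1+n p) ⟩
           suc y ℕ.^ suc p          ≤⟨ suc-^-≤ (suc p) y ⟩
           b ℕ.* 2 ℕ.^ y            ≤⟨ ℕ.*-monoʳ-≤ b (2^≤order^ y) ⟩
           b ℕ.* Q                  ∎)) ⟩
    c₀ ℕ.^ p ℕ.* (Q ℕ.^ p ℕ.* (b ℕ.* Q))
      ≡⟨ ℕS.solve 4 (λ c R b Q → c ℕS.:* (R ℕS.:* (b ℕS.:* Q)) ℕS.:= c ℕS.:* b ℕS.:* (Q ℕS.:* R))
           refl (c₀ ℕ.^ p) (Q ℕ.^ p) b Q ⟩
    K ℕ.* Q ℕ.^ suc p
      ≤⟨ ℕ.*-mono-≤ (≤-power K r) (ℕ.^-monoʳ-≤ Q {{order^≢0 y}} p<r) ⟩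
    K ℕ.^ suc r ℕ.* Q ℕ.^ suc r
      ≡⟨ ^-distrib-* K Q (suc r) ⟨
    (K ℕ.* Q) ℕ.^ suc r ∎
    where
    open ℕ.≤-Reasoning
    module ℕS = ℕSolver.+-*-Solver
    c₀ = order ℕ.* order ℕ.* k
    Q = order ℕ.^ y
    b = suc p ℕ.^ suc p
    K = constantFor p

  constantFor*order^≢0 : ∀ p y → ℕ.NonZero (constantFor p ℕ.* order ℕ.^ y)
  constantFor*order^≢0 p y = ℕ.m*n≢0 (constantFor p) (order ℕ.^ y) {{constantFor≢0 p}} {{order^≢0 y}}

  -- Expanded by `constantFor p`, so that the denominator becomes the `M` whose power dominates
  -- `n^p`.
  error≡ : ∀ p y → error y ≡ (ℤ.+ (2 ℕ.* constantFor p) / (constantFor p ℕ.* order ℕ.^ y)) {{constantFor*order^≢0 p y}}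
  error≡ p y = frac-≡ 2 (2 ℕ.* K) (order ℕ.^ y) (K ℕ.* order ℕ.^ y) {{order^≢0 y}} {{constantFor*order^≢0 p y}}
    (sym (ℕ.*-assoc 2 K (order ℕ.^ y)))
    where K = constantFor p

  degree-range : ∀ n → ∃[ y ] growth y ≤ n × n < growth (suc y)
  -- The search starts at `suc n` because `n < suc n ≤ growth (suc n)`; it cannot fail at the
  -- bottom, where `growth 0` is 0.
  degree-range n = crossing growth n (subst (_≤ n) (sym growth0) z≤n) (suc n) (≤growth (suc n))
    where
    growth0 : growth 0 ≡ 0
    growth0 = trans (cong (order ℕ.^ 1 ℕ.*_) (ℕ.*-zeroʳ k)) (ℕ.*-zeroʳ (order ℕ.^ 1))

  distance<error : ∀ y n .{{_ : ℕ.NonZero n}} → growth y ≤ n →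
                   ∀ {t} → ℝ.Lower ∣ powerFreeCount n /order^ n - infiniteProduct ∣ t → t <ℚ error y
  distance<error y n growth≤n t∈ = let r≤p , p≤r+e = count-error y n growth≤n in
    ∣-infiniteProduct∣-Lower {powerFreeCount n /order^ n} {y} r≤p p≤r+e (error≥0 y) t∈

  asymptotic : (B : ℝ) (0<B : fromℚ 0ℚ <ᴿ B) → B <ᴿ fromℚ 1ℚ →
    Σ[ C ∈ ℚ ] Σ[ C>0 ∈ Positive C ] ∃[ n₀ ]
      (∀ n .{{_ : ℕ.NonZero n}} → n₀ ≤ n →
        ∣ powerFreeCount n /order^ n - infiniteProduct ∣ ≤ᴿ _·_ C {{C>0}} (n ^-[ B , 0<B ]))
  asymptotic B 0<B B<1 with exponent<1 B 0<B B<1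
  -- The estimate holds from `n = 1` on, so `n₀` is 0. The constant depends on `B` only through the
  -- chosen `p`.
  ... | p , r , p<r , B<p/r = ι b , ι-positive b {{b≢0}} , 0 , λ n _ → bound n
    where
    K = constantFor p
    b = 2 ℕ.* K
    b≢0 : ℕ.NonZero b
    b≢0 = ℕ.m*n≢0 2 K {{_}} {{constantFor≢0 p}}
    bound : ∀ n .{{_ : ℕ.NonZero n}} →
            ∣ powerFreeCount n /order^ n - infiniteProduct ∣ ≤ᴿ _·_ (ι b) {{ι-positive b {{b≢0}}}} (n ^-[ B , 0<B ])
    bound n {{n≢0}} t t∈ = let y , growth≤n , n<growth = degree-range n in
      scaled-negPower-lower B 0<B n b (K ℕ.* order ℕ.^ y) p r {{n≢0}} {{b≢0}} {{constantFor*order^≢0 p y}}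
        B<p/r (power-growth n y p r (ℕ.<⇒≤ n<growth) p<r)
        (subst (t <ℚ_) (error≡ p y) (distance<error y n growth≤n t∈))

corollary1p4 : ∀ {c ℓ₁ ℓ₂} (F : FiniteField c ℓ₁ ℓ₂) → let open OverFiniteField F in
    2 ∤ℕ order →
    (k : ℕ) → 2 ≤ k →
    (a : Carrier) → a # 0# →
    Σ[ count ∈ (ℕ → ℕ) ] (∀ n → HasCardinality (powerFreePairs k a n) (count n)) ×
    (Σ[ ∏ ∈ ℝ ] HasProduct monicIrreducibles (eulerFactor k) ∏ ×
    ((B : ℝ) (0<B : fromℚ 0ℚ <ᴿ B) → B <ᴿ fromℚ 1ℚ →
    Σ[ C ∈ ℚ ] Σ[ C>0 ∈ Positive C ] ∃[ n₀ ]
    (∀ n .{{_ : NonZero n}} → n₀ ≤ n →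
    ∣ count n /order^ n - ∏ ∣ ≤ᴿ _·_ C {{C>0}} (n ^-[ B , 0<B ]))))
corollary1p4 F _ k 2≤k a a#0 =
  powerFreeCount , powerFreeCount-cardinality , infiniteProduct , infiniteProduct-hasProduct , asymptotic
  where
  module R = CommutativeRing (FiniteField.commutativeRing F)
  a≉0 : ¬ a R.≈ R.0#
  a≉0 a≈0 = proj₂ (FiniteField.tight F a R.0#) a≈0 a#0
  1≉0 : ¬ R.1# R.≈ R.0#
  -- The nonzero `a` makes the field nontrivial: `a = a · 1` would vanish.
  1≉0 1≈0 = a≉0 (R.trans (R.sym (R.*-identityʳ a)) (R.trans (R.*-congˡ 1≈0) (R.zeroʳ a)))
  open PowerFreeCount F 1≉0 k 2≤k a a≉0
  open Asymptotics F 1≉0 k 2≤k a a≉0
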